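{- For positive integers $m,n$, the series $$S_{m,n}=\sum_{\substack{i\ge1\\ m\mid i}}\ \sum_{\substack{j\ge1\\ mn\mid ij}}\frac{\mu(j)}{i^2j\,\varphi(ij)}$$ converges and equals $$S_{m,n}=\frac{S}{m^3n^3}\prod_{p\mid n}\frac{ -p^4}{p^3-p-1}\prod_{\substack{p\mid m\\ p\nmid n}}\frac{p^3+p^2}{p^3-p-1},$$ where $S=\prod_{p\text{ prime}}\bigl(1-\frac{p}{p^3-1}\bigr)$ and products are over primes $p$.
   Context: $\mu$ is the Möbius function and $\varphi$ Euler's totient function. -}

module Defs where

open import Data.Bool using (if_then_else_)
open import Data.Integer as ℤ using (ℤ; +_; -[1+_]; 0ℤ; 1ℤ; -1ℤ)
open import Data.List using (List; filter; foldr; length; map; upTo)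
open import Data.List.Relation.Unary.Any using (any?)
open import Data.Nat as ℕ using (ℕ; zero; suc)
import Data.Nat.Properties as ℕP
open import Data.Nat.Coprimality using (coprime?)
open import Data.Nat.Divisibility using (_∣?_)
open import Data.Nat.Primality using (prime?)
open import Data.Product using (Σ; ∃; _×_; _,_)
open import Data.Rational as ℚ using (ℚ; 0ℚ; 1ℚ; ½; Positive)
open import Data.Rational.Properties as ℚP using (module ≤-Reasoning)
open import Data.Rational.Solver using (module +-*-Solver)
open import Data.Sum using (inj₁; inj₂)
open import Relation.Binary.PropositionalEquality
  using (_≡_; refl; sym; trans; cong; cong₂)
open import Relation.Nullary using (does; _×-dec_)
open import Relation.Unary using (Pred; Decidable)
open import Level using (0ℓ)

dist : ℚ → ℚ → ℚ
dist x y = ℚ.∣ x ℚ.- y ∣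

-- A real is a Cauchy sequence of rationals.  Representatives of the same real
-- need not be ≡; _≤ℝ_ and _⟶_ below do not distinguish them.

IsCauchy : (ℕ → ℚ) → Set
IsCauchy x = ∀ ε .{{_ : Positive ε}} →
  ∃ λ N → ∀ k l → N ℕ.≤ k → N ℕ.≤ l → ℚ.∣ x k ℚ.- x l ∣ ℚ.≤ ε

record ℝ : Set where
  constructor mkℝ
  field
    seq    : ℕ → ℚ
    cauchy : IsCauchy seq

open ℝ public

open +-*-Solver

half-pos : ∀ ε .{{_ : Positive ε}} → Positive (½ ℚ.* ε)
half-pos ε = ℚP.pos*pos⇒pos ½ ε

halves : ∀ ε → ½ ℚ.* ε ℚ.+ ½ ℚ.* ε ≡ ε
halves ε = trans (sym (ℚP.*-distribʳ-+ ε ½ ½)) (ℚP.*-identityˡ ε)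

≤∣∣ : ∀ p → p ℚ.≤ ℚ.∣ p ∣
≤∣∣ p with ℚP.≤-total 0ℚ p
... | inj₁ 0≤p = ℚP.≤-reflexive (sym (ℚP.0≤p⇒∣p∣≡p 0≤p))
... | inj₂ p≤0 = ℚP.≤-trans p≤0 (ℚP.0≤∣p∣ p)

∣∣-shift : ∀ p q → ℚ.∣ p ∣ ℚ.≤ ℚ.∣ q ∣ ℚ.+ dist p q
∣∣-shift p q = begin
  ℚ.∣ p ∣               ≡⟨ cong ℚ.∣_∣ (solve 2 (λ p q → p := q :+ (p :- q)) refl p q) ⟩
  ℚ.∣ q ℚ.+ (p ℚ.- q) ∣ ≤⟨ ℚP.∣p+q∣≤∣p∣+∣q∣ q (p ℚ.- q) ⟩
  ℚ.∣ q ∣ ℚ.+ dist p q  ∎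
  where open ≤-Reasoning

dist-sym : ∀ p q → dist p q ≡ dist q p
dist-sym p q = trans (sym (ℚP.∣-p∣≡∣p∣ (p ℚ.- q)))
  (cong ℚ.∣_∣ (solve 2 (λ p q → :- (p :- q) := q :- p) refl p q))

∣∣-diff : ∀ p q → ℚ.∣ p ∣ ℚ.- ℚ.∣ q ∣ ℚ.≤ dist p q
∣∣-diff p q = begin
  ℚ.∣ p ∣ ℚ.- ℚ.∣ q ∣                   ≤⟨ ℚP.+-monoˡ-≤ (ℚ.- ℚ.∣ q ∣) (∣∣-shift p q) ⟩
  (ℚ.∣ q ∣ ℚ.+ dist p q) ℚ.- ℚ.∣ q ∣    ≡⟨ solve 2 (λ a b → (a :+ b) :- a := b) refl ℚ.∣ q ∣ (dist p q) ⟩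
  dist p q                              ∎
  where open ≤-Reasoning

dist-∣∣ : ∀ p q → dist ℚ.∣ p ∣ ℚ.∣ q ∣ ℚ.≤ dist p q
dist-∣∣ p q with ℚP.∣p∣≡p∨∣p∣≡-p (ℚ.∣ p ∣ ℚ.- ℚ.∣ q ∣)
... | inj₁ eq = ℚP.≤-trans (ℚP.≤-reflexive eq) (∣∣-diff p q)
... | inj₂ eq = begin
  dist ℚ.∣ p ∣ ℚ.∣ q ∣          ≡⟨ eq ⟩
  ℚ.- (ℚ.∣ p ∣ ℚ.- ℚ.∣ q ∣)     ≡⟨ solve 2 (λ a b → :- (a :- b) := b :- a) refl ℚ.∣ p ∣ ℚ.∣ q ∣ ⟩
  ℚ.∣ q ∣ ℚ.- ℚ.∣ p ∣           ≤⟨ ∣∣-diff q p ⟩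
  dist q p                      ≡⟨ dist-sym q p ⟩
  dist p q                      ∎
  where open ≤-Reasoning

dist-+ : ∀ a b c d → dist (a ℚ.+ b) (c ℚ.+ d) ℚ.≤ dist a c ℚ.+ dist b d
dist-+ a b c d = begin
  dist (a ℚ.+ b) (c ℚ.+ d)            ≡⟨ cong ℚ.∣_∣ (solve 4 (λ a b c d →
                                           (a :+ b) :- (c :+ d) := (a :- c) :+ (b :- d)) refl a b c d) ⟩
  ℚ.∣ (a ℚ.- c) ℚ.+ (b ℚ.- d) ∣       ≤⟨ ℚP.∣p+q∣≤∣p∣+∣q∣ (a ℚ.- c) (b ℚ.- d) ⟩
  dist a c ℚ.+ dist b d               ∎
  where open ≤-Reasoning

dist-* : ∀ a b c d → dist (a ℚ.* b) (c ℚ.* d) ℚ.≤ ℚ.∣ a ∣ ℚ.* dist b d ℚ.+ ℚ.∣ d ∣ ℚ.* dist a c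
dist-* a b c d = begin
  dist (a ℚ.* b) (c ℚ.* d)                          ≡⟨ cong ℚ.∣_∣ (solve 4 (λ a b c d →
                                                         (a :* b) :- (c :* d) := a :* (b :- d) :+ d :* (a :- c)) refl a b c d) ⟩
  ℚ.∣ a ℚ.* (b ℚ.- d) ℚ.+ d ℚ.* (a ℚ.- c) ∣         ≤⟨ ℚP.∣p+q∣≤∣p∣+∣q∣ (a ℚ.* (b ℚ.- d)) (d ℚ.* (a ℚ.- c)) ⟩
  ℚ.∣ a ℚ.* (b ℚ.- d) ∣ ℚ.+ ℚ.∣ d ℚ.* (a ℚ.- c) ∣   ≡⟨ cong₂ ℚ._+_ (ℚP.∣p*q∣≡∣p∣*∣q∣ a (b ℚ.- d)) (ℚP.∣p*q∣≡∣p∣*∣q∣ d (a ℚ.- c)) ⟩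
  ℚ.∣ a ∣ ℚ.* dist b d ℚ.+ ℚ.∣ d ∣ ℚ.* dist a c     ∎
  where open ≤-Reasoning

*-mono-≤-abs : ∀ x y {A e} → ℚ.∣ x ∣ ℚ.≤ A → ℚ.∣ y ∣ ℚ.≤ e → ℚ.∣ x ∣ ℚ.* ℚ.∣ y ∣ ℚ.≤ A ℚ.* e
*-mono-≤-abs x y {A} {e} x≤A y≤e = begin
  ℚ.∣ x ∣ ℚ.* ℚ.∣ y ∣ ≤⟨ ℚP.*-monoʳ-≤-nonNeg ℚ.∣ y ∣ {{ℚ.nonNegative (ℚP.0≤∣p∣ y)}} x≤A ⟩
  A ℚ.* ℚ.∣ y ∣       ≤⟨ ℚP.*-monoˡ-≤-nonNeg A {{ℚ.nonNegative (ℚP.≤-trans (ℚP.0≤∣p∣ x) x≤A)}} y≤e ⟩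
  A ℚ.* e             ∎
  where open ≤-Reasoning

bounded : ∀ x → ∃ λ A → Positive A × ∃ λ N → ∀ k → N ℕ.≤ k → ℚ.∣ seq x k ∣ ℚ.≤ A
bounded x with cauchy x 1ℚ
... | N , close = ℚ.∣ seq x N ∣ ℚ.+ 1ℚ
    , ℚP.nonNeg+pos⇒pos ℚ.∣ seq x N ∣ {{ℚ.nonNegative (ℚP.0≤∣p∣ (seq x N))}} 1ℚ
    , N
    , λ k N≤k → ℚP.≤-trans (∣∣-shift (seq x k) (seq x N))
                  (ℚP.+-monoʳ-≤ ℚ.∣ seq x N ∣ (close k N N≤k ℕP.≤-refl))

shrink : ∀ ε .{{_ : Positive ε}} A .{{_ : Positive A}} →
  ∃ λ e → Positive e × A ℚ.* e ≡ ½ ℚ.* ε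
shrink ε A = (½ ℚ.* ε) ℚ.* A⁻¹
  , ℚP.pos*pos⇒pos (½ ℚ.* ε) {{half-pos ε}} A⁻¹ {{ℚP.1/pos⇒pos A}}
  , trans (solve 3 (λ a h b → a :* (h :* b) := h :* (a :* b)) refl A (½ ℚ.* ε) A⁻¹)
      (trans (cong ((½ ℚ.* ε) ℚ.*_) (ℚP.*-inverseʳ A {{ℚP.pos⇒nonZero A}}))
             (ℚP.*-identityʳ (½ ℚ.* ε)))
  where
  A⁻¹ : ℚ
  A⁻¹ = ℚ.1/_ A {{ℚP.pos⇒nonZero A}}

⊔ˡ : ∀ {a b k} → a ℕ.⊔ b ℕ.≤ k → a ℕ.≤ k
⊔ˡ {a} {b} = ℕP.m⊔n≤o⇒m≤o a b

⊔ʳ : ∀ {a b k} → a ℕ.⊔ b ℕ.≤ k → b ℕ.≤ k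
⊔ʳ {a} {b} = ℕP.m⊔n≤o⇒n≤o a b

+-cauchy : ∀ x y → IsCauchy (λ k → seq x k ℚ.+ seq y k)
+-cauchy x y ε
  with cauchy x (½ ℚ.* ε) {{half-pos ε}} | cauchy y (½ ℚ.* ε) {{half-pos ε}}
... | M , p | N , q = M ℕ.⊔ N , λ k l k≥ l≥ → begin
  dist (seq x k ℚ.+ seq y k) (seq x l ℚ.+ seq y l)       ≤⟨ dist-+ (seq x k) (seq y k) (seq x l) (seq y l) ⟩
  dist (seq x k) (seq x l) ℚ.+ dist (seq y k) (seq y l)  ≤⟨ ℚP.+-mono-≤ (p k l (⊔ˡ {M} {N} k≥) (⊔ˡ {M} {N} l≥))
                                                              (q k l (⊔ʳ {M} {N} k≥) (⊔ʳ {M} {N} l≥)) ⟩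
  ½ ℚ.* ε ℚ.+ ½ ℚ.* ε                                    ≡⟨ halves ε ⟩
  ε                                                      ∎
  where open ≤-Reasoning

neg-cauchy : ∀ x → IsCauchy (λ k → ℚ.- seq x k)
neg-cauchy x ε with cauchy x ε
... | N , p = N , λ k l k≥ l≥ → begin
  dist (ℚ.- seq x k) (ℚ.- seq x l)  ≡⟨ cong ℚ.∣_∣ (solve 2 (λ a b → :- a :- :- b := b :- a) refl (seq x k) (seq x l)) ⟩
  dist (seq x l) (seq x k)          ≤⟨ p l k l≥ k≥ ⟩
  ε                                 ∎
  where open ≤-Reasoning

abs-cauchy : ∀ x → IsCauchy (λ k → ℚ.∣ seq x k ∣)
abs-cauchy x ε with cauchy x ε
... | N , p = N , λ k l k≥ l≥ → ℚP.≤-trans (dist-∣∣ (seq x k) (seq x l)) (p k l k≥ l≥)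

dist-*-bound : ∀ {a b c d A B e f ε} → ℚ.∣ a ∣ ℚ.≤ A → ℚ.∣ d ∣ ℚ.≤ B →
  dist b d ℚ.≤ e → dist a c ℚ.≤ f → A ℚ.* e ≡ ½ ℚ.* ε → B ℚ.* f ≡ ½ ℚ.* ε →
  dist (a ℚ.* b) (c ℚ.* d) ℚ.≤ ε
dist-*-bound {a} {b} {c} {d} {A} {B} {e} {f} {ε} a≤A d≤B bd≤e ac≤f Ae Bf = begin
  dist (a ℚ.* b) (c ℚ.* d)                        ≤⟨ dist-* a b c d ⟩
  ℚ.∣ a ∣ ℚ.* dist b d ℚ.+ ℚ.∣ d ∣ ℚ.* dist a c   ≤⟨ ℚP.+-mono-≤ (*-mono-≤-abs a (b ℚ.- d) a≤A bd≤e)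
                                                       (*-mono-≤-abs d (a ℚ.- c) d≤B ac≤f) ⟩
  A ℚ.* e ℚ.+ B ℚ.* f                             ≡⟨ cong₂ ℚ._+_ Ae Bf ⟩
  ½ ℚ.* ε ℚ.+ ½ ℚ.* ε                             ≡⟨ halves ε ⟩
  ε                                               ∎
  where open ≤-Reasoning

*-cauchy : ∀ x y → IsCauchy (λ k → seq x k ℚ.* seq y k)
*-cauchy x y ε =
  let A , A>0 , K , x≤A = bounded x
      B , B>0 , L , y≤B = bounded y
      e , e>0 , Ae = shrink ε A {{A>0}}
      f , f>0 , Bf = shrink ε B {{B>0}}
      M , q = cauchy y e {{e>0}}
      N , p = cauchy x f {{f>0}}
  in (K ℕ.⊔ L) ℕ.⊔ (M ℕ.⊔ N) , λ k l k≥ l≥ →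
     let k≥′ = ⊔ʳ {K ℕ.⊔ L} {M ℕ.⊔ N} k≥
         l≥′ = ⊔ʳ {K ℕ.⊔ L} {M ℕ.⊔ N} l≥
     in dist-*-bound {seq x k} {seq y k} {seq x l} {seq y l} {A} {B} {e} {f} {ε}
          (x≤A k (⊔ˡ {K} {L} (⊔ˡ {K ℕ.⊔ L} {M ℕ.⊔ N} k≥)))
          (y≤B l (⊔ʳ {K} {L} (⊔ˡ {K ℕ.⊔ L} {M ℕ.⊔ N} l≥)))
          (q k l (⊔ˡ {M} {N} k≥′) (⊔ˡ {M} {N} l≥′))
          (p k l (⊔ʳ {M} {N} k≥′) (⊔ʳ {M} {N} l≥′))
          Ae Bf

infix  8 -ℝ_
infixl 7 _*ℝ_
infixl 6 _+ℝ_ _-ℝ_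
infix  4 _≤ℝ_ _⟶_

fromℚ : ℚ → ℝ
fromℚ q = mkℝ (λ _ → q) λ ε → 0 , λ _ _ _ _ →
  ℚP.≤-trans (ℚP.≤-reflexive (cong ℚ.∣_∣ (ℚP.+-inverseʳ q)))
             (ℚP.<⇒≤ (ℚP.positive⁻¹ ε))

0ℝ 1ℝ : ℝ
0ℝ = fromℚ 0ℚ
1ℝ = fromℚ 1ℚ

_+ℝ_ : ℝ → ℝ → ℝ
x +ℝ y = mkℝ (λ k → seq x k ℚ.+ seq y k) (+-cauchy x y)

_*ℝ_ : ℝ → ℝ → ℝ
x *ℝ y = mkℝ (λ k → seq x k ℚ.* seq y k) (*-cauchy x y)

-ℝ_ : ℝ → ℝ
-ℝ x = mkℝ (λ k → ℚ.- seq x k) (neg-cauchy x)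

_-ℝ_ : ℝ → ℝ → ℝ
x -ℝ y = x +ℝ (-ℝ y)

∣_∣ℝ : ℝ → ℝ
∣ x ∣ℝ = mkℝ (λ k → ℚ.∣ seq x k ∣) (abs-cauchy x)

_≤ℝ_ : ℝ → ℝ → Set
x ≤ℝ y = ∀ δ .{{_ : Positive δ}} → ∃ λ N → ∀ k → N ℕ.≤ k → seq x k ℚ.≤ seq y k ℚ.+ δ

_⟶_ : (ℕ → ℝ) → ℝ → Set
x ⟶ L = ∀ ε .{{_ : Positive ε}} → ∃ λ N → ∀ k → N ℕ.≤ k → ∣ x k -ℝ L ∣ℝ ≤ℝ fromℚ ε

-- Division by zero is given the value 0; every denominator in the theorem
-- is nonzero.
infixl 7 _//_
_//_ : ℤ → ℤ → ℝ
a // (+ zero)  = 0ℝ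
a // (+ suc d) = fromℚ (a ℚ./ suc d)
a // -[1+ d ]  = fromℚ ((ℤ.- a) ℚ./ suc d)

∑ ∏ : List ℕ → (ℕ → ℝ) → ℝ
∑ ks f = foldr (λ k s → f k +ℝ s) 0ℝ ks
∏ ks f = foldr (λ k s → f k *ℝ s) 1ℝ ks

[1‥_] : ℕ → List ℕ
[1‥ N ] = map suc (upTo N)

module _ {P : Pred ℕ 0ℓ} (P? : Decidable P) where

  HasSum HasProduct : (ℕ → ℝ) → ℝ → Set
  HasSum     f L = (λ N → ∑ (filter P? [1‥ N ]) f) ⟶ L
  HasProduct f L = (λ N → ∏ (filter P? [1‥ N ]) f) ⟶ L

-- The iterated series ∑_{i : P i} ∑_{j : Q i j} t i j, over i, j ≥ 1, has sum L:
-- every inner series converges, and the series of inner sums converges to L.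
HasIteratedSum : {P : Pred ℕ 0ℓ} {Q : ℕ → Pred ℕ 0ℓ} →
  Decidable P → (∀ i → Decidable (Q i)) → (ℕ → ℕ → ℝ) → ℝ → Set
HasIteratedSum {P} P? Q? t L = Σ (ℕ → ℝ) λ T →
  (∀ i .{{_ : ℕ.NonZero i}} → P i → HasSum (Q? i) (t i) (T i)) × HasSum P? T L

primeDivisors : ℕ → List ℕ
primeDivisors n = filter (λ p → prime? p ×-dec p ∣? n) [1‥ n ]

φ : ℕ → ℕ
φ n = length (filter (coprime? n) [1‥ n ])

-- Only meaningful for n ≥ 1.
μ : ℕ → ℤ
μ n = if does (any? (λ p → p ℕ.^ 2 ∣? n) (primeDivisors n))
      then 0ℤ
      else -1ℤ ℤ.^ length (primeDivisors n)

module Submission where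

-- The double series converges absolutely, because 2 φ(k)² ≥ k bounds the summand by
-- decay(i) decay(j) with decay(k) of order k^(-3/2).  Hence dilations i ↦ p i and j ↦ p j may be
-- performed up to an error that vanishes with the size of the box of summation.
--
-- Let Z be the sum over pairs (i , j) without prime factors ≤ K, for m and n coprime to
-- all primes ≤ K, let p = K + 1 be prime, m = p^α m′, n = p^β n′, and let U be the sum for
-- m′, n′ over the pairs with p ∤ i j.  Since φ(p k) is p φ(k) or (p - 1) φ(k), the sums W(a)
-- and X(a) over p^a ∣ i, with p ∤ j and p ∥ j respectively, satisfy
--   p³ W(a+1) = W(a)  (a ≥ 1),   (p - 1)(p³ - 1) W(1) = p U,
--   p³ X(a+1) = X(a),            p² X(1) = - W(1),
-- and Z is W(α) + X(α) if β = 0 and W(α+β) + X(α+β-1) otherwise.  So Z is U times the Euler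
-- factor at p.  Sieving by all p ≤ K leaves the pair (1 , 1) and pairs with a coordinate > K,
-- whose contribution tends to 0 as K grows.

-- Because φ(ij) couples i and j, the double series is no product of two single series, so
-- multiplicativity does not yield an Euler product at once; each prime has to be removed from both
-- variables together. None of the auxiliary series W, X, U, Z is ever given a value. Relations
-- between them are kept as statements that a linear combination of summands is `Null`: its sums
-- over I by J boxes tend to 0 as I and J grow independently. Such relations add and scale, so
-- solving for Z in terms of U is plain linear algebra, and no limit has to be constructed inside
-- the sieve. Limits enter only at the end. Reals are Cauchy sequences of rationals, and the claimed
-- value has been set up so that, for K ≥ m and K ≥ n, its K-th approximation is exactly the
-- constant produced by sieving with all primes up to K. It then suffices that the remaining rough
-- sum is close to 1, uniformly in all boxes with sides at least K. The weak bound on φ is enough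
-- for absolute convergence and has an elementary proof by removing one prime factor at a time;
-- integer square roots keep the majorant rational.

module Arithmetic where

  open import Defs using ([1‥_]; primeDivisors; φ; μ)
  open import Algebra.Structures using (IsCommutativeMonoid)
  open import Data.Bool using (if_then_else_)
  open import Data.Integer as ℤ using (0ℤ; -1ℤ)
  import Data.Integer.Properties as ℤP
  open import Data.List using (List; []; _∷_; filter; foldr; length; map; upTo; _∷ʳ_)
  open import Data.List.Properties using (map-++; upTo-∷ʳ)
  open import Data.List.Membership.Propositional using (_∈_; find; lose)
  open import Data.List.Membership.Propositional.Properties
    using (∈-filter⁺; ∈-filter⁻; ∈-map⁺; ∈-upTo⁺)
  open import Data.List.Relation.Unary.All using (_∷_)
  open import Data.List.Relation.Unary.Any using (Any; any?)
  open import Data.Nat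
  open import Data.Nat.Coprimality as Coprimality using (Coprime; coprime?; coprime-divisor)
  open import Data.Nat.Divisibility
  open import Data.Nat.DivMod using (m≡m%n+[m/n]*n; m%n<n)
  open import Data.Nat.Induction using (<-rec)
  open import Data.Nat.Primality
  open import Data.Nat.Primality.Factorisation using (factorise)
  open import Data.Nat.Properties
  open import Data.Nat.Tactic.RingSolver using (solve-∀)
  open import Data.Product using (∃; _×_; _,_; proj₁; proj₂)
  open import Data.Sum using (inj₁; inj₂; [_,_]′)
  open import Function using (_∘_)
  open import Relation.Binary.PropositionalEquality
  open import Relation.Nullary using (¬_; Dec; yes; no; does; contradiction; _×-dec_)
  open import Relation.Nullary.Decidable using (dec-true; dec-false; does-⇔)
  open import Relation.Unary using (Pred; Decidable)
  open import Function.Bundles using (mk⇔)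
  open import Level using (0ℓ)

  -- Folds over 1, ..., N in a commutative monoid

  module RangeFold {A : Set} {_∙_ : A → A → A} {ε : A}
                   (isCM : IsCommutativeMonoid _≡_ _∙_ ε) where

    open IsCommutativeMonoid isCM using (assoc; comm; identityˡ; identityʳ)
    open ≡-Reasoning

    fold : (ℕ → A) → ℕ → A
    fold f zero    = ε
    fold f (suc N) = fold f N ∙ f (suc N)

    -- Replacing filters by guards lets every fold run over a full interval, so that conditions can
    -- be compared, nested and exchanged one index at a time. Only the Boolean of the decision
    -- enters, hence logically equivalent conditions give equal guards.
    guard : {P : Set} → Dec P → A → A
    guard d x = if does d then x else ε

    guard-yes : ∀ {P : Set} {d : Dec P} {x} → P → guard d x ≡ x
    guard-yes {d = d} {x} p rewrite dec-true d p = refl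

    guard-no : ∀ {P : Set} {d : Dec P} {x} → ¬ P → guard d x ≡ ε
    guard-no {d = d} {x} p rewrite dec-false d p = refl

    guard-cong : ∀ {P Q : Set} {d : Dec P} {e : Dec Q} {x} →
      (P → Q) → (Q → P) → guard d x ≡ guard e x
    guard-cong {d = d} {e} {x} to from = cong (λ b → if b then x else ε) (does-⇔ (mk⇔ to from) d e)

    fold-cong≤ : ∀ {f g} N → (∀ k → .{{NonZero k}} → k ≤ N → f k ≡ g k) → fold f N ≡ fold g N
    fold-cong≤ zero    h = refl
    fold-cong≤ (suc N) h = cong₂ _∙_ (fold-cong≤ N λ k k≤N → h k (m≤n⇒m≤1+n k≤N)) (h (suc N) ≤-refl)

    fold-cong : ∀ {f g} → (∀ k → .{{NonZero k}} → f k ≡ g k) → ∀ N → fold f N ≡ fold g N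
    fold-cong h N = fold-cong≤ N λ k _ → h k

    fold-ε : ∀ {f} N → (∀ k → .{{NonZero k}} → k ≤ N → f k ≡ ε) → fold f N ≡ ε
    fold-ε zero    h = refl
    fold-ε (suc N) h = trans
      (cong₂ _∙_ (fold-ε N λ k k≤N → h k (m≤n⇒m≤1+n k≤N)) (h (suc N) ≤-refl)) (identityˡ ε)

    interchange : ∀ a b c d → (a ∙ b) ∙ (c ∙ d) ≡ (a ∙ c) ∙ (b ∙ d)
    interchange a b c d = begin
      (a ∙ b) ∙ (c ∙ d) ≡⟨ assoc a b _ ⟩
      a ∙ (b ∙ (c ∙ d)) ≡⟨ cong (a ∙_) (sym (assoc b c d)) ⟩
      a ∙ ((b ∙ c) ∙ d) ≡⟨ cong (λ z → a ∙ (z ∙ d)) (comm b c) ⟩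
      a ∙ ((c ∙ b) ∙ d) ≡⟨ cong (a ∙_) (assoc c b d) ⟩
      a ∙ (c ∙ (b ∙ d)) ≡⟨ sym (assoc a c _) ⟩
      (a ∙ c) ∙ (b ∙ d) ∎

    fold-∙ : ∀ (f g : ℕ → A) N → fold (λ k → f k ∙ g k) N ≡ fold f N ∙ fold g N
    fold-∙ f g zero    = sym (identityˡ ε)
    fold-∙ f g (suc N) = trans (cong (_∙ (f (suc N) ∙ g (suc N))) (fold-∙ f g N))
      (interchange (fold f N) (fold g N) (f (suc N)) (g (suc N)))

    fold-+ : ∀ (f : ℕ → A) M N → fold f (M + N) ≡ fold f M ∙ fold (λ k → f (M + k)) N
    fold-+ f M zero    = trans (cong (fold f) (+-identityʳ M)) (sym (identityʳ _))
    fold-+ f M (suc N) = begin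
      fold f (M + suc N)                                     ≡⟨ cong (fold f) (+-suc M N) ⟩
      fold f (M + N) ∙ f (suc (M + N))                       ≡⟨ cong₂ _∙_ (fold-+ f M N) (cong f (sym (+-suc M N))) ⟩
      (fold f M ∙ fold (λ k → f (M + k)) N) ∙ f (M + suc N)  ≡⟨ assoc _ _ _ ⟩
      fold f M ∙ fold (λ k → f (M + k)) (suc N)              ∎

    fold-extend : ∀ {f : ℕ → A} {M N} → M ≤ N → (∀ k → M < k → f k ≡ ε) → fold f N ≡ fold f M
    fold-extend {f} {M} {N} M≤N h = begin
      fold f N                                    ≡⟨ cong (fold f) (sym (m+[n∸m]≡n M≤N)) ⟩
      fold f (M + (N ∸ M))                        ≡⟨ fold-+ f M (N ∸ M) ⟩
      fold f M ∙ fold (λ k → f (M + k)) (N ∸ M)   ≡⟨ cong (fold f M ∙_) (fold-ε (N ∸ M)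
                                                       λ { (suc k) _ → h _ (m<m+n M z<s) }) ⟩
      fold f M ∙ ε                                ≡⟨ identityʳ _ ⟩
      fold f M                                    ∎

    fold-single : ∀ {f : ℕ → A} p .{{_ : NonZero p}} {N} → p ≤ N → (∀ k → k ≢ p → f k ≡ ε) → fold f N ≡ f p
    fold-single {f} (suc p) {N} p≤N h = begin
      fold f N             ≡⟨ fold-extend p≤N (λ k p<k → h k λ { refl → <-irrefl refl p<k }) ⟩
      fold f p ∙ f (suc p) ≡⟨ cong (_∙ f (suc p)) (fold-ε p λ k k≤p → h k λ { refl → <-irrefl refl k≤p }) ⟩
      ε ∙ f (suc p)        ≡⟨ identityˡ _ ⟩
      f (suc p)            ∎

    -- Each block of p consecutive indices ending at a multiple of p contains exactly one multiple,
    -- namely its last element.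
    fold-multiples-exact : ∀ p .{{_ : NonZero p}} (f : ℕ → A) q →
      fold (λ k → guard (p ∣? k) (f k)) (q * p) ≡ fold (λ k → f (p * k)) q
    fold-multiples-exact p f zero = refl
    fold-multiples-exact p@(suc p′) f (suc q) = begin
      fold h (p + q * p)                                       ≡⟨ cong (fold h) (+-comm p (q * p)) ⟩
      fold h (q * p + p)                                       ≡⟨ fold-+ h (q * p) p ⟩
      fold h (q * p) ∙ (fold (λ k → h (q * p + k)) p′ ∙ h (q * p + p))
        ≡⟨ cong₂ (λ a b → a ∙ b) (fold-multiples-exact p f q)
             (cong₂ _∙_ (fold-ε p′ λ k k≤p′ → guard-no {d = p ∣? (q * p + k)} λ p∣ →
                           >⇒∤ (s≤s k≤p′) (∣m+n∣m⇒∣n p∣ (n∣m*n q)))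
                        (guard-yes {d = p ∣? (q * p + p)} (∣m∣n⇒∣m+n (n∣m*n q) ∣-refl))) ⟩
      fold (λ k → f (p * k)) q ∙ (ε ∙ f (q * p + p))           ≡⟨ cong (fold (λ k → f (p * k)) q ∙_) (identityˡ _) ⟩
      fold (λ k → f (p * k)) q ∙ f (q * p + p)
        ≡⟨ cong (λ z → fold (λ k → f (p * k)) q ∙ f z)
             (trans (+-comm (q * p) p) (trans (cong (p +_) (*-comm q p)) (sym (*-suc p q)))) ⟩
      fold (λ k → f (p * k)) (suc q)                           ∎
      where h = λ k → guard (p ∣? k) (f k)

    -- After the complete blocks there remain N % p < p indices, none of them divisible by p.
    fold-multiples : ∀ p .{{_ : NonZero p}} (f : ℕ → A) N →
      fold (λ k → guard (p ∣? k) (f k)) N ≡ fold (λ k → f (p * k)) (N / p)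
    fold-multiples p f N = begin
      fold h N                                                 ≡⟨ cong (fold h) (trans (m≡m%n+[m/n]*n N p) (+-comm (N % p) _)) ⟩
      fold h (N / p * p + N % p)                               ≡⟨ fold-+ h (N / p * p) (N % p) ⟩
      fold h (N / p * p) ∙ fold (λ k → h (N / p * p + k)) (N % p)
        ≡⟨ cong₂ _∙_ (fold-multiples-exact p f (N / p))
             (fold-ε (N % p) λ k k≤ → guard-no {d = p ∣? (N / p * p + k)} λ p∣ →
                >⇒∤ (≤-<-trans k≤ (m%n<n N p)) (∣m+n∣m⇒∣n p∣ (n∣m*n (N / p)))) ⟩
      fold (λ k → f (p * k)) (N / p) ∙ ε                       ≡⟨ identityʳ _ ⟩
      fold (λ k → f (p * k)) (N / p)                           ∎
      where h = λ k → guard (p ∣? k) (f k)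

    foldr-filter : ∀ {P : Pred ℕ 0ℓ} (P? : Decidable P) (f : ℕ → A) ks →
      foldr (λ k s → f k ∙ s) ε (filter P? ks) ≡ foldr (λ k s → guard (P? k) (f k) ∙ s) ε ks
    foldr-filter P? f []       = refl
    foldr-filter P? f (k ∷ ks) with P? k
    ... | yes _ = cong (f k ∙_) (foldr-filter P? f ks)
    ... | no _  = trans (foldr-filter P? f ks) (sym (identityˡ _))

    foldr-snoc : ∀ (f : ℕ → A) (ks : List ℕ) x →
      foldr (λ k s → f k ∙ s) ε (ks ∷ʳ x) ≡ foldr (λ k s → f k ∙ s) ε ks ∙ f x
    foldr-snoc f []       x = comm (f x) ε
    foldr-snoc f (k ∷ ks) x = trans (cong (f k ∙_) (foldr-snoc f ks x)) (sym (assoc _ _ _))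

    foldr-range : ∀ (f : ℕ → A) N → foldr (λ k s → f k ∙ s) ε [1‥ N ] ≡ fold f N
    foldr-range f zero    = refl
    foldr-range f (suc N) = begin
      foldr (λ k s → f k ∙ s) ε (map suc (upTo (suc N)))    ≡⟨ cong (foldr _ ε ∘ map suc) (sym (upTo-∷ʳ N)) ⟩
      foldr (λ k s → f k ∙ s) ε (map suc (upTo N ∷ʳ N))     ≡⟨ cong (foldr _ ε) (map-++ suc (upTo N) (N ∷ [])) ⟩
      foldr (λ k s → f k ∙ s) ε ([1‥ N ] ∷ʳ suc N)          ≡⟨ foldr-snoc f [1‥ N ] (suc N) ⟩
      foldr (λ k s → f k ∙ s) ε [1‥ N ] ∙ f (suc N)         ≡⟨ cong (_∙ f (suc N)) (foldr-range f N) ⟩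
      fold f (suc N)                                        ∎

    foldr-filter-range : ∀ {P : Pred ℕ 0ℓ} (P? : Decidable P) (f : ℕ → A) N →
      foldr (λ k s → f k ∙ s) ε (filter P? [1‥ N ]) ≡ fold (λ k → guard (P? k) (f k)) N
    foldr-filter-range P? f N = trans (foldr-filter P? f [1‥ N ]) (foldr-range _ N)

  open RangeFold +-0-isCommutativeMonoid public using () renaming
    (fold to ∑ℕ; guard to guardℕ; guard-yes to guardℕ-yes; guard-no to guardℕ-no; guard-cong to guardℕ-cong;
     fold-cong to ∑ℕ-cong; fold-∙ to ∑ℕ-+; fold-+ to ∑ℕ-split; fold-extend to ∑ℕ-extend;
     fold-single to ∑ℕ-single; fold-multiples-exact to ∑ℕ-multiples;
     foldr-filter-range to foldrℕ-filter-range)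

  ♯ : {P : Set} → Dec P → ℕ
  ♯ d = guardℕ d 1

  length-filter-range : ∀ {P : Pred ℕ 0ℓ} (P? : Decidable P) N →
    length (filter P? [1‥ N ]) ≡ ∑ℕ (λ k → ♯ (P? k)) N
  length-filter-range P? N = trans (length≡foldr (filter P? [1‥ N ])) (foldrℕ-filter-range P? (λ _ → 1) N)
    where
    length≡foldr : (ks : List ℕ) → length ks ≡ foldr (λ _ s → 1 + s) 0 ks
    length≡foldr []       = refl
    length≡foldr (_ ∷ ks) = cong suc (length≡foldr ks)

  -- Primes and coprimality

  ∃-prime-divisor : ∀ n → 1 < n → ∃ λ p → Prime p × p ∣ n
  ∃-prime-divisor (suc zero) (s≤s ())
  ∃-prime-divisor n@(suc (suc _)) 1<n with factorise n
  ... | record { factors = []     ; isFactorisation = eq }                   = contradiction eq λ ()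
  ... | record { factors = p ∷ ps ; isFactorisation = eq ; factorsPrime = pr ∷ _ } =
    p , pr , subst (p ∣_) (sym eq) (m∣m*n _)

  distinct-primes : ∀ {p q} → Prime p → Prime q → q ∣ p → q ≡ p
  distinct-primes pp pq q∣p with prime⇒irreducible pp q∣p
  ... | inj₁ refl = contradiction pq ¬prime[1]
  ... | inj₂ q≡p  = q≡p

  ∤⇒coprime : ∀ {p} → Prime p → ∀ {k} → p ∤ k → Coprime p k
  ∤⇒coprime pp p∤k (d∣p , d∣k) with prime⇒irreducible pp d∣p
  ... | inj₁ d≡1  = d≡1
  ... | inj₂ refl = contradiction d∣k p∤k

  coprime-* : ∀ {a b k} → Coprime a k → Coprime b k → Coprime (a * b) k
  coprime-* ca cb (d∣ab , d∣k) =
    cb (coprime-divisor (λ (e∣d , e∣a) → ca (e∣a , ∣-trans e∣d d∣k)) d∣ab , d∣k)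

  coprime-*ʳ : ∀ a {b k} → Coprime (a * b) k → Coprime b k
  coprime-*ʳ a c (d∣b , d∣k) = c (∣n⇒∣m*n a d∣b , d∣k)

  -- Euler's totient function

  coprimes : ℕ → ℕ → ℕ
  coprimes n k = ♯ (coprime? n k)

  φ≡∑ : ∀ n → φ n ≡ ∑ℕ (coprimes n) n
  φ≡∑ n = length-filter-range (coprime? n) n

  -- Coprimality to n depends only on the residue modulo n, so every period contributes φ(n).
  ∑-coprimes-periodic : ∀ n q → ∑ℕ (coprimes n) (q * n) ≡ q * φ n
  ∑-coprimes-periodic n zero    = refl
  ∑-coprimes-periodic n (suc q) = begin
    ∑ℕ (coprimes n) (n + q * n)                                  ≡⟨ ∑ℕ-split (coprimes n) n (q * n) ⟩
    ∑ℕ (coprimes n) n + ∑ℕ (λ k → coprimes n (n + k)) (q * n)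
      ≡⟨ cong₂ _+_ (sym (φ≡∑ n)) (∑ℕ-cong (λ k → guardℕ-cong {d = coprime? n (n + k)} {e = coprime? n k}
           (λ c (d∣n , d∣k) → c (d∣n , ∣m∣n⇒∣m+n d∣n d∣k))
           (λ c (d∣n , d∣n+k) → c (d∣n , ∣m+n∣m⇒∣n d∣n+k d∣n))) (q * n)) ⟩
    φ n + ∑ℕ (coprimes n) (q * n)                                ≡⟨ cong (φ n +_) (∑-coprimes-periodic n q) ⟩
    φ n + q * φ n                                                ∎
    where open ≡-Reasoning

  -- When p divides n, being coprime to p n and being coprime to n are the same condition, and the
  -- range up to p n consists of p periods.
  φ-prime-∣ : ∀ {p n} → Prime p → p ∣ n → φ (p * n) ≡ p * φ n
  φ-prime-∣ {p} {n} pp p∣n = begin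
    φ (p * n)                        ≡⟨ φ≡∑ (p * n) ⟩
    ∑ℕ (coprimes (p * n)) (p * n)    ≡⟨ ∑ℕ-cong (λ k → guardℕ-cong {d = coprime? (p * n) k} {e = coprime? n k} (coprime-*ʳ p)
                                          λ c → coprime-* (λ (d∣p , d∣k) → c (∣-trans d∣p p∣n , d∣k)) c) (p * n) ⟩
    ∑ℕ (coprimes n) (p * n)          ≡⟨ ∑-coprimes-periodic n p ⟩
    p * φ n                          ∎
    where open ≡-Reasoning

  -- Among the p φ(n) integers up to p n that are coprime to n, the multiples of p are the p k with
  -- k ≤ n coprime to n, φ(n) in number; the others are coprime to p n. The term φ(n) is added on
  -- both sides, which avoids truncated subtraction.
  φ-prime-∤ : ∀ {p n} → Prime p → p ∤ n → φ (p * n) ≡ pred p * φ n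
  φ-prime-∤ {p} {n} pp p∤n = +-cancelʳ-≡ (φ n) _ _ (begin
    φ (p * n) + φ n
      ≡⟨ cong₂ _+_ (φ≡∑ (p * n)) (trans (φ≡∑ n) (∑ℕ-cong (λ k → guardℕ-cong {d = coprime? n k} {e = coprime? n (p * k)}
           (λ c → Coprimality.sym (coprime-* (∤⇒coprime pp p∤n) (Coprimality.sym c)))
           (λ c (d∣n , d∣k) → c (d∣n , ∣n⇒∣m*n p d∣k))) n)) ⟩
    ∑ℕ (coprimes (p * n)) (p * n) + ∑ℕ (λ k → coprimes n (p * k)) n
      ≡⟨ cong₂ _+_ (cong (∑ℕ (coprimes (p * n))) (*-comm p n)) (sym (∑ℕ-multiples p {{prime⇒nonZero pp}} (coprimes n) n)) ⟩
    ∑ℕ (coprimes (p * n)) (n * p) + ∑ℕ (λ k → guardℕ (p ∣? k) (coprimes n k)) (n * p)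
      ≡⟨ sym (∑ℕ-+ _ _ (n * p)) ⟩
    ∑ℕ (λ k → coprimes (p * n) k + guardℕ (p ∣? k) (coprimes n k)) (n * p)
      ≡⟨ trans (∑ℕ-cong (λ k → pointwise k) (n * p)) (cong (∑ℕ (coprimes n)) (*-comm n p)) ⟩
    ∑ℕ (coprimes n) (p * n)                   ≡⟨ ∑-coprimes-periodic n p ⟩
    p * φ n                                   ≡⟨ cong (_* φ n) (sym (suc-pred p {{prime⇒nonZero pp}})) ⟩
    suc (pred p) * φ n                        ≡⟨ +-comm (φ n) _ ⟩
    pred p * φ n + φ n                        ∎)
    where
    open ≡-Reasoning
    pointwise : ∀ k → coprimes (p * n) k + guardℕ (p ∣? k) (coprimes n k) ≡ coprimes n k
    pointwise k with p ∣? k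
    ... | yes p∣k = cong (_+ coprimes n k) (guardℕ-no {d = coprime? (p * n) k} λ c →
                      contradiction (subst Prime (c (m∣m*n n , p∣k)) pp) ¬prime[1])
    ... | no p∤k  = trans (+-identityʳ _) (guardℕ-cong {d = coprime? (p * n) k} {e = coprime? n k} (coprime-*ʳ p) (coprime-* (∤⇒coprime pp p∤k)))

  prime≥2 : ∀ {p} → Prime p → 2 ≤ p
  prime≥2 pp = nonTrivial⇒n>1 _ {{prime⇒nonTrivial pp}}

  -- Multiplying n by a prime p multiplies φ² by p² or (p - 1)², which is at least p except when p =
  -- 2 enters for the first time. The sharper bound for odd n is carried through the induction to
  -- absorb this single loss of a factor 2.
  φ-bound : ∀ n → .{{NonZero n}} → n ≤ 2 * (φ n * φ n) × (2 ∤ n → n ≤ φ n * φ n)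
  φ-bound = <-rec _ step
    where
    open ≤-Reasoning
    Bound : ℕ → Set
    Bound n = .{{NonZero n}} → n ≤ 2 * (φ n * φ n) × (2 ∤ n → n ≤ φ n * φ n)

    square-pred : ∀ p → 3 ≤ p → p ≤ pred p * pred p
    square-pred (suc (suc (suc p))) _ = ≤-trans (m≤m+n (3 + p) (1 + 3 * p + p * p)) (≤-reflexive (lemma p))
      where lemma : ∀ p → 3 + p + (1 + 3 * p + p * p) ≡ (2 + p) * (2 + p)
            lemma = solve-∀
    square-pred (suc (suc zero)) (s≤s (s≤s ()))
    square-pred (suc zero) (s≤s ())

    [ab]² : ∀ c a b → (a * a) * (c * (b * b)) ≡ c * ((a * b) * (a * b))
    [ab]² = solve-∀

    prime-case : ∀ {p n} → Prime p → .{{NonZero n}} → Bound n → Bound (p * n)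
    prime-case {p} {n} pp b with p ∣? n
    ... | yes p∣n = scale 2 (proj₁ b) , λ 2∤ → ≤-trans
            (scale 1 (≤-trans (proj₂ b (2∤ ∘ ∣n⇒∣m*n p)) (≤-reflexive (sym (*-identityˡ _)))))
            (≤-reflexive (*-identityˡ _))
      where
      scale : ∀ c → n ≤ c * (φ n * φ n) → p * n ≤ c * (φ (p * n) * φ (p * n))
      scale c h = begin
        p * n                              ≤⟨ *-mono-≤ (m≤m*n p p {{prime⇒nonZero pp}}) h ⟩
        (p * p) * (c * (φ n * φ n))        ≡⟨ [ab]² c p (φ n) ⟩
        c * ((p * φ n) * (p * φ n))        ≡⟨ cong (λ z → c * (z * z)) (sym (φ-prime-∣ pp p∣n)) ⟩
        c * (φ (p * n) * φ (p * n))        ∎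
    ... | no p∤n with p ≟ 2
    ...   | yes refl = ( begin
        2 * n                                        ≤⟨ *-monoʳ-≤ 2 (proj₂ b p∤n) ⟩
        2 * (φ n * φ n)                              ≡⟨ cong (λ z → 2 * (z * z)) (sym (trans (φ-prime-∤ pp p∤n) (*-identityˡ (φ n)))) ⟩
        2 * (φ (2 * n) * φ (2 * n))                  ∎)
        , λ 2∤ → contradiction (m∣m*n n) 2∤
    ...   | no p≢2 = scale 2 (proj₁ b) , λ 2∤ → ≤-trans
            (scale 1 (≤-trans (proj₂ b (2∤ ∘ ∣n⇒∣m*n p)) (≤-reflexive (sym (*-identityˡ _)))))
            (≤-reflexive (*-identityˡ _))
      where
      scale : ∀ c → n ≤ c * (φ n * φ n) → p * n ≤ c * (φ (p * n) * φ (p * n))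
      scale c h = begin
        p * n                                  ≤⟨ *-mono-≤ (square-pred p (≤∧≢⇒< (prime≥2 pp) (p≢2 ∘ sym))) h ⟩
        (pred p * pred p) * (c * (φ n * φ n))  ≡⟨ [ab]² c (pred p) (φ n) ⟩
        c * ((pred p * φ n) * (pred p * φ n))  ≡⟨ cong (λ z → c * (z * z)) (sym (φ-prime-∤ pp p∤n)) ⟩
        c * (φ (p * n) * φ (p * n))            ∎

    step : ∀ n → (∀ {m} → m < n → Bound m) → Bound n
    step (suc zero) rec = s≤s z≤n , λ _ → s≤s z≤n
    step n@(suc (suc _)) rec with ∃-prime-divisor n (s≤s (s≤s z≤n))
    ... | p , pp , p∣n = subst Bound (sym (m∣n⇒n≡m*quotient p∣n))
      (prime-case pp {{quotient≢0 p∣n}} (rec (quotient-< p∣n {{prime⇒nonTrivial pp}})))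

  -- The Möbius function

  ω : ℕ → ℕ
  ω n = length (primeDivisors n)

  prime-divisor? : ∀ n → Decidable (λ p → Prime p × p ∣ n)
  prime-divisor? n p = prime? p ×-dec p ∣? n

  -- The free upper end N allows the prime divisors of n and of p n to be counted over one common
  -- range.
  ω≡∑ : ∀ n → .{{NonZero n}} → ∀ {N} → n ≤ N → ω n ≡ ∑ℕ (λ p → ♯ (prime-divisor? n p)) N
  ω≡∑ n n≤N = trans (length-filter-range (prime-divisor? n) n)
    (sym (∑ℕ-extend n≤N λ k n<k → guardℕ-no {d = prime-divisor? n k} λ (_ , k∣n) → >⇒∤ n<k k∣n))

  ω-prime-∤ : ∀ {p n} → Prime p → .{{NonZero n}} → p ∤ n → ω (p * n) ≡ suc (ω n)
  ω-prime-∤ {p} {n} pp p∤n = begin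
    ω (p * n)                                                       ≡⟨ ω≡∑ (p * n) {{m*n≢0 p n}} ≤-refl ⟩
    ∑ℕ (λ q → ♯ (prime-divisor? (p * n) q)) (p * n)                 ≡⟨ ∑ℕ-cong (λ q → pointwise q) (p * n) ⟩
    ∑ℕ (λ q → ♯ (q ≟ p) + ♯ (prime-divisor? n q)) (p * n)           ≡⟨ ∑ℕ-+ (λ q → ♯ (q ≟ p)) _ (p * n) ⟩
    ∑ℕ (λ q → ♯ (q ≟ p)) (p * n) + ∑ℕ (λ q → ♯ (prime-divisor? n q)) (p * n)
      ≡⟨ cong₂ _+_ (trans (∑ℕ-single p (m≤m*n p n) (λ k → guardℕ-no {d = k ≟ p})) (guardℕ-yes {d = p ≟ p} refl))
           (sym (ω≡∑ n (m≤n*m n p))) ⟩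
    suc (ω n)                                                       ∎
    where
    open ≡-Reasoning
    instance
      p≢0 : NonZero p
      p≢0 = prime⇒nonZero pp
    pointwise : ∀ q → ♯ (prime-divisor? (p * n) q) ≡ ♯ (q ≟ p) + ♯ (prime-divisor? n q)
    pointwise q with q ≟ p
    ... | yes refl = trans (guardℕ-yes {d = prime-divisor? (p * n) q} (pp , m∣m*n n))
                       (cong₂ _+_ (sym (guardℕ-yes {d = q ≟ q} refl))
                                  (sym (guardℕ-no {d = prime-divisor? n q} (p∤n ∘ proj₂))))
    ... | no q≢p   = trans (guardℕ-cong {d = prime-divisor? (p * n) q} {e = prime-divisor? n q}
      (λ (pq , q∣pn) → pq , [ (λ q∣p → contradiction (distinct-primes pp pq q∣p) q≢p) , (λ q∣n → q∣n) ]′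
                              (euclidsLemma p n pq q∣pn))
      (λ (pq , q∣n) → pq , ∣n⇒∣m*n p q∣n))
      (cong (_+ ♯ (prime-divisor? n q)) (sym (guardℕ-no {d = q ≟ p} q≢p)))

  -- This is literally the condition tested in `μ`, so a case split on `hasSquare?` makes `μ`
  -- compute.
  HasSquare : ℕ → Set
  HasSquare n = Any (λ p → p ^ 2 ∣ n) (primeDivisors n)

  hasSquare? : ∀ n → Dec (HasSquare n)
  hasSquare? n = any? (λ p → p ^ 2 ∣? n) (primeDivisors n)

  prime²∣⇒hasSquare : ∀ {p n} → .{{NonZero n}} → Prime p → p ^ 2 ∣ n → HasSquare n
  prime²∣⇒hasSquare {p} {n} pp p²∣n = lose (∈-filter⁺ (prime-divisor? n) p∈ (pp , p∣n)) p²∣n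
    where
    p∣n : p ∣ n
    p∣n = m*n∣⇒m∣ p (p * 1) p²∣n
    p∈ : p ∈ [1‥ n ]
    p∈ = subst (_∈ [1‥ n ]) (suc-pred p {{prime⇒nonZero pp}})
           (∈-map⁺ suc (∈-upTo⁺ (≤-trans (≤-reflexive (suc-pred p {{prime⇒nonZero pp}})) (∣⇒≤ p∣n))))

  hasSquare⇒prime²∣ : ∀ {n} → HasSquare n → ∃ λ p → Prime p × p ^ 2 ∣ n
  hasSquare⇒prime²∣ {n} h with find h
  ... | p , p∈ , p²∣n = p , proj₁ (proj₂ (∈-filter⁻ (prime-divisor? n) {xs = [1‥ n ]} p∈)) , p²∣n

  -- Suppose q² divides p n. If q = p, then p would divide n; otherwise q² is coprime to p and
  -- divides n.
  hasSquare-prime-∤ : ∀ {p n} → Prime p → .{{NonZero n}} → p ∤ n → HasSquare (p * n) → HasSquare n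
  hasSquare-prime-∤ {p} {n} pp p∤n h with hasSquare⇒prime²∣ h
  ... | q , pq , q²∣pn with q ≟ p
  ...   | yes refl = contradiction (∣-trans (m∣m*n 1) (*-cancelˡ-∣ p {{prime⇒nonZero pp}} q²∣pn)) p∤n
  ...   | no q≢p   = prime²∣⇒hasSquare pq (coprime-divisor (coprime-* q⊥p (coprime-* q⊥p (Coprimality.1-coprimeTo p))) q²∣pn)
    where
    q⊥p : Coprime q p
    q⊥p = ∤⇒coprime pq (q≢p ∘ distinct-primes pp pq)

  μ-prime-∤ : ∀ {p n} → Prime p → .{{NonZero n}} → p ∤ n → μ (p * n) ≡ ℤ.- μ n
  μ-prime-∤ {p} {n} pp p∤n with hasSquare? n | hasSquare? (p * n)
  ... | yes _ | yes _ = refl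
  ... | yes h | no ¬h = contradiction
        (let q , pq , q²∣n = hasSquare⇒prime²∣ h
         in prime²∣⇒hasSquare {{m*n≢0 p n {{prime⇒nonZero pp}}}} pq (∣n⇒∣m*n p q²∣n)) ¬h
  ... | no ¬h | yes h = contradiction (hasSquare-prime-∤ pp p∤n h) ¬h
  ... | no _  | no _  = trans (cong (-1ℤ ℤ.^_) (ω-prime-∤ pp p∤n)) (ℤP.-1*i≡-i _)

  μ-prime-∣ : ∀ {p n} → Prime p → .{{NonZero n}} → p ∣ n → μ (p * n) ≡ 0ℤ
  μ-prime-∣ {p} {n} pp p∣n
    rewrite dec-true (hasSquare? (p * n)) (prime²∣⇒hasSquare {{m*n≢0 p n {{prime⇒nonZero pp}}}} pp
              (*-monoʳ-∣ p (subst (_∣ n) (sym (*-identityʳ p)) p∣n))) = refl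

  ∣μ∣≤1 : ∀ n → ℤ.∣ μ n ∣ ≤ 1
  ∣μ∣≤1 n with hasSquare? n
  ... | yes _ = z≤n
  ... | no _  = ≤-reflexive (power (ω n))
    where
    power : ∀ k → ℤ.∣ -1ℤ ℤ.^ k ∣ ≡ 1
    power zero    = refl
    power (suc k) = trans (ℤP.abs-* -1ℤ (-1ℤ ℤ.^ k)) (trans (+-identityʳ _) (power k))

module DoubleSeries where

  open import Defs
  open import Data.Integer as ℤ using (ℤ)
  import Data.Integer.Properties as ℤP
  open import Data.List using (List; []; _∷_; filter; foldr)
  open import Data.Nat as ℕ using (ℕ; zero; suc; NonZero; z≤n; s≤s)
  import Data.Nat.Properties as ℕP
  open import Data.Nat.Coprimality as Coprimality using (Coprime; coprime-divisor; 1-coprimeTo)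
  open import Data.Nat.Divisibility
  open import Data.Nat.DivMod using (m*n/n≡m; /-monoˡ-≤; m/n≤m)
  open import Data.Nat.Induction using (<-rec)
  open import Data.Nat.Primality using (Prime; prime?; prime⇒nonZero; prime⇒nonTrivial; euclidsLemma; ¬prime[1])
  open import Data.Nat.Tactic.RingSolver using (solve-∀)
  open import Data.Product using (∃; ∃₂; _×_; _,_; proj₁; proj₂)
  open import Data.Rational as ℚ
    using (ℚ; mkℚ; 0ℚ; 1ℚ; ½; _+_; _*_; _-_; -_; ∣_∣; _≤_; Positive; toℚᵘ)
  open import Data.Rational.Properties hiding (_≟_; _≤?_; _<?_)
  open import Data.Rational.Solver using (module +-*-Solver)
  open import Data.Rational.Unnormalised as ℚᵘ using (mkℚᵘ; *≡*; *≤*)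
  import Data.Rational.Unnormalised.Properties as ℚᵘP
  open import Data.Sum using (inj₁; inj₂; [_,_]′)
  open import Function using (_∘_)
  open import Level using (0ℓ)
  open import Relation.Binary.PropositionalEquality
  open import Relation.Nullary using (Dec; yes; no; ¬_; contradiction; ¬?; _×-dec_)
  open import Relation.Unary using (Pred; Decidable)

  open +-*-Solver
  open Arithmetic

  -- Rational numbers and a summable majorant

  abstract
    -- Opaque, so that the gcd normalisation hidden in a fraction never unfolds: outside the
    -- `abstract` blocks only the laws proved for `ι` are available.
    ι : ℤ → ℚ
    ι z = z ℚ./ 1

  ν : ℕ → ℚ
  ν n = ι (ℤ.+ n)

  abstract
    -- The junk value inv 0 = 0 makes inv multiplicative without side conditions.
    inv : ℕ → ℚ
    inv zero    = 0ℚ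
    inv (suc d) = ℤ.+ 1 ℚ./ suc d

    private
      toℚᵘ-/ : ∀ a d → toℚᵘ (a ℚ./ suc d) ℚᵘ.≃ mkℚᵘ a d
      toℚᵘ-/ a d = toℚᵘ-fromℚᵘ (mkℚᵘ a d)

    ι-+ : ∀ a b → ι (a ℤ.+ b) ≡ ι a + ι b
    ι-+ a b = toℚᵘ-injective (ℚᵘP.≃-trans (toℚᵘ-/ (a ℤ.+ b) 0) (ℚᵘP.≃-trans
      (*≡* (cong (ℤ._* ℤ.+ 1) (sym (cong₂ ℤ._+_ (ℤP.*-identityʳ a) (ℤP.*-identityʳ b)))))
      (ℚᵘP.≃-sym (ℚᵘP.≃-trans (toℚᵘ-homo-+ (ι a) (ι b)) (ℚᵘP.+-cong (toℚᵘ-/ a 0) (toℚᵘ-/ b 0))))))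

    ι-* : ∀ a b → ι (a ℤ.* b) ≡ ι a * ι b
    ι-* a b = toℚᵘ-injective (ℚᵘP.≃-trans (toℚᵘ-/ (a ℤ.* b) 0)
      (ℚᵘP.≃-sym (ℚᵘP.≃-trans (toℚᵘ-homo-* (ι a) (ι b)) (ℚᵘP.*-cong (toℚᵘ-/ a 0) (toℚᵘ-/ b 0)))))

    ι-neg : ∀ a → ι (ℤ.- a) ≡ - ι a
    ι-neg a = toℚᵘ-injective (ℚᵘP.≃-trans (toℚᵘ-/ (ℤ.- a) 0)
      (ℚᵘP.≃-sym (ℚᵘP.≃-trans (toℚᵘ-homo‿- (ι a)) (ℚᵘP.-‿cong (toℚᵘ-/ a 0)))))

    ι-mono-≤ : ∀ {a b} → a ℤ.≤ b → ι a ≤ ι b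
    ι-mono-≤ {a} {b} a≤b = toℚᵘ-cancel-≤ (ℚᵘP.≤-trans (ℚᵘP.≤-reflexive (toℚᵘ-/ a 0)) (ℚᵘP.≤-trans
      (*≤* (ℤP.*-monoʳ-≤-nonNeg (ℤ.+ 1) a≤b)) (ℚᵘP.≤-reflexive (ℚᵘP.≃-sym (toℚᵘ-/ b 0)))))

    ν-* : ∀ a b → ν (a ℕ.* b) ≡ ν a * ν b
    ν-* a b = trans (cong ι (ℤP.pos-* a b)) (ι-* (ℤ.+ a) (ℤ.+ b))

    ν-+ : ∀ a b → ν (a ℕ.+ b) ≡ ν a + ν b
    ν-+ a b = trans (cong ι (ℤP.pos-+ a b)) (ι-+ (ℤ.+ a) (ℤ.+ b))

    ν-0 : ν 0 ≡ 0ℚ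
    ν-0 = refl

    ν-1 : ν 1 ≡ 1ℚ
    ν-1 = refl

    ι-0 : ι (ℤ.+ 0) ≡ 0ℚ
    ι-0 = refl

    ν-suc : ∀ n → ν (suc n) ≡ 1ℚ + ν n
    ν-suc n = ν-+ 1 n

    ν-mono-≤ : ∀ {a b} → a ℕ.≤ b → ν a ≤ ν b
    ν-mono-≤ a≤b = ι-mono-≤ (ℤ.+≤+ a≤b)

    0≤ν : ∀ n → 0ℚ ≤ ν n
    0≤ν n = ν-mono-≤ (z≤n {n})

    ν-pos : ∀ n .{{_ : NonZero n}} → Positive (ν n)
    ν-pos n = ℚ.positive (<-≤-trans (positive⁻¹ 1ℚ) (ν-mono-≤ {1} {n} (ℕ.>-nonZero⁻¹ n)))

    /≡ι*inv : ∀ a d → a ℚ./ suc d ≡ ι a * inv (suc d)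
    /≡ι*inv a d = toℚᵘ-injective (ℚᵘP.≃-trans (toℚᵘ-/ a d) (ℚᵘP.≃-trans
      (*≡* (cong₂ ℤ._*_ (sym (ℤP.*-identityʳ a)) (cong (λ n → ℤ.+ suc n) (ℕP.+-identityʳ d))))
      (ℚᵘP.≃-sym (ℚᵘP.≃-trans (toℚᵘ-homo-* (ι a) (inv (suc d))) (ℚᵘP.*-cong (toℚᵘ-/ a 0) (toℚᵘ-/ (ℤ.+ 1) d))))))

    ν*inv : ∀ n .{{_ : NonZero n}} → ν n * inv n ≡ 1ℚ
    ν*inv (suc d) = trans (sym (/≡ι*inv (ℤ.+ suc d) d)) (toℚᵘ-injective (ℚᵘP.≃-trans (toℚᵘ-/ (ℤ.+ suc d) d)
      (*≡* (ℤP.*-comm (ℤ.+ suc d) (ℤ.+ 1)))))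

    ν-cancel : ∀ n .{{_ : NonZero n}} {x y} → ν n * x ≡ ν n * y → x ≡ y
    ν-cancel n {x} {y} eq = begin
      x                   ≡⟨ unit x ⟩
      inv n * (ν n * x)   ≡⟨ cong (inv n *_) eq ⟩
      inv n * (ν n * y)   ≡⟨ sym (unit y) ⟩
      y                   ∎
      where
      open ≡-Reasoning
      unit : ∀ z → z ≡ inv n * (ν n * z)
      unit z = begin
        z                 ≡⟨ sym (*-identityˡ z) ⟩
        1ℚ * z            ≡⟨ cong (_* z) (sym (ν*inv n)) ⟩
        ν n * inv n * z   ≡⟨ solve 3 (λ a b c → a :* b :* c := b :* (a :* c)) refl (ν n) (inv n) z ⟩
        inv n * (ν n * z) ∎

    inv-* : ∀ a b → inv (a ℕ.* b) ≡ inv a * inv b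
    inv-* zero      b         = sym (*-zeroˡ (inv b))
    inv-* a@(suc _) zero      = trans (cong inv (ℕP.*-zeroʳ a)) (sym (*-zeroʳ (inv a)))
    inv-* a@(suc _) b@(suc _) = ν-cancel (a ℕ.* b) (begin
      ν (a ℕ.* b) * inv (a ℕ.* b)     ≡⟨ ν*inv (a ℕ.* b) ⟩
      1ℚ                              ≡⟨ sym (cong₂ _*_ (ν*inv a) (ν*inv b)) ⟩
      ν a * inv a * (ν b * inv b)     ≡⟨ solve 4 (λ a a′ b b′ → a :* a′ :* (b :* b′) := a :* b :* (a′ :* b′))
                                           refl (ν a) (inv a) (ν b) (inv b) ⟩
      ν a * ν b * (inv a * inv b)     ≡⟨ cong (_* (inv a * inv b)) (sym (ν-* a b)) ⟩
      ν (a ℕ.* b) * (inv a * inv b)   ∎)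
      where open ≡-Reasoning

    0≤inv : ∀ n → 0ℚ ≤ inv n
    0≤inv zero    = ≤-refl
    0≤inv (suc d) = nonNegative⁻¹ (inv (suc d)) {{normalize-nonNeg 1 (suc d)}}

  *-mono-≤-nonNeg : ∀ {a b c d} → 0ℚ ≤ a → a ≤ b → 0ℚ ≤ c → c ≤ d → a * c ≤ b * d
  *-mono-≤-nonNeg {a} {b} {c} {d} 0≤a a≤b 0≤c c≤d = ≤-trans
    (*-monoʳ-≤-nonNeg c {{ℚ.nonNegative 0≤c}} a≤b)
    (*-monoˡ-≤-nonNeg b {{ℚ.nonNegative (≤-trans 0≤a a≤b)}} c≤d)

  0≤* : ∀ {a b} → 0ℚ ≤ a → 0ℚ ≤ b → 0ℚ ≤ a * b
  0≤* {a} {b} 0≤a 0≤b = ≤-trans (≤-reflexive (sym (*-zeroˡ 0ℚ))) (*-mono-≤-nonNeg ≤-refl 0≤a ≤-refl 0≤b)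

  inv-anti-≤ : ∀ {a b} .{{_ : NonZero a}} → a ℕ.≤ b → inv b ≤ inv a
  inv-anti-≤ {a} {b} a≤b = begin
    inv b                   ≡⟨ sym (trans (cong (_* inv b) (ν*inv a)) (*-identityˡ (inv b))) ⟩
    ν a * inv a * inv b     ≤⟨ *-monoʳ-≤-nonNeg (inv b) {{ℚ.nonNegative (0≤inv b)}}
                                 (*-monoʳ-≤-nonNeg (inv a) {{ℚ.nonNegative (0≤inv a)}} (ν-mono-≤ a≤b)) ⟩
    ν b * inv a * inv b     ≡⟨ solve 3 (λ b a′ b′ → b :* a′ :* b′ := a′ :* (b :* b′)) refl (ν b) (inv a) (inv b) ⟩
    inv a * (ν b * inv b)   ≡⟨ trans (cong (inv a *_) (ν*inv b {{ℕ.>-nonZero (ℕP.<-≤-trans (ℕ.>-nonZero⁻¹ a) a≤b)}})) (*-identityʳ (inv a)) ⟩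
    inv a                   ∎
    where open ≤-Reasoning

  abstract
    -- A positive fraction is at least the reciprocal of its own denominator.
    archimedean : ∀ ε .{{_ : Positive ε}} → ∃ λ n → NonZero n × inv n ≤ ε
    archimedean ε@(mkℚ (ℤ.+ suc a) d _) = suc d , _ , toℚᵘ-cancel-≤ (ℚᵘP.≤-trans
      (ℚᵘP.≤-reflexive (toℚᵘ-/ (ℤ.+ 1) d)) (*≤* (ℤP.*-monoʳ-≤-nonNeg (ℤ.+ suc d) {ℤ.+ 1} {ℤ.+ suc a} (ℤ.+≤+ (s≤s z≤n)))))

  abstract
    -- The case d = 0 fits in because `_//_` and `inv` use the same default value 0.
    //-seq : ∀ a d l → seq (a // (ℤ.+ d)) l ≡ ι a * inv d
    //-seq a zero    l = sym (*-zeroʳ (ι a))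
    //-seq a (suc d) l = /≡ι*inv a d

  open RangeFold +-0-isCommutativeMonoid public using () renaming
    (fold to ∑ℚ; guard to guardℚ; guard-yes to guardℚ-yes; guard-no to guardℚ-no; guard-cong to guardℚ-cong;
     fold-cong to ∑ℚ-cong; fold-∙ to ∑ℚ-+; fold-+ to ∑ℚ-split;
     fold-multiples to ∑ℚ-multiples; fold-ε to ∑ℚ-zero;
     foldr-filter-range to foldrℚ-filter-range)

  open RangeFold *-1-isCommutativeMonoid public using () renaming
    (fold to ∏ℚ; guard to guard*; guard-yes to guard*-yes; guard-no to guard*-no; fold-cong to ∏ℚ-cong;
     fold-∙ to ∏ℚ-*; fold-extend to ∏ℚ-extend;
     foldr-filter to foldr*-filter; foldr-filter-range to foldr*-filter-range)

  ∑ℚ-*ˡ : ∀ c f N → ∑ℚ (λ k → c * f k) N ≡ c * ∑ℚ f N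
  ∑ℚ-*ˡ c f zero    = sym (*-zeroʳ c)
  ∑ℚ-*ˡ c f (suc N) = trans (cong (_+ c * f (suc N)) (∑ℚ-*ˡ c f N)) (sym (*-distribˡ-+ c _ _))

  ∑ℚ-neg : ∀ f N → ∑ℚ (λ k → - f k) N ≡ - ∑ℚ f N
  ∑ℚ-neg f zero    = refl
  ∑ℚ-neg f (suc N) = trans (cong (_+ - f (suc N)) (∑ℚ-neg f N)) (sym (neg-distrib-+ (∑ℚ f N) (f (suc N))))

  ∑ℚ-mono : ∀ {f g} → (∀ k → .{{NonZero k}} → f k ≤ g k) → ∀ N → ∑ℚ f N ≤ ∑ℚ g N
  ∑ℚ-mono h zero    = ≤-refl
  ∑ℚ-mono h (suc N) = +-mono-≤ (∑ℚ-mono h N) (h (suc N))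

  ∣∑ℚ∣≤ : ∀ {f g} → (∀ k → .{{NonZero k}} → ∣ f k ∣ ≤ g k) → ∀ N → ∣ ∑ℚ f N ∣ ≤ ∑ℚ g N
  ∣∑ℚ∣≤         h zero    = ≤-refl
  ∣∑ℚ∣≤ {f} {g} h (suc N) = ≤-trans (∣p+q∣≤∣p∣+∣q∣ (∑ℚ f N) (f (suc N))) (+-mono-≤ (∣∑ℚ∣≤ h N) (h (suc N)))

  ∑ℚ-const : ∀ c N → ∑ℚ (λ _ → c) N ≡ ν N * c
  ∑ℚ-const c zero    = sym (trans (cong (_* c) ν-0) (*-zeroˡ c))
  ∑ℚ-const c (suc N) = begin
    ∑ℚ (λ _ → c) N + c   ≡⟨ cong (_+ c) (∑ℚ-const c N) ⟩
    ν N * c + c          ≡⟨ solve 2 (λ n c → n :* c :+ c := (con 1ℚ :+ n) :* c) refl (ν N) c ⟩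
    (1ℚ + ν N) * c       ≡⟨ cong (_* c) (sym (ν-suc N)) ⟩
    ν (suc N) * c        ∎
    where open ≡-Reasoning

  p≤p+nonNeg : ∀ {p q} → 0ℚ ≤ q → p ≤ p + q
  p≤p+nonNeg {p} {q} 0≤q = ≤-trans (≤-reflexive (sym (+-identityʳ p))) (+-monoʳ-≤ p 0≤q)

  ∑ℚ-nonNeg : ∀ {f} → (∀ k → .{{NonZero k}} → 0ℚ ≤ f k) → ∀ N → 0ℚ ≤ ∑ℚ f N
  ∑ℚ-nonNeg h zero    = ≤-refl
  ∑ℚ-nonNeg h (suc N) = ≤-trans (∑ℚ-nonNeg h N) (p≤p+nonNeg (h (suc N)))

  ∑ℚ-monoʳ : ∀ {f} → (∀ k → .{{NonZero k}} → 0ℚ ≤ f k) → ∀ {M N} → M ℕ.≤ N → ∑ℚ f M ≤ ∑ℚ f N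
  ∑ℚ-monoʳ {f} h {M} {N} M≤N = begin
    ∑ℚ f M                                        ≤⟨ p≤p+nonNeg (∑ℚ-nonNeg (λ { (suc k) → h (M ℕ.+ suc k)
                                                       {{ℕ.>-nonZero (ℕP.m<n⇒0<n (ℕP.m<m+n M ℕ.z<s))}} }) (N ℕ.∸ M)) ⟩
    ∑ℚ f M + ∑ℚ (λ k → f (M ℕ.+ k)) (N ℕ.∸ M)     ≡⟨ sym (∑ℚ-split f M (N ℕ.∸ M)) ⟩
    ∑ℚ f (M ℕ.+ (N ℕ.∸ M))                        ≡⟨ cong (∑ℚ f) (ℕP.m+[n∸m]≡n M≤N) ⟩
    ∑ℚ f N                                        ∎
    where open ≤-Reasoning

  abstract
    -- The integer part of the square root, as `√²≤` and `<suc√²` together show.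
    √_ : ℕ → ℕ
    √ zero  = zero
    √ suc n with suc (√ n) ℕ.* suc (√ n) ℕ.≤? suc n
    ... | yes _ = suc (√ n)
    ... | no  _ = √ n

    √²≤ : ∀ n → √ n ℕ.* √ n ℕ.≤ n
    √²≤ zero = z≤n
    √²≤ (suc n) with suc (√ n) ℕ.* suc (√ n) ℕ.≤? suc n
    ... | yes h = h
    ... | no  _ = ℕP.m≤n⇒m≤1+n (√²≤ n)

    √-mono-suc : ∀ n → √ n ℕ.≤ √ suc n
    √-mono-suc n with suc (√ n) ℕ.* suc (√ n) ℕ.≤? suc n
    ... | yes _ = ℕP.n≤1+n (√ n)
    ... | no  _ = ℕP.≤-refl

    √-mono : ∀ {m n} → m ℕ.≤ n → √ m ℕ.≤ √ n
    √-mono {m} {n} m≤n = go (ℕP.≤⇒≤′ m≤n)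
      where
      go : ∀ {n} → m ℕ.≤′ n → √ m ℕ.≤ √ n
      go ℕ.≤′-refl       = ℕP.≤-refl
      go (ℕ.≤′-step {n} m≤n) = ℕP.≤-trans (go m≤n) (√-mono-suc n)

    ²-cancel-≤ : ∀ {a b} → a ℕ.* a ℕ.≤ b ℕ.* b → a ℕ.≤ b
    ²-cancel-≤ {a} {b} h with a ℕ.≤? b
    ... | yes a≤b = a≤b
    ... | no  a≰b = contradiction h (ℕP.<⇒≱ (ℕP.*-mono-< (ℕP.≰⇒> a≰b) (ℕP.≰⇒> a≰b)))

    <suc√² : ∀ n → n ℕ.< suc (√ n) ℕ.* suc (√ n)
    <suc√² zero = s≤s z≤n
    <suc√² (suc n) with suc (√ n) ℕ.* suc (√ n) ℕ.≤? suc n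
    ... | yes _ = ℕP.≤-<-trans (<suc√² n) (ℕP.*-mono-< (ℕP.n<1+n (suc (√ n))) (ℕP.n<1+n (suc (√ n))))
    ... | no  h = ℕP.≰⇒> h

    √-square : ∀ {R n} → R ℕ.* R ℕ.≤ n → R ℕ.≤ √ n
    √-square {R} {n} h with R ℕ.≤? √ n
    ... | yes R≤ = R≤
    ... | no  R≰ = contradiction (ℕP.<-≤-trans (<suc√² n) (ℕP.≤-trans (ℕP.*-mono-≤ (ℕP.≰⇒> R≰) (ℕP.≰⇒> R≰)) h)) (ℕP.<-irrefl refl)

    1≤√ : ∀ n .{{_ : NonZero n}} → 1 ℕ.≤ √ n
    1≤√ n = √-square {1} (ℕ.>-nonZero⁻¹ n)

  -- decay n is of order n^(-3/2) and has an explicit tail estimate.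
  decay : ℕ → ℚ
  decay n = ν 2 * inv (n ℕ.* √ n)

  0≤decay : ∀ n → 0ℚ ≤ decay n
  0≤decay n = 0≤* (0≤ν 2) (0≤inv (n ℕ.* √ n))

  n*√n≢0 : ∀ n .{{_ : NonZero n}} → NonZero (n ℕ.* √ n)
  n*√n≢0 n = ℕP.m*n≢0 n (√ n) {{it}} {{ℕ.>-nonZero (1≤√ n)}}
    where
    it : NonZero n
    it = ℕ.≢-nonZero (ℕ.≢-nonZero⁻¹ n)

  decay-anti : ∀ {m n} .{{_ : NonZero m}} → m ℕ.≤ n → decay n ≤ decay m
  decay-anti {m} {n} m≤n = *-monoˡ-≤-nonNeg (ν 2) {{ℚ.nonNegative (0≤ν 2)}}
    (inv-anti-≤ {{n*√n≢0 m}} (ℕP.*-mono-≤ m≤n (√-mono m≤n)))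

  -- The partial fraction 1/(Q(Q+1)) = 1/Q - 1/(Q+1) without subtraction. It drives both telescoping
  -- arguments, the one for `decay` and the one for the product S.
  inv-suc-difference : ∀ Q .{{_ : NonZero Q}} → inv (Q ℕ.* suc Q) + inv (suc Q) ≡ inv Q
  inv-suc-difference Q = begin
    inv (Q ℕ.* suc Q) + inv (suc Q)
      ≡⟨ cong₂ _+_ (inv-* Q (suc Q)) (sym (trans (cong (_* inv (suc Q)) (ν*inv Q)) (*-identityˡ _))) ⟩
    inv Q * inv (suc Q) + ν Q * inv Q * inv (suc Q)
      ≡⟨ solve 3 (λ q i s → i :* s :+ q :* i :* s := i :* ((con 1ℚ :+ q) :* s)) refl (ν Q) (inv Q) (inv (suc Q)) ⟩
    inv Q * ((1ℚ + ν Q) * inv (suc Q))  ≡⟨ cong (λ z → inv Q * (z * inv (suc Q))) (sym (ν-suc Q)) ⟩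
    inv Q * (ν (suc Q) * inv (suc Q))   ≡⟨ trans (cong (inv Q *_) (ν*inv (suc Q))) (*-identityʳ _) ⟩
    inv Q                               ∎
    where open ≡-Reasoning

  -- The 2R + 1 integers in (R², (R+1)²] contribute at most 6/R² to ∑ decay, and 1/R² telescopes.
  ∑decay-square-step : ∀ Q .{{_ : NonZero Q}} →
    ∑ℚ decay (suc (suc Q) ℕ.* suc (suc Q)) + ν 6 * inv (suc Q) ≤ ∑ℚ decay (suc Q ℕ.* suc Q) + ν 6 * inv Q
  ∑decay-square-step Q = begin
    ∑ℚ decay (suc R ℕ.* suc R) + ν 6 * inv R
      ≡⟨ cong (λ z → ∑ℚ decay z + ν 6 * inv R) (square R) ⟩
    ∑ℚ decay (R ℕ.* R ℕ.+ (2 ℕ.* R ℕ.+ 1)) + ν 6 * inv R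
      ≡⟨ cong (_+ ν 6 * inv R) (∑ℚ-split decay (R ℕ.* R) (2 ℕ.* R ℕ.+ 1)) ⟩
    s + ∑ℚ (λ k → decay (R ℕ.* R ℕ.+ k)) (2 ℕ.* R ℕ.+ 1) + ν 6 * inv R
      ≤⟨ +-monoˡ-≤ (ν 6 * inv R) (+-monoʳ-≤ s (∑ℚ-mono (λ k → decay-large k) (2 ℕ.* R ℕ.+ 1))) ⟩
    s + ∑ℚ (λ k → ν 2 * inv (R ℕ.* R ℕ.* R)) (2 ℕ.* R ℕ.+ 1) + ν 6 * inv R
      ≡⟨ cong (λ z → s + z + ν 6 * inv R) (∑ℚ-const (ν 2 * inv (R ℕ.* R ℕ.* R)) (2 ℕ.* R ℕ.+ 1)) ⟩
    s + ν (2 ℕ.* R ℕ.+ 1) * (ν 2 * inv (R ℕ.* R ℕ.* R)) + ν 6 * inv R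
      ≤⟨ +-monoˡ-≤ (ν 6 * inv R) (+-monoʳ-≤ s block) ⟩
    s + ν 6 * inv (Q ℕ.* R) + ν 6 * inv R
      ≡⟨ solve 4 (λ s c x y → s :+ c :* x :+ c :* y := s :+ c :* (x :+ y)) refl s (ν 6) (inv (Q ℕ.* R)) (inv R) ⟩
    s + ν 6 * (inv (Q ℕ.* R) + inv R)
      ≡⟨ cong (λ z → s + ν 6 * z) (inv-suc-difference Q) ⟩
    s + ν 6 * inv Q ∎
    where
    open ≤-Reasoning
    R = suc Q
    s = ∑ℚ decay (R ℕ.* R)
    square : ∀ R → suc R ℕ.* suc R ≡ R ℕ.* R ℕ.+ (2 ℕ.* R ℕ.+ 1)
    square = solve-∀
    decay-large : ∀ k → decay (R ℕ.* R ℕ.+ k) ≤ ν 2 * inv (R ℕ.* R ℕ.* R)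
    decay-large k = *-monoˡ-≤-nonNeg (ν 2) {{ℚ.nonNegative (0≤ν 2)}}
      (inv-anti-≤ (ℕP.*-mono-≤ (ℕP.m≤m+n (R ℕ.* R) k) (√-square (ℕP.m≤m+n (R ℕ.* R) k))))
    -- Here 2R + 1 ≤ 3R and each term is at most 2/R³. Weakening 6/R² to 6/(QR) = 6/Q - 6/R is what
    -- makes the blocks telescope.
    block : ν (2 ℕ.* R ℕ.+ 1) * (ν 2 * inv (R ℕ.* R ℕ.* R)) ≤ ν 6 * inv (Q ℕ.* R)
    block = begin
      ν (2 ℕ.* R ℕ.+ 1) * (ν 2 * inv (R ℕ.* R ℕ.* R))
        ≤⟨ *-monoʳ-≤-nonNeg (ν 2 * inv (R ℕ.* R ℕ.* R)) {{ℚ.nonNegative (0≤* (0≤ν 2) (0≤inv (R ℕ.* R ℕ.* R)))}}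
             (ν-mono-≤ (ℕP.≤-trans (ℕP.+-monoʳ-≤ (2 ℕ.* R) (s≤s (z≤n {Q}))) (ℕP.≤-reflexive (three R)))) ⟩
      ν (3 ℕ.* R) * (ν 2 * inv (R ℕ.* R ℕ.* R))
        ≡⟨ cong₂ (λ x y → x * (ν 2 * y)) (ν-* 3 R) (inv-* (R ℕ.* R) R) ⟩
      ν 3 * ν R * (ν 2 * (inv (R ℕ.* R) * inv R))
        ≡⟨ solve 5 (λ a r c i j → a :* r :* (c :* (i :* j)) := a :* c :* i :* (r :* j)) refl (ν 3) (ν R) (ν 2) (inv (R ℕ.* R)) (inv R) ⟩
      ν 3 * ν 2 * inv (R ℕ.* R) * (ν R * inv R)
        ≡⟨ cong (λ z → z * inv (R ℕ.* R) * (ν R * inv R)) (sym (ν-* 3 2)) ⟩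
      ν 6 * inv (R ℕ.* R) * (ν R * inv R)
        ≡⟨ trans (cong (ν 6 * inv (R ℕ.* R) *_) (ν*inv R)) (*-identityʳ _) ⟩
      ν 6 * inv (R ℕ.* R)
        ≤⟨ *-monoˡ-≤-nonNeg (ν 6) {{ℚ.nonNegative (0≤ν 6)}}
             (inv-anti-≤ {{ℕP.m*n≢0 Q R {{ℕ.≢-nonZero (ℕ.≢-nonZero⁻¹ Q)}}}} (ℕP.*-monoˡ-≤ R (ℕP.n≤1+n Q))) ⟩
      ν 6 * inv (Q ℕ.* R) ∎
      where three : ∀ R → 2 ℕ.* R ℕ.+ R ≡ 3 ℕ.* R
            three = solve-∀

  ∑decay-squares : ∀ Q .{{_ : NonZero Q}} d →
    ∑ℚ decay (suc (d ℕ.+ Q) ℕ.* suc (d ℕ.+ Q)) + ν 6 * inv (d ℕ.+ Q) ≤ ∑ℚ decay (suc Q ℕ.* suc Q) + ν 6 * inv Q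
  ∑decay-squares Q zero    = ≤-refl
  ∑decay-squares Q (suc d) = ≤-trans (∑decay-square-step (d ℕ.+ Q) {{ℕ.>-nonZero (ℕP.<-≤-trans (ℕ.>-nonZero⁻¹ Q) (ℕP.m≤n+m Q d))}}) (∑decay-squares Q d)

  -- N lies below the square (N + Q + 1)², to which `∑decay-squares` applies. The free Q serves two
  -- purposes: Q = 1 bounds the whole sum, a large Q makes the tails small.
  ∑decay-upper : ∀ Q .{{_ : NonZero Q}} N → ∑ℚ decay N ≤ ∑ℚ decay (suc Q ℕ.* suc Q) + ν 6 * inv Q
  ∑decay-upper Q N = begin
    ∑ℚ decay N                                                       ≤⟨ ∑ℚ-monoʳ (λ k → 0≤decay k)
        (ℕP.≤-trans (ℕP.m≤m+n N Q) (ℕP.≤-trans (ℕP.n≤1+n _) (ℕP.m≤m*n (suc (N ℕ.+ Q)) (suc (N ℕ.+ Q))))) ⟩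
    ∑ℚ decay (suc (N ℕ.+ Q) ℕ.* suc (N ℕ.+ Q))                       ≤⟨ p≤p+nonNeg (0≤* (0≤ν 6) (0≤inv (N ℕ.+ Q))) ⟩
    ∑ℚ decay (suc (N ℕ.+ Q) ℕ.* suc (N ℕ.+ Q)) + ν 6 * inv (N ℕ.+ Q) ≤⟨ ∑decay-squares Q N ⟩
    ∑ℚ decay (suc Q ℕ.* suc Q) + ν 6 * inv Q                         ∎
    where open ≤-Reasoning

  ∑decay-total : ∃ λ C → Positive C × ∀ N → ∑ℚ decay N ≤ C
  ∑decay-total = total 1
    where
    total : ∀ Q .{{_ : NonZero Q}} → ∃ λ C → Positive C × ∀ N → ∑ℚ decay N ≤ C
    -- The added 1 makes the bound visibly positive, so that one may divide by it in `shrink`.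
    total Q = ∑ℚ decay (suc Q ℕ.* suc Q) + ν 6 * inv Q + 1ℚ
      , nonNeg+pos⇒pos (∑ℚ decay (suc Q ℕ.* suc Q) + ν 6 * inv Q)
          {{ℚ.nonNegative (+-mono-≤ (∑ℚ-nonNeg (λ k → 0≤decay k) (suc Q ℕ.* suc Q)) (0≤* (0≤ν 6) (0≤inv Q)))}} 1ℚ
      , λ N → ≤-trans (∑decay-upper Q N) (p≤p+nonNeg (nonNegative⁻¹ 1ℚ))

  +-cancelˡ-≤ : ∀ r p q → r + p ≤ r + q → p ≤ q
  +-cancelˡ-≤ r p q h = begin
    p              ≡⟨ solve 2 (λ r p → p := :- r :+ (r :+ p)) refl r p ⟩
    - r + (r + p)  ≤⟨ +-monoʳ-≤ (- r) h ⟩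
    - r + (r + q)  ≡⟨ solve 2 (λ r p → :- r :+ (r :+ p) := p) refl r q ⟩
    q              ∎
    where open ≤-Reasoning

  ½ε≤ε : ∀ ε .{{_ : Positive ε}} → ½ * ε ≤ ε
  ½ε≤ε ε = ≤-trans (p≤p+nonNeg (nonNegative⁻¹ (½ * ε) {{pos⇒nonNeg (½ * ε) {{half-pos ε}}}})) (≤-reflexive (halves ε))

  ∑decay-tail-from : ∀ {M c K} → (∀ N → ∑ℚ decay N ≤ ∑ℚ decay M + c) → M ℕ.≤ K → ∀ N → ∑ℚ (λ k → decay (K ℕ.+ k)) N ≤ c
  ∑decay-tail-from {M} {c} {K} upper M≤K N = +-cancelˡ-≤ (∑ℚ decay K) (∑ℚ (λ k → decay (K ℕ.+ k)) N) c (begin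
    ∑ℚ decay K + ∑ℚ (λ k → decay (K ℕ.+ k)) N  ≡⟨ sym (∑ℚ-split decay K N) ⟩
    ∑ℚ decay (K ℕ.+ N)                     ≤⟨ upper (K ℕ.+ N) ⟩
    ∑ℚ decay M + c                         ≤⟨ +-monoˡ-≤ c (∑ℚ-monoʳ (λ k → 0≤decay k) M≤K) ⟩
    ∑ℚ decay K + c                         ∎)
    where open ≤-Reasoning

  ∑decay-tail : ∀ ε .{{_ : Positive ε}} → ∃ λ M → ∀ {K} → M ℕ.≤ K → ∀ N → ∑ℚ (λ k → decay (K ℕ.+ k)) N ≤ ε
  ∑decay-tail ε =
    let e , e>0 , 6e≡½ε = shrink ε (ν 6) {{ν-pos 6}}
        Q , Q≢0 , 1/Q≤e = archimedean e {{e>0}}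
        6/Q≤ε = begin
          ν 6 * inv Q  ≤⟨ *-monoˡ-≤-nonNeg (ν 6) {{ℚ.nonNegative (0≤ν 6)}} 1/Q≤e ⟩
          ν 6 * e      ≡⟨ 6e≡½ε ⟩
          ½ * ε        ≤⟨ ½ε≤ε ε ⟩
          ε            ∎
    in suc Q ℕ.* suc Q , λ M≤K N → ≤-trans (∑decay-tail-from (∑decay-upper Q {{Q≢0}}) M≤K N) 6/Q≤ε
    where open ≤-Reasoning

  -- Double series

  boxSum : (ℕ → ℕ → ℚ) → ℕ → ℕ → ℚ
  boxSum f I J = ∑ℚ (λ i → ∑ℚ (f i) J) I

  -- Null f means that the double series of f has sum 0.
  Null : (ℕ → ℕ → ℚ) → Set
  Null f = ∀ ε .{{_ : Positive ε}} → ∃ λ M → ∀ {I J} → M ℕ.≤ I → M ℕ.≤ J → ∣ boxSum f I J ∣ ≤ ε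

  boxSum-cong : ∀ {f g} → (∀ i j → .{{NonZero i}} → .{{NonZero j}} → f i j ≡ g i j) →
    ∀ I J → boxSum f I J ≡ boxSum g I J
  boxSum-cong h I J = ∑ℚ-cong (λ i → ∑ℚ-cong (λ j → h i j) J) I

  boxSum-+ : ∀ f g I J → boxSum (λ i j → f i j + g i j) I J ≡ boxSum f I J + boxSum g I J
  boxSum-+ f g I J = trans (∑ℚ-cong (λ i → ∑ℚ-+ (f i) (g i) J) I) (∑ℚ-+ (λ i → ∑ℚ (f i) J) (λ i → ∑ℚ (g i) J) I)

  boxSum-*ˡ : ∀ c f I J → boxSum (λ i j → c * f i j) I J ≡ c * boxSum f I J
  boxSum-*ˡ c f I J = trans (∑ℚ-cong (λ i → ∑ℚ-*ˡ c (f i) J) I) (∑ℚ-*ˡ c (λ i → ∑ℚ (f i) J) I)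

  boxSum-neg : ∀ f I J → boxSum (λ i j → - f i j) I J ≡ - boxSum f I J
  boxSum-neg f I J = trans (∑ℚ-cong (λ i → ∑ℚ-neg (f i) J) I) (∑ℚ-neg (λ i → ∑ℚ (f i) J) I)

  null-cong : ∀ {f g} → (∀ i j → .{{NonZero i}} → .{{NonZero j}} → f i j ≡ g i j) → Null f → Null g
  null-cong h N ε with N ε
  ... | M , small = M , λ {I} {J} M≤I M≤J → subst (λ x → ∣ x ∣ ≤ ε) (boxSum-cong h I J) (small M≤I M≤J)

  null-+ : ∀ {f g} → Null f → Null g → Null (λ i j → f i j + g i j)
  null-+ {f} {g} Nf Ng ε with Nf (½ * ε) {{half-pos ε}} | Ng (½ * ε) {{half-pos ε}}
  ... | K , p | L , q = K ℕ.⊔ L , λ {I} {J} M≤I M≤J → begin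
    ∣ boxSum (λ i j → f i j + g i j) I J ∣    ≡⟨ cong ∣_∣ (boxSum-+ f g I J) ⟩
    ∣ boxSum f I J + boxSum g I J ∣           ≤⟨ ∣p+q∣≤∣p∣+∣q∣ (boxSum f I J) (boxSum g I J) ⟩
    ∣ boxSum f I J ∣ + ∣ boxSum g I J ∣       ≤⟨ +-mono-≤ (p (⊔ˡ {K} {L} M≤I) (⊔ˡ {K} {L} M≤J)) (q (⊔ʳ {K} {L} M≤I) (⊔ʳ {K} {L} M≤J)) ⟩
    ½ * ε + ½ * ε                             ≡⟨ halves ε ⟩
    ε                                         ∎
    where open ≤-Reasoning

  scale-small : ∀ c ε .{{_ : Positive ε}} → ∃ λ e → Positive e × ∀ x → ∣ x ∣ ≤ e → ∣ c ∣ * ∣ x ∣ ≤ ½ * ε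
  scale-small c ε =
    let e , e>0 , eq = shrink ε A {{nonNeg+pos⇒pos ∣ c ∣ {{∣-∣-nonNeg c}} 1ℚ}}
    in e , e>0 , λ x x≤e → subst (∣ c ∣ * ∣ x ∣ ≤_) eq
         (*-mono-≤-nonNeg {∣ c ∣} {A} {∣ x ∣} {e} (0≤∣p∣ c) c≤A (0≤∣p∣ x) x≤e)
    where
    A : ℚ
    -- The added 1 keeps A positive when c = 0.
    A = ∣ c ∣ + 1ℚ
    c≤A : ∣ c ∣ ≤ A
    c≤A = p≤p+nonNeg {∣ c ∣} {1ℚ} (nonNegative⁻¹ 1ℚ)

  null-*ˡ : ∀ {f} c → Null f → Null (λ i j → c * f i j)
  null-*ˡ {f} c N ε =
    let e , e>0 , scale = scale-small c ε
        M , small = N e {{e>0}}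
    in M , λ {I} {J} M≤I M≤J → bound I J (scale (boxSum f I J) (small M≤I M≤J))
    where
    open ≤-Reasoning
    bound : ∀ I J → ∣ c ∣ * ∣ boxSum f I J ∣ ≤ ½ * ε → ∣ boxSum (λ i j → c * f i j) I J ∣ ≤ ε
    bound I J h = begin
      ∣ boxSum (λ i j → c * f i j) I J ∣  ≡⟨ cong ∣_∣ (boxSum-*ˡ c f I J) ⟩
      ∣ c * boxSum f I J ∣                ≡⟨ ∣p*q∣≡∣p∣*∣q∣ c (boxSum f I J) ⟩
      ∣ c ∣ * ∣ boxSum f I J ∣            ≤⟨ h ⟩
      ½ * ε                               ≤⟨ ½ε≤ε ε ⟩
      ε                                   ∎

  null-zero : ∀ {f} → (∀ i j → .{{NonZero i}} → .{{NonZero j}} → f i j ≡ 0ℚ) → Null f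
  null-zero h ε = 0 , λ {I} {J} _ _ → ≤-trans
    (≤-reflexive (cong ∣_∣ (∑ℚ-zero I λ i _ → ∑ℚ-zero J λ j _ → h i j))) (nonNegative⁻¹ ε {{pos⇒nonNeg ε}})

  -- Absolute convergence with one fixed majorant. Guards, dilations of a variable and factors of
  -- absolute value at most 1 all preserve it, so one tail estimate covers every series that occurs.
  Dominated : (ℕ → ℕ → ℚ) → Set
  Dominated f = ∀ i j → .{{NonZero i}} → .{{NonZero j}} → ∣ f i j ∣ ≤ decay i * decay j

  ∑-tail : ∀ f M N → M ℕ.≤ N → ∑ℚ f N - ∑ℚ f M ≡ ∑ℚ (λ k → f (M ℕ.+ k)) (N ℕ.∸ M)
  ∑-tail f M N M≤N = begin
    ∑ℚ f N - ∑ℚ f M                                         ≡⟨ cong (λ n → ∑ℚ f n - ∑ℚ f M) (sym (ℕP.m+[n∸m]≡n M≤N)) ⟩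
    ∑ℚ f (M ℕ.+ (N ℕ.∸ M)) - ∑ℚ f M                         ≡⟨ cong (_- ∑ℚ f M) (∑ℚ-split f M (N ℕ.∸ M)) ⟩
    ∑ℚ f M + ∑ℚ (λ k → f (M ℕ.+ k)) (N ℕ.∸ M) - ∑ℚ f M      ≡⟨ solve 2 (λ a t → a :+ t :- a := t) refl (∑ℚ f M) _ ⟩
    ∑ℚ (λ k → f (M ℕ.+ k)) (N ℕ.∸ M)                        ∎
    where open ≡-Reasoning

  abstract
    mass : ℚ
    mass = proj₁ ∑decay-total

    mass-pos : Positive mass
    mass-pos = proj₁ (proj₂ ∑decay-total)

    ∑decay≤mass : ∀ N → ∑ℚ decay N ≤ mass
    ∑decay≤mass = proj₂ (proj₂ ∑decay-total)

  0≤mass : 0ℚ ≤ mass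
  0≤mass = nonNegative⁻¹ mass {{pos⇒nonNeg mass {{mass-pos}}}}

  ∑decay-tail-scaled : ∀ ε .{{_ : Positive ε}} → ∃ λ M → ∀ {K} → M ℕ.≤ K → ∀ N → mass * ∑ℚ (λ k → decay (K ℕ.+ k)) N ≤ ½ * ε
  ∑decay-tail-scaled ε =
    let e , e>0 , eq = shrink ε mass {{mass-pos}}
        M , small = ∑decay-tail e {{e>0}}
    in M , λ M≤K N → subst (_ ≤_) eq (*-monoˡ-≤-nonNeg mass {{ℚ.nonNegative 0≤mass}} (small M≤K N))

  row-bound : ∀ {f} → Dominated f → ∀ i → .{{NonZero i}} → ∀ J → ∣ ∑ℚ (f i) J ∣ ≤ mass * decay i
  row-bound {f} dom i J = begin
    ∣ ∑ℚ (f i) J ∣           ≤⟨ ∣∑ℚ∣≤ (λ j → dom i j) J ⟩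
    ∑ℚ (λ j → decay i * decay j) J   ≡⟨ ∑ℚ-*ˡ (decay i) decay J ⟩
    decay i * ∑ℚ decay J             ≤⟨ *-monoˡ-≤-nonNeg (decay i) {{ℚ.nonNegative (0≤decay i)}} (∑decay≤mass J) ⟩
    decay i * mass                ≡⟨ *-comm (decay i) mass ⟩
    mass * decay i                ∎
    where open ≤-Reasoning

  shift≢0 : ∀ M k → .{{NonZero k}} → NonZero (M ℕ.+ k)
  shift≢0 M (suc k) = ℕ.>-nonZero (ℕP.m<n⇒0<n (ℕP.m<m+n M ℕ.z<s))

  -- The boxes differ by the rows M < i ≤ N, and `row-bound` controls each of them independently of
  -- the width J.
  rows-bound : ∀ {f} → Dominated f → ∀ {M N} → M ℕ.≤ N → ∀ J →
    ∣ boxSum f N J - boxSum f M J ∣ ≤ mass * ∑ℚ (λ k → decay (M ℕ.+ k)) (N ℕ.∸ M)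
  rows-bound {f} dom {M} {N} M≤N J = begin
    ∣ boxSum f N J - boxSum f M J ∣                       ≡⟨ cong ∣_∣ (∑-tail (λ i → ∑ℚ (f i) J) M N M≤N) ⟩
    ∣ ∑ℚ (λ k → ∑ℚ (f (M ℕ.+ k)) J) (N ℕ.∸ M) ∣           ≤⟨ ∣∑ℚ∣≤ (λ k → row-bound dom (M ℕ.+ k) {{shift≢0 M k}} J) (N ℕ.∸ M) ⟩
    ∑ℚ (λ k → mass * decay (M ℕ.+ k)) (N ℕ.∸ M)                ≡⟨ ∑ℚ-*ˡ mass (λ k → decay (M ℕ.+ k)) (N ℕ.∸ M) ⟩
    mass * ∑ℚ (λ k → decay (M ℕ.+ k)) (N ℕ.∸ M)                ∎
    where open ≤-Reasoning

  column-tail : ∀ {f} → Dominated f → ∀ i → .{{NonZero i}} → ∀ {M N} → M ℕ.≤ N →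
    ∣ ∑ℚ (f i) N - ∑ℚ (f i) M ∣ ≤ decay i * ∑ℚ (λ k → decay (M ℕ.+ k)) (N ℕ.∸ M)
  column-tail {f} dom i {M} {N} M≤N = begin
    ∣ ∑ℚ (f i) N - ∑ℚ (f i) M ∣                           ≡⟨ cong ∣_∣ (∑-tail (f i) M N M≤N) ⟩
    ∣ ∑ℚ (λ k → f i (M ℕ.+ k)) (N ℕ.∸ M) ∣                ≤⟨ ∣∑ℚ∣≤ (λ k → dom i (M ℕ.+ k) {{it}} {{shift≢0 M k}}) (N ℕ.∸ M) ⟩
    ∑ℚ (λ k → decay i * decay (M ℕ.+ k)) (N ℕ.∸ M)                ≡⟨ ∑ℚ-*ˡ (decay i) (λ k → decay (M ℕ.+ k)) (N ℕ.∸ M) ⟩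
    decay i * ∑ℚ (λ k → decay (M ℕ.+ k)) (N ℕ.∸ M)                ∎
    where
    open ≤-Reasoning
    it : NonZero i
    it = ℕ.≢-nonZero (ℕ.≢-nonZero⁻¹ i)

  0≤∑decay : ∀ M N → 0ℚ ≤ ∑ℚ (λ k → decay (M ℕ.+ k)) N
  0≤∑decay M = ∑ℚ-nonNeg (λ k → 0≤decay (M ℕ.+ k))

  columns-bound : ∀ {f} → Dominated f → ∀ {M N} → M ℕ.≤ N → ∀ I →
    ∣ boxSum f I N - boxSum f I M ∣ ≤ mass * ∑ℚ (λ k → decay (M ℕ.+ k)) (N ℕ.∸ M)
  columns-bound {f} dom {M} {N} M≤N I = begin
    ∣ boxSum f I N - boxSum f I M ∣                       ≡⟨ cong ∣_∣ (sym (trans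
                                                               (∑ℚ-+ (λ i → ∑ℚ (f i) N) (λ i → - ∑ℚ (f i) M) I)
                                                               (cong (boxSum f I N +_) (∑ℚ-neg (λ i → ∑ℚ (f i) M) I)))) ⟩
    ∣ ∑ℚ (λ i → ∑ℚ (f i) N - ∑ℚ (f i) M) I ∣              ≤⟨ ∣∑ℚ∣≤ (λ i → ≤-trans (column-tail dom i M≤N) (≤-reflexive (*-comm (decay i) t))) I ⟩
    ∑ℚ (λ i → t * decay i) I                                  ≡⟨ ∑ℚ-*ˡ t decay I ⟩
    t * ∑ℚ decay I                                            ≤⟨ *-monoˡ-≤-nonNeg t {{ℚ.nonNegative (0≤∑decay M (N ℕ.∸ M))}} (∑decay≤mass I) ⟩
    t * mass                                               ≡⟨ *-comm t mass ⟩
    mass * t                                               ∎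
    where
    open ≤-Reasoning
    t = ∑ℚ (λ k → decay (M ℕ.+ k)) (N ℕ.∸ M)

  decay-dilate : ∀ p .{{_ : NonZero p}} n .{{_ : NonZero n}} → decay (p ℕ.* n) ≤ decay n
  decay-dilate p n = decay-anti (ℕP.m≤n*m n p)

  /-large : ∀ {M N} p .{{_ : NonZero p}} → M ℕ.* p ℕ.≤ N → M ℕ.≤ N ℕ./ p
  /-large {M} {N} p h = subst (ℕ._≤ N ℕ./ p) (m*n/n≡m M p) (/-monoˡ-≤ p h)

  guard-∑ : ∀ {P : Set} (d : Dec P) f J → ∑ℚ (λ j → guardℚ d (f j)) J ≡ guardℚ d (∑ℚ f J)
  guard-∑ (yes _) f J = refl
  guard-∑ (no _)  f J = ∑ℚ-zero J (λ _ _ → refl)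

  -- The multiples of p up to I are the p k with k ≤ I / p. Hence the two box sums differ only by
  -- the rows of the dilated series between I / p and I, and I ≥ M p places these rows in a small
  -- tail.
  dilate₁ : ∀ p .{{_ : NonZero p}} {f} → Dominated f →
    Null (λ i j → guardℚ (p ∣? i) (f i j) - f (p ℕ.* i) j)
  dilate₁ p {f} dom ε =
    let M , small = ∑decay-tail-scaled ε
    in M ℕ.* p , λ {I} {J} MpI _ → bound I J (small {I ℕ./ p} (/-large {M} {I} p MpI) (I ℕ.∸ I ℕ./ p))
    where
    open ≤-Reasoning
    F : ℕ → ℕ → ℚ
    F i j = f (p ℕ.* i) j
    domF : Dominated F
    domF i j = ≤-trans (dom (p ℕ.* i) j {{ℕP.m*n≢0 p i}} {{ℕ.≢-nonZero (ℕ.≢-nonZero⁻¹ j)}})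
      (*-monoʳ-≤-nonNeg (decay j) {{ℚ.nonNegative (0≤decay j)}} (decay-dilate p i))
    multiples : ∀ I J → boxSum (λ i j → guardℚ (p ∣? i) (f i j)) I J ≡ boxSum F (I ℕ./ p) J
    multiples I J = trans (∑ℚ-cong (λ i → guard-∑ (p ∣? i) (f i) J) I) (∑ℚ-multiples p (λ i → ∑ℚ (f i) J) I)
    difference : ∀ I J → boxSum (λ i j → guardℚ (p ∣? i) (f i j) - F i j) I J ≡ boxSum F (I ℕ./ p) J - boxSum F I J
    difference I J = trans (boxSum-+ (λ i j → guardℚ (p ∣? i) (f i j)) (λ i j → - F i j) I J)
      (cong₂ _+_ (multiples I J) (boxSum-neg F I J))
    bound : ∀ I J → mass * ∑ℚ (λ k → decay (I ℕ./ p ℕ.+ k)) (I ℕ.∸ I ℕ./ p) ≤ ½ * ε →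
      ∣ boxSum (λ i j → guardℚ (p ∣? i) (f i j) - F i j) I J ∣ ≤ ε
    bound I J h = begin
      ∣ boxSum (λ i j → guardℚ (p ∣? i) (f i j) - F i j) I J ∣  ≡⟨ cong ∣_∣ (difference I J) ⟩
      ∣ boxSum F (I ℕ./ p) J - boxSum F I J ∣                   ≡⟨ dist-sym (boxSum F (I ℕ./ p) J) (boxSum F I J) ⟩
      ∣ boxSum F I J - boxSum F (I ℕ./ p) J ∣                   ≤⟨ rows-bound domF (m/n≤m I p) J ⟩
      mass * ∑ℚ (λ k → decay (I ℕ./ p ℕ.+ k)) (I ℕ.∸ I ℕ./ p)        ≤⟨ h ⟩
      ½ * ε                                                     ≤⟨ ½ε≤ε ε ⟩
      ε                                                         ∎

  dilate₂ : ∀ p .{{_ : NonZero p}} {f} → Dominated f →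
    Null (λ i j → guardℚ (p ∣? j) (f i j) - f i (p ℕ.* j))
  dilate₂ p {f} dom ε =
    let M , small = ∑decay-tail-scaled ε
    in M ℕ.* p , λ {I} {J} _ MpJ → bound I J (small {J ℕ./ p} (/-large {M} {J} p MpJ) (J ℕ.∸ J ℕ./ p))
    where
    open ≤-Reasoning
    F : ℕ → ℕ → ℚ
    F i j = f i (p ℕ.* j)
    domF : Dominated F
    domF i j = ≤-trans (dom i (p ℕ.* j) {{ℕ.≢-nonZero (ℕ.≢-nonZero⁻¹ i)}} {{ℕP.m*n≢0 p j}})
      (*-monoˡ-≤-nonNeg (decay i) {{ℚ.nonNegative (0≤decay i)}} (decay-dilate p j))
    difference : ∀ I J → boxSum (λ i j → guardℚ (p ∣? j) (f i j) - F i j) I J ≡ boxSum F I (J ℕ./ p) - boxSum F I J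
    difference I J = trans (boxSum-+ (λ i j → guardℚ (p ∣? j) (f i j)) (λ i j → - F i j) I J)
      (cong₂ _+_ (∑ℚ-cong (λ i → ∑ℚ-multiples p (f i) J) I) (boxSum-neg F I J))
    bound : ∀ I J → mass * ∑ℚ (λ k → decay (J ℕ./ p ℕ.+ k)) (J ℕ.∸ J ℕ./ p) ≤ ½ * ε →
      ∣ boxSum (λ i j → guardℚ (p ∣? j) (f i j) - F i j) I J ∣ ≤ ε
    bound I J h = begin
      ∣ boxSum (λ i j → guardℚ (p ∣? j) (f i j) - F i j) I J ∣  ≡⟨ cong ∣_∣ (difference I J) ⟩
      ∣ boxSum F I (J ℕ./ p) - boxSum F I J ∣                   ≡⟨ dist-sym (boxSum F I (J ℕ./ p)) (boxSum F I J) ⟩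
      ∣ boxSum F I J - boxSum F I (J ℕ./ p) ∣                   ≤⟨ columns-bound domF (m/n≤m J p) I ⟩
      mass * ∑ℚ (λ k → decay (J ℕ./ p ℕ.+ k)) (J ℕ.∸ J ℕ./ p)        ≤⟨ h ⟩
      ½ * ε                                                     ≤⟨ ½ε≤ε ε ⟩
      ε                                                         ∎

  -- The summand: behaviour under dilation by a prime, and domination

  summandℚ : ℕ → ℕ → ℚ
  summandℚ i j = ι (μ j) * inv (i ℕ.^ 2 ℕ.* j ℕ.* φ (i ℕ.* j))

  ν*inv* : ∀ c .{{_ : NonZero c}} x → ν c * inv (c ℕ.* x) ≡ inv x
  ν*inv* c x = begin
    ν c * inv (c ℕ.* x)    ≡⟨ cong (ν c *_) (inv-* c x) ⟩
    ν c * (inv c * inv x)  ≡⟨ sym (*-assoc (ν c) (inv c) (inv x)) ⟩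
    ν c * inv c * inv x    ≡⟨ cong (_* inv x) (ν*inv c) ⟩
    1ℚ * inv x             ≡⟨ *-identityˡ (inv x) ⟩
    inv x                  ∎
    where open ≡-Reasoning

  -- Reduces a dilation law with unchanged μ to an identity between denominators in ℕ.
  summandℚ-scale : ∀ c .{{_ : NonZero c}} i j i′ j′ → ι (μ j′) ≡ ι (μ j) →
    i′ ℕ.^ 2 ℕ.* j′ ℕ.* φ (i′ ℕ.* j′) ≡ c ℕ.* (i ℕ.^ 2 ℕ.* j ℕ.* φ (i ℕ.* j)) → ν c * summandℚ i′ j′ ≡ summandℚ i j
  summandℚ-scale c i j i′ j′ μ≡ eq = begin
    ν c * (ι (μ j′) * inv (i′ ℕ.^ 2 ℕ.* j′ ℕ.* φ (i′ ℕ.* j′)))  ≡⟨ cong₂ (λ x y → ν c * (x * inv y)) μ≡ eq ⟩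
    ν c * (ι (μ j) * inv (c ℕ.* d))                             ≡⟨ solve 3 (λ c m x → c :* (m :* x) := m :* (c :* x)) refl (ν c) (ι (μ j)) _ ⟩
    ι (μ j) * (ν c * inv (c ℕ.* d))                             ≡⟨ cong (ι (μ j) *_) (ν*inv* c d) ⟩
    ι (μ j) * inv d                                             ∎
    where
    open ≡-Reasoning
    d = i ℕ.^ 2 ℕ.* j ℕ.* φ (i ℕ.* j)

  module _ {p} (pp : Prime p) where

    private instance
      p≢0 : NonZero p
      p≢0 = prime⇒nonZero pp

    pred-p≢0 : NonZero (ℕ.pred p)
    pred-p≢0 = ℕ.>-nonZero (ℕP.pred-mono-≤ (prime≥2 pp))

    -- Of the factor p³, two powers come from i² and one from φ, since p already divides i j. When p
    -- does not divide i j, as in the next law, φ contributes p - 1 instead.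
    summandℚ-dilate₁-∣ : ∀ i j → p ∣ i ℕ.* j → ν (p ℕ.* p ℕ.* p) * summandℚ (p ℕ.* i) j ≡ summandℚ i j
    summandℚ-dilate₁-∣ i j p∣ij = summandℚ-scale (p ℕ.* p ℕ.* p) {{ℕP.m*n≢0 (p ℕ.* p) p {{ℕP.m*n≢0 p p}}}} i j (p ℕ.* i) j refl (begin
      (p ℕ.* i) ℕ.^ 2 ℕ.* j ℕ.* φ (p ℕ.* i ℕ.* j)    ≡⟨ cong ((p ℕ.* i) ℕ.^ 2 ℕ.* j ℕ.*_)
                                                         (trans (cong φ (ℕP.*-assoc p i j)) (φ-prime-∣ pp p∣ij)) ⟩
      (p ℕ.* i) ℕ.^ 2 ℕ.* j ℕ.* (p ℕ.* φ (i ℕ.* j))  ≡⟨ lemma p i j (φ (i ℕ.* j)) ⟩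
      p ℕ.* p ℕ.* p ℕ.* (i ℕ.^ 2 ℕ.* j ℕ.* φ (i ℕ.* j)) ∎)
      where
      open ≡-Reasoning
      lemma : ∀ p i j f → (p ℕ.* i) ℕ.* ((p ℕ.* i) ℕ.* 1) ℕ.* j ℕ.* (p ℕ.* f) ≡ p ℕ.* p ℕ.* p ℕ.* (i ℕ.* (i ℕ.* 1) ℕ.* j ℕ.* f)
      lemma = solve-∀

    summandℚ-dilate₁-∤ : ∀ i j → p ∤ i ℕ.* j → ν (p ℕ.* p ℕ.* ℕ.pred p) * summandℚ (p ℕ.* i) j ≡ summandℚ i j
    summandℚ-dilate₁-∤ i j p∤ij = summandℚ-scale (p ℕ.* p ℕ.* ℕ.pred p) {{ℕP.m*n≢0 (p ℕ.* p) (ℕ.pred p) {{ℕP.m*n≢0 p p}} {{pred-p≢0}}}} i j (p ℕ.* i) j refl (begin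
      (p ℕ.* i) ℕ.^ 2 ℕ.* j ℕ.* φ (p ℕ.* i ℕ.* j)    ≡⟨ cong ((p ℕ.* i) ℕ.^ 2 ℕ.* j ℕ.*_)
                                                         (trans (cong φ (ℕP.*-assoc p i j)) (φ-prime-∤ pp p∤ij)) ⟩
      (p ℕ.* i) ℕ.^ 2 ℕ.* j ℕ.* (ℕ.pred p ℕ.* φ (i ℕ.* j))  ≡⟨ lemma p (ℕ.pred p) i j (φ (i ℕ.* j)) ⟩
      p ℕ.* p ℕ.* ℕ.pred p ℕ.* (i ℕ.^ 2 ℕ.* j ℕ.* φ (i ℕ.* j)) ∎)
      where
      open ≡-Reasoning
      lemma : ∀ p q i j f → (p ℕ.* i) ℕ.* ((p ℕ.* i) ℕ.* 1) ℕ.* j ℕ.* (q ℕ.* f) ≡ p ℕ.* p ℕ.* q ℕ.* (i ℕ.* (i ℕ.* 1) ℕ.* j ℕ.* f)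
      lemma = solve-∀

    -- The factor j and the totient each contribute one p, and μ changes sign.
    summandℚ-dilate₂ : ∀ i j → .{{NonZero j}} → p ∣ i → p ∤ j → ν (p ℕ.* p) * summandℚ i (p ℕ.* j) ≡ - summandℚ i j
    summandℚ-dilate₂ i j p∣i p∤j = begin
      ν (p ℕ.* p) * (ι (μ (p ℕ.* j)) * inv (i ℕ.^ 2 ℕ.* (p ℕ.* j) ℕ.* φ (i ℕ.* (p ℕ.* j))))
        ≡⟨ cong₂ (λ x y → ν (p ℕ.* p) * (x * inv y)) (trans (cong ι (μ-prime-∤ pp p∤j)) (ι-neg (μ j))) denominator ⟩
      ν (p ℕ.* p) * (- ι (μ j) * inv (p ℕ.* p ℕ.* d))
        ≡⟨ solve 3 (λ c m x → c :* (:- m :* x) := :- (m :* (c :* x))) refl (ν (p ℕ.* p)) (ι (μ j)) _ ⟩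
      - (ι (μ j) * (ν (p ℕ.* p) * inv (p ℕ.* p ℕ.* d)))
        ≡⟨ cong (λ z → - (ι (μ j) * z)) (ν*inv* (p ℕ.* p) {{ℕP.m*n≢0 p p}} d) ⟩
      - summandℚ i j ∎
      where
      open ≡-Reasoning
      d = i ℕ.^ 2 ℕ.* j ℕ.* φ (i ℕ.* j)
      swap : ∀ p i j → i ℕ.* (p ℕ.* j) ≡ p ℕ.* (i ℕ.* j)
      swap = solve-∀
      lemma : ∀ p i j f → i ℕ.* (i ℕ.* 1) ℕ.* (p ℕ.* j) ℕ.* (p ℕ.* f) ≡ p ℕ.* p ℕ.* (i ℕ.* (i ℕ.* 1) ℕ.* j ℕ.* f)
      lemma = solve-∀
      denominator : i ℕ.^ 2 ℕ.* (p ℕ.* j) ℕ.* φ (i ℕ.* (p ℕ.* j)) ≡ p ℕ.* p ℕ.* d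
      denominator = trans (cong (i ℕ.^ 2 ℕ.* (p ℕ.* j) ℕ.*_)
        (trans (cong φ (swap p i j)) (φ-prime-∣ pp (∣m⇒∣m*n j p∣i)))) (lemma p i j (φ (i ℕ.* j)))

    summandℚ-dilate₂-∣ : ∀ i j → .{{NonZero j}} → p ∣ j → summandℚ i (p ℕ.* j) ≡ 0ℚ
    summandℚ-dilate₂-∣ i j p∣j = trans (cong (_* inv d) (trans (cong ι (μ-prime-∣ pp p∣j)) ι-0)) (*-zeroˡ (inv d))
      where d = i ℕ.^ 2 ℕ.* (p ℕ.* j) ℕ.* φ (i ℕ.* (p ℕ.* j))

  -- From j ≤ i j ≤ 2 φ(ij)²; rounding 2 up to 4 turns the right-hand side into a square.
  √≤2φ : ∀ i j → .{{NonZero i}} → .{{NonZero j}} → √ j ℕ.≤ 2 ℕ.* φ (i ℕ.* j)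
  √≤2φ i j = ²-cancel-≤ (begin
    √ j ℕ.* √ j                      ≤⟨ √²≤ j ⟩
    j                                ≤⟨ ℕP.m≤n*m j i ⟩
    i ℕ.* j                          ≤⟨ proj₁ (φ-bound (i ℕ.* j) {{ℕP.m*n≢0 i j}}) ⟩
    2 ℕ.* (f ℕ.* f)                  ≤⟨ ℕP.*-monoˡ-≤ (f ℕ.* f) {2} {4} (s≤s (s≤s z≤n)) ⟩
    4 ℕ.* (f ℕ.* f)                  ≡⟨ lemma f ⟩
    (2 ℕ.* f) ℕ.* (2 ℕ.* f)          ∎)
    where
    open ℕP.≤-Reasoning
    f = φ (i ℕ.* j)
    lemma : ∀ f → 4 ℕ.* (f ℕ.* f) ≡ (2 ℕ.* f) ℕ.* (2 ℕ.* f)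
    lemma = solve-∀

  √≤ : ∀ n → √ n ℕ.≤ n
  √≤ n = ℕP.≤-trans (m≤m² (√ n)) (√²≤ n)
    where m≤m² : ∀ m → m ℕ.≤ m ℕ.* m
          m≤m² zero    = z≤n
          m≤m² (suc m) = ℕP.m≤m*n (suc m) (suc m)

  ι-abs≤1 : ∀ z → ℤ.∣ z ∣ ℕ.≤ 1 → ∣ ι z ∣ ≤ 1ℚ
  ι-abs≤1 (ℤ.+ n) h = begin
    ∣ ν n ∣  ≡⟨ 0≤p⇒∣p∣≡p (0≤ν n) ⟩
    ν n      ≤⟨ ν-mono-≤ h ⟩
    ν 1      ≡⟨ ν-1 ⟩
    1ℚ       ∎
    where open ≤-Reasoning
  ι-abs≤1 ℤ.-[1+ n ] h = begin
    ∣ ι (ℤ.- (ℤ.+ suc n)) ∣  ≡⟨ cong ∣_∣ (ι-neg (ℤ.+ suc n)) ⟩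
    ∣ - ν (suc n) ∣          ≡⟨ ∣-p∣≡∣p∣ (ν (suc n)) ⟩
    ∣ ν (suc n) ∣            ≤⟨ ι-abs≤1 (ℤ.+ suc n) h ⟩
    1ℚ                       ∎
    where open ≤-Reasoning

  -- The factor i² alone gives convergence in i, so all of φ(ij) can be spent on j. The constant 4
  -- is the product of the constants 2 in the two values of `decay`.
  summandℚ-dominated : Dominated summandℚ
  summandℚ-dominated i j = begin
    ∣ ι (μ j) * inv d ∣            ≡⟨ ∣p*q∣≡∣p∣*∣q∣ (ι (μ j)) (inv d) ⟩
    ∣ ι (μ j) ∣ * ∣ inv d ∣        ≤⟨ *-mono-≤-nonNeg (0≤∣p∣ (ι (μ j))) (ι-abs≤1 (μ j) (∣μ∣≤1 j)) (0≤∣p∣ (inv d))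
                                        (≤-reflexive (0≤p⇒∣p∣≡p (0≤inv d))) ⟩
    1ℚ * inv d                     ≡⟨ trans (*-identityˡ (inv d)) (sym (ν*inv* 4 d)) ⟩
    ν 4 * inv (4 ℕ.* d)            ≤⟨ *-monoˡ-≤-nonNeg (ν 4) {{ℚ.nonNegative (0≤ν 4)}} (inv-anti-≤
                                        {{ℕP.m*n≢0 (i ℕ.* √ i) (j ℕ.* √ j) {{n*√n≢0 i}} {{n*√n≢0 j}}}} bound) ⟩
    ν 4 * inv (x ℕ.* y)            ≡⟨ cong₂ _*_ (ν-* 2 2) (inv-* x y) ⟩
    ν 2 * ν 2 * (inv x * inv y)    ≡⟨ solve 3 (λ c x y → c :* c :* (x :* y) := c :* x :* (c :* y)) refl (ν 2) (inv x) (inv y) ⟩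
    decay i * decay j                      ∎
    where
    open ≤-Reasoning
    d = i ℕ.^ 2 ℕ.* j ℕ.* φ (i ℕ.* j)
    x = i ℕ.* √ i
    y = j ℕ.* √ j
    lemma : ∀ i j f → i ℕ.* i ℕ.* (j ℕ.* (2 ℕ.* f)) ≡ 2 ℕ.* (i ℕ.* (i ℕ.* 1) ℕ.* j ℕ.* f)
    lemma = solve-∀
    bound : x ℕ.* y ℕ.≤ 4 ℕ.* d
    bound = ℕP.≤-trans (ℕP.*-mono-≤ (ℕP.*-monoʳ-≤ i (√≤ i)) (ℕP.*-monoʳ-≤ j (√≤2φ i j)))
      (ℕP.≤-trans (ℕP.≤-reflexive (lemma i j (φ (i ℕ.* j)))) (ℕP.*-monoˡ-≤ d {2} {4} (s≤s (s≤s z≤n))))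

  -- Local factors

  coprime-^ : ∀ {p n} → Coprime p n → ∀ a → Coprime (p ℕ.^ a) n
  coprime-^ c zero    = 1-coprimeTo _
  coprime-^ c (suc a) = coprime-* c (coprime-^ c a)

  ^∣-cancelʳ : ∀ {p} → Prime p → ∀ a i {j} → p ∤ j → p ℕ.^ a ∣ i ℕ.* j → p ℕ.^ a ∣ i
  ^∣-cancelʳ {p} pp a i {j} p∤j h = coprime-divisor (coprime-^ (∤⇒coprime pp p∤j) a) (subst (p ℕ.^ a ∣_) (ℕP.*-comm i j) h)

  guardℚ-*ˡ : ∀ {A : Set} (d : Dec A) c x → c * guardℚ d x ≡ guardℚ d (c * x)
  guardℚ-*ˡ (yes _) c x = refl
  guardℚ-*ˡ (no _)  c x = *-zeroʳ c

  guard-zero : ∀ {A : Set} (d : Dec A) → guardℚ d 0ℚ ≡ 0ℚ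
  guard-zero (yes _) = refl
  guard-zero (no _)  = refl

  ∣guardℚ∣≤ : ∀ {A : Set} (d : Dec A) {x y} → ∣ x ∣ ≤ y → ∣ guardℚ d x ∣ ≤ y
  ∣guardℚ∣≤ (yes _) h = h
  ∣guardℚ∣≤ (no _) {x} h = ≤-trans (0≤∣p∣ x) h

  *-cube : ∀ {x} p a → ν (p ℕ.^ suc a) * ν (p ℕ.^ suc a) * ν (p ℕ.^ suc a) * x ≡
           ν (p ℕ.^ a) * ν (p ℕ.^ a) * ν (p ℕ.^ a) * (ν p * ν p * ν p * x)
  *-cube {x} p a = begin
    ν (p ℕ.^ suc a) * ν (p ℕ.^ suc a) * ν (p ℕ.^ suc a) * x   ≡⟨ cong (λ z → z * z * z * x) (ν-* p (p ℕ.^ a)) ⟩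
    (ν p * q) * (ν p * q) * (ν p * q) * x
      ≡⟨ solve 3 (λ p q x → (p :* q) :* (p :* q) :* (p :* q) :* x := q :* q :* q :* (p :* p :* p :* x)) refl (ν p) q x ⟩
    q * q * q * (ν p * ν p * ν p * x)                         ∎
    where
    open ≡-Reasoning
    q = ν (p ℕ.^ a)

  -- `χ` gathers the part of the summation conditions that is blind to p: divisibility by the parts
  -- of m and n prime to p, and absence of smaller prime factors. The local computation sees it only
  -- through its bound and its invariance under dilation by p.
  module LocalFactor {p : ℕ} (pp : Prime p) (χ : ℕ → ℕ → ℚ)
    (∣χ∣≤1 : ∀ i j → ∣ χ i j ∣ ≤ 1ℚ)
    (χ-dilate₁ : ∀ i j → χ (p ℕ.* i) j ≡ χ i j)
    (χ-dilate₂ : ∀ i j → χ i (p ℕ.* j) ≡ χ i j) where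

    private instance
      p≢0 : NonZero p
      p≢0 = prime⇒nonZero pp

    P : ℚ
    P = ν p

    cube : ℕ → ℚ
    cube a = ν (p ℕ.^ a) * ν (p ℕ.^ a) * ν (p ℕ.^ a)

    -- `H` stands for the second coordinates divisible by p exactly once, written p j and indexed by
    -- j. Higher powers of p in the second coordinate are annihilated by μ.
    G H U : ℕ → ℕ → ℚ
    G i j = guardℚ (¬? (p ∣? j)) (χ i j * summandℚ i j)
    H i j = guardℚ (¬? (p ∣? j)) (χ i j * summandℚ i (p ℕ.* j))
    U i j = guardℚ (¬? (p ∣? i)) (G i j)

    W X : ℕ → ℕ → ℕ → ℚ
    W a i j = guardℚ (p ℕ.^ a ∣? i) (G i j)
    X a i j = guardℚ (p ℕ.^ a ∣? i) (H i j)

    Z : ℕ → ℕ → ℕ → ℕ → ℚ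
    Z α β i j = guardℚ (p ℕ.^ α ∣? i) (guardℚ (p ℕ.^ (α ℕ.+ β) ∣? i ℕ.* j) (χ i j * summandℚ i j))

    χ*-dominated : ∀ i j {x y} → ∣ x ∣ ≤ y → ∣ χ i j * x ∣ ≤ y
    χ*-dominated i j {x} {y} h = begin
      ∣ χ i j * x ∣       ≡⟨ ∣p*q∣≡∣p∣*∣q∣ (χ i j) x ⟩
      ∣ χ i j ∣ * ∣ x ∣   ≤⟨ *-mono-≤-nonNeg (0≤∣p∣ (χ i j)) (∣χ∣≤1 i j) (0≤∣p∣ x) h ⟩
      1ℚ * y              ≡⟨ *-identityˡ y ⟩
      y                   ∎
      where open ≤-Reasoning

    W-dominated : ∀ a → Dominated (W a)
    W-dominated a i j = ∣guardℚ∣≤ (p ℕ.^ a ∣? i) (∣guardℚ∣≤ (¬? (p ∣? j)) (χ*-dominated i j (summandℚ-dominated i j)))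

    X-dominated : ∀ a → Dominated (X a)
    X-dominated a i j = ∣guardℚ∣≤ (p ℕ.^ a ∣? i) (∣guardℚ∣≤ (¬? (p ∣? j)) (χ*-dominated i j (≤-trans
      (summandℚ-dominated i (p ℕ.* j) {{≢0 i}} {{ℕP.m*n≢0 p j}})
      (*-monoˡ-≤-nonNeg (decay i) {{ℚ.nonNegative (0≤decay i)}} (decay-dilate p j)))))
      where
      ≢0 : ∀ i → .{{NonZero i}} → NonZero i
      ≢0 i = ℕ.≢-nonZero (ℕ.≢-nonZero⁻¹ i)

    Z-dominated : ∀ α β → Dominated (Z α β)
    Z-dominated α β i j = ∣guardℚ∣≤ (p ℕ.^ α ∣? i) (∣guardℚ∣≤ (p ℕ.^ (α ℕ.+ β) ∣? i ℕ.* j)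
      (χ*-dominated i j (summandℚ-dominated i j)))

    ^suc∣⇒∣ : ∀ a {i} → p ℕ.^ suc a ∣ i → p ∣ i
    ^suc∣⇒∣ a = m*n∣⇒m∣ p (p ℕ.^ a)

    guard-absorb : ∀ a i x → guardℚ (p ∣? i) (guardℚ (p ℕ.^ suc a ∣? i) x) ≡ guardℚ (p ℕ.^ suc a ∣? i) x
    guard-absorb a i x with p ℕ.^ suc a ∣? i
    ... | yes h = guardℚ-yes {d = p ∣? i} (^suc∣⇒∣ a h)
    ... | no  _ with p ∣? i
    ...   | yes _ = refl
    ...   | no  _ = refl

    ν-p³ : ν (p ℕ.* p ℕ.* p) ≡ P * P * P
    ν-p³ = trans (ν-* (p ℕ.* p) p) (cong (_* P) (ν-* p p))

    ν-pred-p : ν (ℕ.pred p) ≡ P - 1ℚ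
    ν-pred-p = begin
      ν (ℕ.pred p)                  ≡⟨ solve 1 (λ x → x := con 1ℚ :+ x :- con 1ℚ) refl (ν (ℕ.pred p)) ⟩
      1ℚ + ν (ℕ.pred p) - 1ℚ        ≡⟨ cong (_- 1ℚ) (sym (ν-suc (ℕ.pred p))) ⟩
      ν (suc (ℕ.pred p)) - 1ℚ       ≡⟨ cong (λ n → ν n - 1ℚ) (ℕP.suc-pred p) ⟩
      P - 1ℚ                        ∎
      where open ≡-Reasoning

    χ*summandℚ-dilate : ∀ i j k → p ∣ i ℕ.* k → P * P * P * (χ i j * summandℚ (p ℕ.* i) k) ≡ χ i j * summandℚ i k
    χ*summandℚ-dilate i j k p∣ = begin
      P * P * P * (χ i j * summandℚ (p ℕ.* i) k)
        ≡⟨ solve 3 (λ a c x → a :* (c :* x) := c :* (a :* x)) refl (P * P * P) (χ i j) (summandℚ (p ℕ.* i) k) ⟩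
      χ i j * (P * P * P * summandℚ (p ℕ.* i) k)
        ≡⟨ cong (χ i j *_) (trans (cong (_* summandℚ (p ℕ.* i) k) (sym ν-p³)) (summandℚ-dilate₁-∣ pp i k p∣)) ⟩
      χ i j * summandℚ i k ∎
      where open ≡-Reasoning

    W-dilate : ∀ a i j → W (suc a) (p ℕ.* i) j ≡ guardℚ (p ℕ.^ a ∣? i) (guardℚ (¬? (p ∣? j)) (χ i j * summandℚ (p ℕ.* i) j))
    W-dilate a i j = trans
      (guardℚ-cong {d = p ℕ.^ suc a ∣? p ℕ.* i} {e = p ℕ.^ a ∣? i} (*-cancelˡ-∣ p) (*-monoʳ-∣ p))
      (cong (λ z → guardℚ (p ℕ.^ a ∣? i) (guardℚ (¬? (p ∣? j)) (z * summandℚ (p ℕ.* i) j))) (χ-dilate₁ i j))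

    X-dilate : ∀ a i j → X (suc a) (p ℕ.* i) j ≡ guardℚ (p ℕ.^ a ∣? i) (guardℚ (¬? (p ∣? j)) (χ i j * summandℚ (p ℕ.* i) (p ℕ.* j)))
    X-dilate a i j = trans
      (guardℚ-cong {d = p ℕ.^ suc a ∣? p ℕ.* i} {e = p ℕ.^ a ∣? i} (*-cancelˡ-∣ p) (*-monoʳ-∣ p))
      (cong (λ z → guardℚ (p ℕ.^ a ∣? i) (guardℚ (¬? (p ∣? j)) (z * summandℚ (p ℕ.* i) (p ℕ.* j)))) (χ-dilate₁ i j))

    -- The guard p ∣ i created by `dilate₁` is implied by p^(a+1) ∣ i and is absorbed.
    W-shift : ∀ a → Null (λ i j → W (suc a) i j - W (suc a) (p ℕ.* i) j)
    W-shift a = null-cong (λ i j → cong (_- W (suc a) (p ℕ.* i) j) (guard-absorb a i (G i j)))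
      (dilate₁ p {W (suc a)} (W-dominated (suc a)))

    X-shift : ∀ a → Null (λ i j → X (suc a) i j - X (suc a) (p ℕ.* i) j)
    X-shift a = null-cong (λ i j → cong (_- X (suc a) (p ℕ.* i) j) (guard-absorb a i (H i j)))
      (dilate₁ p {X (suc a)} (X-dominated (suc a)))

    W-scale : ∀ a i j → P * P * P * W (suc (suc a)) (p ℕ.* i) j ≡ W (suc a) i j
    W-scale a i j = trans (cong (P * P * P *_) (W-dilate (suc a) i j)) (go (p ℕ.^ suc a ∣? i) (¬? (p ∣? j)))
      where
      go : (d : Dec (p ℕ.^ suc a ∣ i)) (e : Dec (p ∤ j)) →
        P * P * P * guardℚ d (guardℚ e (χ i j * summandℚ (p ℕ.* i) j)) ≡ guardℚ d (guardℚ e (χ i j * summandℚ i j))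
      go (yes h) (yes _) = χ*summandℚ-dilate i j j (∣m⇒∣m*n j (^suc∣⇒∣ a h))
      go (yes _) (no _)  = *-zeroʳ (P * P * P)
      go (no _)  _       = *-zeroʳ (P * P * P)

    -- In contrast to `W-scale`, this starts at a = 0: the second coordinate p j already supplies
    -- the prime p that makes φ scale by p rather than p - 1.
    X-scale : ∀ a i j → P * P * P * X (suc a) (p ℕ.* i) j ≡ X a i j
    X-scale a i j = trans (cong (P * P * P *_) (X-dilate a i j)) (go (p ℕ.^ a ∣? i) (¬? (p ∣? j)))
      where
      go : (d : Dec (p ℕ.^ a ∣ i)) (e : Dec (p ∤ j)) →
        P * P * P * guardℚ d (guardℚ e (χ i j * summandℚ (p ℕ.* i) (p ℕ.* j))) ≡ guardℚ d (guardℚ e (χ i j * summandℚ i (p ℕ.* j)))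
      go (yes _) (yes _) = χ*summandℚ-dilate i j (p ℕ.* j) (∣n⇒∣m*n i (m∣m*n j))
      go (yes _) (no _)  = *-zeroʳ (P * P * P)
      go (no _)  _       = *-zeroʳ (P * P * P)

    p^1∣ : ∀ {i} → p ∣ i → p ℕ.^ 1 ∣ i
    p^1∣ {i} = subst (_∣ i) (sym (ℕP.*-identityʳ p))

    -- Dilating i divides the summand by p³ if p ∣ i and by p²(p - 1) if not; (p - 1) p³ is a common
    -- multiple. The two kinds of i give the terms with W(1) and U.
    W1-scale : ∀ i j → (P - 1ℚ) * (P * P * P) * W 1 (p ℕ.* i) j ≡ P * U i j + (P - 1ℚ) * W 1 i j
    W1-scale i j = begin
      (P - 1ℚ) * (P * P * P) * W 1 (p ℕ.* i) j                        ≡⟨ cong ((P - 1ℚ) * (P * P * P) *_) (W-dilate 0 i j) ⟩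
      (P - 1ℚ) * (P * P * P) * guardℚ (1 ∣? i) (guardℚ (¬? (p ∣? j)) (χ i j * summandℚ (p ℕ.* i) j))
        ≡⟨ cong ((P - 1ℚ) * (P * P * P) *_) (guardℚ-yes {d = 1 ∣? i} (1∣ i)) ⟩
      (P - 1ℚ) * (P * P * P) * guardℚ (¬? (p ∣? j)) (χ i j * summandℚ (p ℕ.* i) j)
        ≡⟨ go ⟩
      P * U i j + (P - 1ℚ) * W 1 i j  ∎
      where
      open ≡-Reasoning
      go : (P - 1ℚ) * (P * P * P) * guardℚ (¬? (p ∣? j)) (χ i j * summandℚ (p ℕ.* i) j) ≡ P * U i j + (P - 1ℚ) * W 1 i j
      go with p ∣? i
      go | yes p∣i = begin
        (P - 1ℚ) * (P * P * P) * guardℚ (¬? (p ∣? j)) (χ i j * summandℚ (p ℕ.* i) j)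
          ≡⟨ trans (*-assoc (P - 1ℚ) (P * P * P) _) (cong ((P - 1ℚ) *_) (trans (guardℚ-*ˡ (¬? (p ∣? j)) (P * P * P) (χ i j * summandℚ (p ℕ.* i) j))
               (cong (guardℚ (¬? (p ∣? j))) (χ*summandℚ-dilate i j j (∣m⇒∣m*n j p∣i))))) ⟩
        (P - 1ℚ) * G i j
          ≡⟨ cong ((P - 1ℚ) *_) (sym (guardℚ-yes {d = p ℕ.^ 1 ∣? i} (p^1∣ p∣i))) ⟩
        (P - 1ℚ) * W 1 i j
          ≡⟨ solve 2 (λ p w → w := p :* con 0ℚ :+ w) refl P ((P - 1ℚ) * W 1 i j) ⟩
        P * 0ℚ + (P - 1ℚ) * W 1 i j ∎
      go | no p∤i = trans main (cong (λ z → P * G i j + (P - 1ℚ) * z) (sym (guardℚ-no {d = p ℕ.^ 1 ∣? i} λ h → p∤i (^suc∣⇒∣ 0 h))))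
        where
        coprime-case : p ∤ j → (P - 1ℚ) * (P * P * P) * (χ i j * summandℚ (p ℕ.* i) j) ≡ P * (χ i j * summandℚ i j)
        coprime-case p∤j = begin
          (P - 1ℚ) * (P * P * P) * (χ i j * summandℚ (p ℕ.* i) j)
            ≡⟨ solve 4 (λ q p c x → q :* (p :* p :* p) :* (c :* x) := p :* (c :* (p :* p :* q :* x))) refl (P - 1ℚ) P (χ i j) (summandℚ (p ℕ.* i) j) ⟩
          P * (χ i j * (P * P * (P - 1ℚ) * summandℚ (p ℕ.* i) j))
            ≡⟨ cong (λ z → P * (χ i j * (z * summandℚ (p ℕ.* i) j))) (sym (trans (ν-* (p ℕ.* p) (ℕ.pred p)) (cong₂ _*_ (ν-* p p) ν-pred-p))) ⟩
          P * (χ i j * (ν (p ℕ.* p ℕ.* ℕ.pred p) * summandℚ (p ℕ.* i) j))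
            ≡⟨ cong (λ z → P * (χ i j * z)) (summandℚ-dilate₁-∤ pp i j λ h → [ p∤i , p∤j ]′ (euclidsLemma i j pp h)) ⟩
          P * (χ i j * summandℚ i j) ∎
        main : (P - 1ℚ) * (P * P * P) * guardℚ (¬? (p ∣? j)) (χ i j * summandℚ (p ℕ.* i) j) ≡ P * G i j + (P - 1ℚ) * 0ℚ
        main with p ∣? j
        ... | yes _  = solve 1 (λ p → (p :- con 1ℚ) :* (p :* p :* p) :* con 0ℚ := p :* con 0ℚ :+ (p :- con 1ℚ) :* con 0ℚ) refl P
        ... | no p∤j = trans (coprime-case p∤j) (solve 2 (λ p x → p :* x := p :* x :+ (p :- con 1ℚ) :* con 0ℚ) refl P (χ i j * summandℚ i j))

    -- `X` is already indexed by j instead of p j, so the range of summation is not changed: the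
    -- relation is exact at each pair, not merely up to a null series.
    X1≡-W1 : ∀ i j → .{{NonZero j}} → P * P * X 1 i j ≡ - W 1 i j
    X1≡-W1 i j = go (p ℕ.^ 1 ∣? i) (p ∣? j)
      where
      go : (d : Dec (p ℕ.^ 1 ∣ i)) (e : Dec (p ∣ j)) →
        P * P * guardℚ d (guardℚ (¬? e) (χ i j * summandℚ i (p ℕ.* j))) ≡ - guardℚ d (guardℚ (¬? e) (χ i j * summandℚ i j))
      go (yes h) (no p∤j) = begin
        P * P * (χ i j * summandℚ i (p ℕ.* j))
          ≡⟨ solve 3 (λ a c x → a :* (c :* x) := c :* (a :* x)) refl (P * P) (χ i j) (summandℚ i (p ℕ.* j)) ⟩
        χ i j * (P * P * summandℚ i (p ℕ.* j))
          ≡⟨ cong (χ i j *_) (trans (cong (_* summandℚ i (p ℕ.* j)) (sym (ν-* p p))) (summandℚ-dilate₂ pp i j (^suc∣⇒∣ 0 h) p∤j)) ⟩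
        χ i j * - summandℚ i j         ≡⟨ sym (neg-distribʳ-* (χ i j) (summandℚ i j)) ⟩
        - (χ i j * summandℚ i j)       ∎
        where open ≡-Reasoning
      go (yes _) (yes _) = *-zeroʳ (P * P)
      go (no _)  _       = *-zeroʳ (P * P)

    -- Shifting and scaling give (p - 1) p³ W(1) = p U + (p - 1) W(1), an equation with W(1) on both
    -- sides. Solving it replaces summing a geometric series over the powers of p in i.
    null-W1 : Null (λ i j → (P - 1ℚ) * (P * P * P - 1ℚ) * W 1 i j - P * U i j)
    null-W1 = null-cong eq
      (null-*ˡ ((P - 1ℚ) * (P * P * P)) (W-shift 0))
      where
      open ≡-Reasoning
      eq : ∀ i j → .{{NonZero i}} → .{{NonZero j}} →
        (P - 1ℚ) * (P * P * P) * (W 1 i j - W 1 (p ℕ.* i) j) ≡ (P - 1ℚ) * (P * P * P - 1ℚ) * W 1 i j - P * U i j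
      eq i j = begin
        (P - 1ℚ) * (P * P * P) * (W 1 i j - W 1 (p ℕ.* i) j)
          ≡⟨ solve 3 (λ a w v → a :* (w :- v) := a :* w :- a :* v) refl ((P - 1ℚ) * (P * P * P)) (W 1 i j) (W 1 (p ℕ.* i) j) ⟩
        (P - 1ℚ) * (P * P * P) * W 1 i j - (P - 1ℚ) * (P * P * P) * W 1 (p ℕ.* i) j
          ≡⟨ cong (λ z → (P - 1ℚ) * (P * P * P) * W 1 i j - z) (W1-scale i j) ⟩
        (P - 1ℚ) * (P * P * P) * W 1 i j - (P * U i j + (P - 1ℚ) * W 1 i j)
          ≡⟨ solve 3 (λ p w u → (p :- con 1ℚ) :* (p :* p :* p) :* w :- (p :* u :+ (p :- con 1ℚ) :* w) :=
                                (p :- con 1ℚ) :* (p :* p :* p :- con 1ℚ) :* w :- p :* u) refl P (W 1 i j) (U i j) ⟩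
        (P - 1ℚ) * (P * P * P - 1ℚ) * W 1 i j - P * U i j ∎

    -- Combine p³ X(1) = X(0) with p² X(1) = - W(1).
    null-X0 : Null (λ i j → X 0 i j + P * W 1 i j)
    null-X0 = null-cong eq (null-*ˡ (- (P * P * P)) (X-shift 0))
      where
      open ≡-Reasoning
      eq : ∀ i j → .{{NonZero i}} → .{{NonZero j}} →
        - (P * P * P) * (X 1 i j - X 1 (p ℕ.* i) j) ≡ X 0 i j + P * W 1 i j
      eq i j = begin
        - (P * P * P) * (X 1 i j - X 1 (p ℕ.* i) j)
          ≡⟨ solve 3 (λ p x y → :- (p :* p :* p) :* (x :- y) := p :* p :* p :* y :- p :* (p :* p :* x)) refl P (X 1 i j) (X 1 (p ℕ.* i) j) ⟩
        P * P * P * X 1 (p ℕ.* i) j - P * (P * P * X 1 i j)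
          ≡⟨ cong₂ (λ x y → x - P * y) (X-scale 0 i j) (X1≡-W1 i j) ⟩
        X 0 i j - P * - W 1 i j
          ≡⟨ solve 3 (λ p x w → x :- p :* :- w := x :+ p :* w) refl P (X 0 i j) (W 1 i j) ⟩
        X 0 i j + P * W 1 i j ∎

    null-W : ∀ a → Null (λ i j → cube a * W (suc a) i j - W 1 i j)
    null-W zero    = null-zero λ i j → trans
      (cong (λ z → z * z * z * W 1 i j - W 1 i j) ν-1)
      (solve 1 (λ w → con 1ℚ :* con 1ℚ :* con 1ℚ :* w :- w := con 0ℚ) refl (W 1 i j))
    null-W (suc a) = null-cong eq (null-+ (null-*ˡ (cube (suc a)) (W-shift (suc a))) (null-W a))
      where
      open ≡-Reasoning
      eq : ∀ i j → .{{NonZero i}} → .{{NonZero j}} →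
        cube (suc a) * (W (suc (suc a)) i j - W (suc (suc a)) (p ℕ.* i) j) + (cube a * W (suc a) i j - W 1 i j)
        ≡ cube (suc a) * W (suc (suc a)) i j - W 1 i j
      eq i j = begin
        cube (suc a) * (w₂ - v) + (cube a * w₁ - w)
          ≡⟨ cong (_+ (cube a * w₁ - w)) (trans (*-distribˡ-+ (cube (suc a)) w₂ (- v)) (cong (cube (suc a) * w₂ +_) (sym (neg-distribʳ-* (cube (suc a)) v)))) ⟩
        cube (suc a) * w₂ - cube (suc a) * v + (cube a * w₁ - w)
          ≡⟨ cong (λ z → cube (suc a) * w₂ - z + (cube a * w₁ - w)) (trans (*-cube p a) (cong (cube a *_) (W-scale a i j))) ⟩
        cube (suc a) * w₂ - cube a * w₁ + (cube a * w₁ - w)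
          ≡⟨ solve 3 (λ x y w → x :- y :+ (y :- w) := x :- w) refl (cube (suc a) * w₂) (cube a * w₁) w ⟩
        cube (suc a) * w₂ - w ∎
        where
        w = W 1 i j
        w₁ = W (suc a) i j
        w₂ = W (suc (suc a)) i j
        v = W (suc (suc a)) (p ℕ.* i) j

    null-X : ∀ a → Null (λ i j → cube a * X a i j - X 0 i j)
    null-X zero    = null-zero λ i j → trans
      (cong (λ z → z * z * z * X 0 i j - X 0 i j) ν-1)
      (solve 1 (λ w → con 1ℚ :* con 1ℚ :* con 1ℚ :* w :- w := con 0ℚ) refl (X 0 i j))
    null-X (suc a) = null-cong eq (null-+ (null-*ˡ (cube (suc a)) (X-shift a)) (null-X a))
      where
      open ≡-Reasoning
      eq : ∀ i j → .{{NonZero i}} → .{{NonZero j}} →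
        cube (suc a) * (X (suc a) i j - X (suc a) (p ℕ.* i) j) + (cube a * X a i j - X 0 i j)
        ≡ cube (suc a) * X (suc a) i j - X 0 i j
      eq i j = begin
        cube (suc a) * (x₁ - v) + (cube a * x - x₀)
          ≡⟨ cong (_+ (cube a * x - x₀)) (trans (*-distribˡ-+ (cube (suc a)) x₁ (- v)) (cong (cube (suc a) * x₁ +_) (sym (neg-distribʳ-* (cube (suc a)) v)))) ⟩
        cube (suc a) * x₁ - cube (suc a) * v + (cube a * x - x₀)
          ≡⟨ cong (λ z → cube (suc a) * x₁ - z + (cube a * x - x₀)) (trans (*-cube p a) (cong (cube a *_) (X-scale a i j))) ⟩
        cube (suc a) * x₁ - cube a * x + (cube a * x - x₀)
          ≡⟨ solve 3 (λ x y w → x :- y :+ (y :- w) := x :- w) refl (cube (suc a) * x₁) (cube a * x) x₀ ⟩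
        cube (suc a) * x₁ - x₀ ∎
        where
        x₀ = X 0 i j
        x = X a i j
        x₁ = X (suc a) i j
        v = X (suc a) (p ℕ.* i) j

    -- Exponent of p in the least i admissible for a given j with p ∥ j.
    exponent∥ : ℕ → ℕ → ℕ
    exponent∥ α zero    = α
    exponent∥ α (suc β) = α ℕ.+ β

    -- For p ∤ j both conditions concern i alone, and p^(α+β) ∣ i contains p^α ∣ i.
    Z-on-∤ : ∀ α β i j → guardℚ (¬? (p ∣? j)) (Z α β i j) ≡ W (α ℕ.+ β) i j
    Z-on-∤ α β i j with p ∣? j
    ... | yes _ with p ℕ.^ (α ℕ.+ β) ∣? i
    ...   | yes _ = refl
    ...   | no  _ = refl
    Z-on-∤ α β i j | no p∤j = go (p ℕ.^ α ∣? i) (p ℕ.^ (α ℕ.+ β) ∣? i ℕ.* j) (p ℕ.^ (α ℕ.+ β) ∣? i)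
      where
      go : ∀ {x} (d : Dec (p ℕ.^ α ∣ i)) (e : Dec (p ℕ.^ (α ℕ.+ β) ∣ i ℕ.* j)) (f : Dec (p ℕ.^ (α ℕ.+ β) ∣ i)) →
        guardℚ d (guardℚ e x) ≡ guardℚ f x
      go (yes _) (yes h) f = sym (guardℚ-yes {d = f} (^∣-cancelʳ pp (α ℕ.+ β) i p∤j h))
      go (yes _) (no ¬h) f = sym (guardℚ-no {d = f} λ h → ¬h (∣m⇒∣m*n j h))
      go (no ¬d) _       f = sym (guardℚ-no {d = f} λ h →
        ¬d (m*n∣⇒m∣ (p ℕ.^ α) (p ℕ.^ β) (subst (_∣ i) (ℕP.^-distribˡ-+-* p α β) h)))

    -- If p ∣ j, both sides vanish because of μ. If not, the factor p of p j takes over one power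
    -- from the condition on the product: for β = 0 the condition p^α ∣ i remains decisive, for β ≥
    -- 1 it is implied by p^(α+β-1) ∣ i.
    Z-at-∥ : ∀ α β i j → .{{NonZero j}} → Z α β i (p ℕ.* j) ≡ X (exponent∥ α β) i j
    Z-at-∥ α β i j = go (p ∣? j)
      where
      swap : i ℕ.* (p ℕ.* j) ≡ p ℕ.* (i ℕ.* j)
      swap = trans (sym (ℕP.*-assoc i p j)) (trans (cong (ℕ._* j) (ℕP.*-comm i p)) (ℕP.*-assoc p i j))
      exp : ∀ β {x} → p ∤ j → guardℚ (p ℕ.^ α ∣? i) (guardℚ (p ℕ.^ (α ℕ.+ β) ∣? i ℕ.* (p ℕ.* j)) x)
                     ≡ guardℚ (p ℕ.^ exponent∥ α β ∣? i) x
      exp zero p∤j with p ℕ.^ α ∣? i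
      ... | yes h = guardℚ-yes {d = p ℕ.^ (α ℕ.+ 0) ∣? i ℕ.* (p ℕ.* j)}
                      (∣m⇒∣m*n (p ℕ.* j) (subst (λ a → p ℕ.^ a ∣ i) (sym (ℕP.+-identityʳ α)) h))
      ... | no  _ = refl
      exp (suc β) {x} p∤j with p ℕ.^ α ∣? i
      ... | yes _ = guardℚ-cong {d = p ℕ.^ (α ℕ.+ suc β) ∣? i ℕ.* (p ℕ.* j)} {e = p ℕ.^ (α ℕ.+ β) ∣? i}
        (λ h → ^∣-cancelʳ pp (α ℕ.+ β) i p∤j (*-cancelˡ-∣ p
                 (subst₂ _∣_ (cong (p ℕ.^_) (ℕP.+-suc α β)) swap h)))
        (λ h → subst₂ _∣_ (cong (p ℕ.^_) (sym (ℕP.+-suc α β))) (sym swap) (*-monoʳ-∣ p (∣m⇒∣m*n j h)))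
      ... | no ¬d = sym (guardℚ-no {d = p ℕ.^ (α ℕ.+ β) ∣? i} λ h →
        ¬d (m*n∣⇒m∣ (p ℕ.^ α) (p ℕ.^ β) (subst (_∣ i) (ℕP.^-distribˡ-+-* p α β) h)))
      go : (d : Dec (p ∣ j)) → Z α β i (p ℕ.* j) ≡ guardℚ (p ℕ.^ exponent∥ α β ∣? i) (guardℚ (¬? d) (χ i j * summandℚ i (p ℕ.* j)))
      go (yes p∣j) = begin
        Z α β i (p ℕ.* j)
          ≡⟨ cong (λ z → guardℚ (p ℕ.^ α ∣? i) (guardℚ (p ℕ.^ (α ℕ.+ β) ∣? i ℕ.* (p ℕ.* j)) z))
               (trans (cong (χ i (p ℕ.* j) *_) (summandℚ-dilate₂-∣ pp i j p∣j)) (*-zeroʳ (χ i (p ℕ.* j)))) ⟩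
        guardℚ (p ℕ.^ α ∣? i) (guardℚ (p ℕ.^ (α ℕ.+ β) ∣? i ℕ.* (p ℕ.* j)) 0ℚ)
          ≡⟨ cong (guardℚ (p ℕ.^ α ∣? i)) (guard-zero (p ℕ.^ (α ℕ.+ β) ∣? i ℕ.* (p ℕ.* j))) ⟩
        guardℚ (p ℕ.^ α ∣? i) 0ℚ
          ≡⟨ trans (guard-zero (p ℕ.^ α ∣? i)) (sym (guard-zero (p ℕ.^ exponent∥ α β ∣? i))) ⟩
        guardℚ (p ℕ.^ exponent∥ α β ∣? i) 0ℚ ∎
        where open ≡-Reasoning
      go (no p∤j) = trans
        (cong (λ z → guardℚ (p ℕ.^ α ∣? i) (guardℚ (p ℕ.^ (α ℕ.+ β) ∣? i ℕ.* (p ℕ.* j)) (z * summandℚ i (p ℕ.* j)))) (χ-dilate₂ i j))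
        (exp β p∤j)

    -- The pairs with p ∣ j are reindexed by `dilate₂`; those with p ∤ j are kept as they are.
    null-Z-split : ∀ α β → Null (λ i j → Z α β i j - (W (α ℕ.+ β) i j + X (exponent∥ α β) i j))
    null-Z-split α β = null-cong eq (dilate₂ p {Z α β} (Z-dominated α β))
      where
      open ≡-Reasoning
      complement : ∀ {A : Set} (d : Dec A) x → guardℚ d x ≡ x - guardℚ (¬? d) x
      complement (yes _) x = solve 1 (λ x → x := x :- con 0ℚ) refl x
      complement (no _)  x = sym (+-inverseʳ x)
      eq : ∀ i j → .{{NonZero i}} → .{{NonZero j}} →
        guardℚ (p ∣? j) (Z α β i j) - Z α β i (p ℕ.* j) ≡ Z α β i j - (W (α ℕ.+ β) i j + X (exponent∥ α β) i j)
      eq i j = begin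
        guardℚ (p ∣? j) (Z α β i j) - Z α β i (p ℕ.* j)
          ≡⟨ cong₂ _-_ (trans (complement (p ∣? j) (Z α β i j)) (cong (λ z → Z α β i j - z) (Z-on-∤ α β i j))) (Z-at-∥ α β i j) ⟩
        Z α β i j - W (α ℕ.+ β) i j - X (exponent∥ α β) i j
          ≡⟨ solve 3 (λ z w x → z :- w :- x := z :- (w :+ x)) refl (Z α β i j) (W (α ℕ.+ β) i j) (X (exponent∥ α β) i j) ⟩
        Z α β i j - (W (α ℕ.+ β) i j + X (exponent∥ α β) i j) ∎

    W0≡U+W1 : ∀ i j → W 0 i j ≡ U i j + W 1 i j
    W0≡U+W1 i j = trans (guardℚ-yes {d = 1 ∣? i} (1∣ i)) (trans (split (p ∣? i)) (cong (U i j +_)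
      (guardℚ-cong {d = p ∣? i} {e = p ℕ.^ 1 ∣? i} p^1∣ (^suc∣⇒∣ 0))))
      where
      split : ∀ {x} (d : Dec (p ∣ i)) → x ≡ guardℚ (¬? d) x + guardℚ d x
      split (yes _) = sym (+-identityˡ _)
      split (no _)  = sym (+-identityʳ _)

    -- Numerators of the Euler factor at p over the common denominator p^(3(α+β)) (p³ - 1). The
    -- first one, p³ - p - 1, belongs to the factor 1 - p/(p³ - 1) of S.
    localFactor : ℕ → ℕ → ℚ
    localFactor zero    zero    = P * P * P - P - 1ℚ
    localFactor (suc _) zero    = P * P * P + P * P
    localFactor _       (suc _) = - (P * P * P * P)

    -- Each case is a linear combination of earlier null series, with coefficients chosen so that
    -- every W and X cancels. In the steps below c = p³ - 1 and r = p^(3a), and equations hold up to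
    -- null series.
    null-local : ∀ α β → Null (λ i j → cube (α ℕ.+ β) * (P * P * P - 1ℚ) * Z α β i j - localFactor α β * U i j)
    -- Z = U + W(1) + X(0) = U - (p - 1) W(1), hence c Z = c U - p U.
    null-local zero zero = null-cong eq (null-+ (null-+ (null-*ˡ c (null-Z-split 0 0)) (null-*ˡ c null-X0)) (null-*ˡ (- 1ℚ) null-W1))
      where
      open ≡-Reasoning
      c = P * P * P - 1ℚ
      eq : ∀ i j → .{{NonZero i}} → .{{NonZero j}} →
        c * (Z 0 0 i j - (W 0 i j + X 0 i j)) + c * (X 0 i j + P * W 1 i j) + - 1ℚ * ((P - 1ℚ) * c * W 1 i j - P * U i j)
        ≡ cube 0 * c * Z 0 0 i j - (P * P * P - P - 1ℚ) * U i j
      eq i j = begin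
        c * (Z 0 0 i j - (W 0 i j + X 0 i j)) + c * (X 0 i j + P * W 1 i j) + - 1ℚ * ((P - 1ℚ) * c * W 1 i j - P * U i j)
          ≡⟨ cong (λ w → c * (Z 0 0 i j - (w + X 0 i j)) + c * (X 0 i j + P * W 1 i j) + - 1ℚ * ((P - 1ℚ) * c * W 1 i j - P * U i j)) (W0≡U+W1 i j) ⟩
        c * (Z 0 0 i j - (U i j + W 1 i j + X 0 i j)) + c * (X 0 i j + P * W 1 i j) + - 1ℚ * ((P - 1ℚ) * c * W 1 i j - P * U i j)
          ≡⟨ solve 5 (λ p z u w x →
               (p :* p :* p :- con 1ℚ) :* (z :- (u :+ w :+ x)) :+ (p :* p :* p :- con 1ℚ) :* (x :+ p :* w)
                 :+ con (- 1ℚ) :* ((p :- con 1ℚ) :* (p :* p :* p :- con 1ℚ) :* w :- p :* u)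
               := con 1ℚ :* con 1ℚ :* con 1ℚ :* (p :* p :* p :- con 1ℚ) :* z :- (p :* p :* p :- p :- con 1ℚ) :* u)
               refl P (Z 0 0 i j) (U i j) (W 1 i j) (X 0 i j) ⟩
        1ℚ * 1ℚ * 1ℚ * c * Z 0 0 i j - (P * P * P - P - 1ℚ) * U i j
          ≡⟨ cong (λ z → z * z * z * c * Z 0 0 i j - (P * P * P - P - 1ℚ) * U i j) (sym ν-1) ⟩
        cube 0 * c * Z 0 0 i j - (P * P * P - P - 1ℚ) * U i j ∎
    -- r p³ c Z = p³ c W(1) + c X(0) = p (p + 1) (p - 1) c W(1) = p² (p + 1) U.
    null-local (suc a) zero = null-cong eq (null-+ (null-+ (null-+ (null-+ (null-*ˡ (cube (suc a) * c) split)
        (null-*ˡ (P * P * P * c) (null-W a))) (null-*ˡ c (null-X (suc a)))) (null-*ˡ c null-X0)) (null-*ˡ (P * (P + 1ℚ)) null-W1))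
      where
      open ≡-Reasoning
      c = P * P * P - 1ℚ
      split : Null (λ i j → Z (suc a) 0 i j - (W (suc a) i j + X (suc a) i j))
      split = null-cong (λ i j → cong (λ n → Z (suc a) 0 i j - (W n i j + X (suc a) i j)) (ℕP.+-identityʳ (suc a))) (null-Z-split (suc a) 0)
      eq : ∀ i j → .{{NonZero i}} → .{{NonZero j}} →
        cube (suc a) * c * (Z (suc a) 0 i j - (W (suc a) i j + X (suc a) i j)) + P * P * P * c * (cube a * W (suc a) i j - W 1 i j)
          + c * (cube (suc a) * X (suc a) i j - X 0 i j) + c * (X 0 i j + P * W 1 i j) + P * (P + 1ℚ) * ((P - 1ℚ) * c * W 1 i j - P * U i j)
        ≡ cube (suc a ℕ.+ 0) * c * Z (suc a) 0 i j - (P * P * P + P * P) * U i j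
      eq i j = begin
        _ ≡⟨ cong (λ r → r * c * (z - (w + x)) + P * P * P * c * (cube a * w - w₁) + c * (r * x - x₀) + c * (x₀ + P * w₁) + P * (P + 1ℚ) * ((P - 1ℚ) * c * w₁ - P * u))
               cube-suc ⟩
        cube a * (P * P * P) * c * (z - (w + x)) + P * P * P * c * (cube a * w - w₁) + c * (cube a * (P * P * P) * x - x₀) + c * (x₀ + P * w₁) + P * (P + 1ℚ) * ((P - 1ℚ) * c * w₁ - P * u)
          ≡⟨ solve 8 (λ p r z w x w₁ x₀ u → let c = p :* p :* p :- con 1ℚ in
               r :* (p :* p :* p) :* c :* (z :- (w :+ x)) :+ p :* p :* p :* c :* (r :* w :- w₁) :+ c :* (r :* (p :* p :* p) :* x :- x₀)
                 :+ c :* (x₀ :+ p :* w₁) :+ p :* (p :+ con 1ℚ) :* ((p :- con 1ℚ) :* c :* w₁ :- p :* u)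
               := r :* (p :* p :* p) :* c :* z :- (p :* p :* p :+ p :* p) :* u) refl P (cube a) z w x w₁ x₀ u ⟩
        cube a * (P * P * P) * c * z - (P * P * P + P * P) * u
          ≡⟨ cong (λ r → r * c * z - (P * P * P + P * P) * u) (trans (sym cube-suc) (cong cube (sym (ℕP.+-identityʳ (suc a))))) ⟩
        cube (suc a ℕ.+ 0) * c * z - (P * P * P + P * P) * u ∎
        where
        z = Z (suc a) 0 i j
        w = W (suc a) i j
        x = X (suc a) i j
        w₁ = W 1 i j
        x₀ = X 0 i j
        u = U i j
        cube-suc : cube (suc a) ≡ cube a * (P * P * P)
        cube-suc = trans (sym (*-identityʳ (cube (suc a)))) (trans (*-cube p a) (cong (cube a *_) (*-identityʳ (P * P * P))))
    -- With a = α + β one has Z = W(a+1) + X(a), so r p³ c Z = p³ c (W(1) + X(0)) = - p³ (p - 1) c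
    -- W(1) = - p⁴ U.
    null-local α (suc β) = null-cong eq (null-+ (null-+ (null-+ (null-+ (null-*ˡ (cube (suc a) * c) split)
        (null-*ˡ (P * P * P * c) (null-W a))) (null-*ˡ (P * P * P * c) (null-X a))) (null-*ˡ (P * P * P * c) null-X0)) (null-*ˡ (- (P * P * P)) null-W1))
      where
      open ≡-Reasoning
      a = α ℕ.+ β
      c = P * P * P - 1ℚ
      split : Null (λ i j → Z α (suc β) i j - (W (suc a) i j + X a i j))
      split = null-cong (λ i j → cong (λ n → Z α (suc β) i j - (W n i j + X a i j)) (ℕP.+-suc α β)) (null-Z-split α (suc β))
      eq : ∀ i j → .{{NonZero i}} → .{{NonZero j}} →
        cube (suc a) * c * (Z α (suc β) i j - (W (suc a) i j + X a i j)) + P * P * P * c * (cube a * W (suc a) i j - W 1 i j)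
          + P * P * P * c * (cube a * X a i j - X 0 i j) + P * P * P * c * (X 0 i j + P * W 1 i j) + - (P * P * P) * ((P - 1ℚ) * c * W 1 i j - P * U i j)
        ≡ cube (α ℕ.+ suc β) * c * Z α (suc β) i j - localFactor α (suc β) * U i j
      eq i j = begin
        _ ≡⟨ cong (λ r → r * c * (z - (w + x)) + P * P * P * c * (cube a * w - w₁) + P * P * P * c * (cube a * x - x₀) + P * P * P * c * (x₀ + P * w₁) + - (P * P * P) * ((P - 1ℚ) * c * w₁ - P * u))
               cube-suc ⟩
        cube a * (P * P * P) * c * (z - (w + x)) + P * P * P * c * (cube a * w - w₁) + P * P * P * c * (cube a * x - x₀) + P * P * P * c * (x₀ + P * w₁) + - (P * P * P) * ((P - 1ℚ) * c * w₁ - P * u)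
          ≡⟨ solve 8 (λ p r z w x w₁ x₀ u → let c = p :* p :* p :- con 1ℚ in
               r :* (p :* p :* p) :* c :* (z :- (w :+ x)) :+ p :* p :* p :* c :* (r :* w :- w₁) :+ p :* p :* p :* c :* (r :* x :- x₀)
                 :+ p :* p :* p :* c :* (x₀ :+ p :* w₁) :+ :- (p :* p :* p) :* ((p :- con 1ℚ) :* c :* w₁ :- p :* u)
               := r :* (p :* p :* p) :* c :* z :- :- (p :* p :* p :* p) :* u) refl P (cube a) z w x w₁ x₀ u ⟩
        cube a * (P * P * P) * c * z - - (P * P * P * P) * u
          ≡⟨ cong₂ (λ r l → r * c * z - l * u) (trans (sym cube-suc) (cong cube (sym (ℕP.+-suc α β)))) (sym (factor α)) ⟩
        cube (α ℕ.+ suc β) * c * z - localFactor α (suc β) * u ∎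
        where
        z = Z α (suc β) i j
        w = W (suc a) i j
        x = X a i j
        w₁ = W 1 i j
        x₀ = X 0 i j
        u = U i j
        cube-suc : cube (suc a) ≡ cube a * (P * P * P)
        cube-suc = trans (sym (*-identityʳ (cube (suc a)))) (trans (*-cube p a) (cong (cube a *_) (*-identityʳ (P * P * P))))
        factor : ∀ α → localFactor α (suc β) ≡ - (P * P * P * P)
        factor zero    = refl
        factor (suc _) = refl

  -- The sieve

  -- The indicator of the integers without prime factors up to K. Recursion on K adds one condition
  -- at a time, in step with the induction in `sieve`.
  rough : ℕ → ℕ → ℚ
  rough zero    i = 1ℚ
  rough (suc K) i = guardℚ (¬? (prime? (suc K) ×-dec suc K ∣? i)) (rough K i)

  rough-prime : ∀ {K} → Prime (suc K) → ∀ i → guardℚ (¬? (suc K ∣? i)) (rough K i) ≡ rough (suc K) i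
  rough-prime {K} pp i = guardℚ-cong {d = ¬? (suc K ∣? i)} {e = ¬? (prime? (suc K) ×-dec suc K ∣? i)}
    (_∘ proj₂) (λ h d → h (pp , d))

  rough-nonprime : ∀ {K} → ¬ Prime (suc K) → ∀ i → rough K i ≡ rough (suc K) i
  rough-nonprime {K} ¬pp i = sym (guardℚ-yes {d = ¬? (prime? (suc K) ×-dec suc K ∣? i)} (¬pp ∘ proj₁))

  rough-dilate : ∀ {p} → Prime p → ∀ {K} → K ℕ.< p → ∀ i → rough K (p ℕ.* i) ≡ rough K i
  rough-dilate     pp {zero}  K<p i = refl
  rough-dilate {p} pp {suc K} K<p i = trans
    (guardℚ-cong {d = ¬? (prime? (suc K) ×-dec suc K ∣? p ℕ.* i)} {e = ¬? (prime? (suc K) ×-dec suc K ∣? i)}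
      (λ h (pq , q∣i) → h (pq , ∣n⇒∣m*n p q∣i))
      (λ h (pq , q∣pi) → h (pq , [ (λ q∣p → contradiction (distinct-primes pp pq q∣p) (ℕP.<⇒≢ K<p))
                                 , (λ q∣i → q∣i) ]′ (euclidsLemma p i pq q∣pi))))
    (cong (guardℚ (¬? (prime? (suc K) ×-dec suc K ∣? i))) (rough-dilate pp (ℕP.<-trans (ℕP.n<1+n K) K<p) i))

  rough-1 : ∀ K → rough K 1 ≡ 1ℚ
  rough-1 zero    = refl
  rough-1 (suc K) = trans
    (guardℚ-yes {d = ¬? (prime? (suc K) ×-dec suc K ∣? 1)} λ (pq , q∣1) → ¬prime[1] (subst Prime (∣1⇒≡1 q∣1) pq))
    (rough-1 K)

  ∣rough∣≤1 : ∀ K i → ∣ rough K i ∣ ≤ 1ℚ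
  ∣rough∣≤1 zero    i = ≤-refl
  ∣rough∣≤1 (suc K) i = ∣guardℚ∣≤ (¬? (prime? (suc K) ×-dec suc K ∣? i)) (∣rough∣≤1 K i)

  rough-divisible : ∀ {q} → Prime q → ∀ {K} → q ℕ.≤ K → ∀ {i} → q ∣ i → rough K i ≡ 0ℚ
  rough-divisible {q} pq {zero}  q≤K _ = contradiction (ℕP.≤-trans (prime≥2 pq) q≤K) λ ()
  rough-divisible {q} pq {suc K} q≤K {i} q∣i with q ℕ.≟ suc K
  ... | yes refl = guardℚ-no {d = ¬? (prime? q ×-dec q ∣? i)} λ h → h (pq , q∣i)
  ... | no q≢    = trans (cong (guardℚ (¬? (prime? (suc K) ×-dec suc K ∣? i)))
                                (rough-divisible pq (ℕP.≤-pred (ℕP.≤∧≢⇒< q≤K q≢)) q∣i))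
                         (guard-zero (¬? (prime? (suc K) ×-dec suc K ∣? i)))

  rough-small : ∀ {K i} → 1 ℕ.< i → i ℕ.≤ K → rough K i ≡ 0ℚ
  rough-small {K} {i} 1<i i≤K with ∃-prime-divisor i 1<i
  ... | q , pq , q∣i = rough-divisible pq
    (ℕP.≤-trans (∣⇒≤ {{ℕ.>-nonZero (ℕP.<-trans ℕ.z<s 1<i)}} q∣i) i≤K) q∣i

  factorOut : ∀ {p} → Prime p → ∀ n → .{{NonZero n}} → ∃₂ λ α n′ → n ≡ p ℕ.^ α ℕ.* n′ × p ∤ n′
  factorOut {p} pp = <-rec _ step
    where
    step : ∀ n → (∀ {m} → m ℕ.< n → .{{NonZero m}} → ∃₂ λ α n′ → m ≡ p ℕ.^ α ℕ.* n′ × p ∤ n′) →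
      .{{NonZero n}} → ∃₂ λ α n′ → n ≡ p ℕ.^ α ℕ.* n′ × p ∤ n′
    step n rec with p ∣? n
    ... | no p∤n  = 0 , n , sym (ℕP.*-identityˡ n) , p∤n
    ... | yes p∣n with rec (quotient-< p∣n {{prime⇒nonTrivial pp}}) {{quotient≢0 p∣n}}
    ...   | α , n′ , eq , p∤n′ = suc α , n′
          , trans (m∣n⇒n≡m*quotient p∣n) (trans (cong (p ℕ.*_) eq) (sym (ℕP.*-assoc p (p ℕ.^ α) n′))) , p∤n′

  ^*∣ : ∀ {p} → Prime p → ∀ α {m i} → p ∤ m → p ℕ.^ α ∣ i → m ∣ i → p ℕ.^ α ℕ.* m ∣ i
  ^*∣ pp α {m} p∤m p^α∣i (divides-refl q) = *-monoˡ-∣ m (^∣-cancelʳ pp α q p∤m p^α∣i)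

  ∣-dilate : ∀ {p m} → Prime p → p ∤ m → ∀ {i} → m ∣ p ℕ.* i → m ∣ i
  ∣-dilate pp p∤m = coprime-divisor (Coprimality.sym (∤⇒coprime pp p∤m))

  term : ℕ → ℕ → ℕ → ℕ → ℕ → ℚ
  term m n K i j = guardℚ (m ∣? i) (guardℚ (m ℕ.* n ∣? i ℕ.* j) (rough K i * rough K j * summandℚ i j))

  -- The Euler factor as it appears in the theorem: a function of the two divisibilities instead of
  -- the exponents.
  numerator : ℚ → ∀ {A B : Set} → Dec A → Dec B → ℚ
  numerator P _       (yes _) = - (P * P * P * P)
  numerator P (yes _) (no _)  = P * P * P + P * P
  numerator P (no _)  (no _)  = P * P * P - P - 1ℚ

  cube∸1 : ℕ → ℕ
  cube∸1 p = p ℕ.^ 3 ℕ.∸ 1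

  euler : ℕ → ℕ → ℕ → ℚ
  euler m n p = inv (cube∸1 p) * numerator (ν p) (p ∣? m) (p ∣? n)

  eulerProduct : ℕ → ℕ → ℕ → ℚ
  eulerProduct m n = ∏ℚ (λ p → guard* (prime? p) (euler m n p))

  p³≥2 : ∀ {p} → Prime p → 2 ℕ.≤ p ℕ.^ 3
  p³≥2 {p} pp = ℕP.≤-trans (prime≥2 pp) (ℕP.m≤m*n p (p ℕ.^ 2) {{ℕP.m^n≢0 p 2 {{prime⇒nonZero pp}}}})

  cube∸1≢0 : ∀ {p} → Prime p → NonZero (cube∸1 p)
  cube∸1≢0 pp = ℕ.>-nonZero (ℕP.m<n⇒0<n∸m (p³≥2 pp))

  ν-cube : ∀ p → ν (p ℕ.^ 3) ≡ ν p * ν p * ν p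
  ν-cube p = begin
    ν (p ℕ.^ 3)        ≡⟨ cong ν (lemma p) ⟩
    ν (p ℕ.* p ℕ.* p)  ≡⟨ trans (ν-* (p ℕ.* p) p) (cong (_* ν p) (ν-* p p)) ⟩
    ν p * ν p * ν p    ∎
    where
    open ≡-Reasoning
    lemma : ∀ p → p ℕ.* (p ℕ.* (p ℕ.* 1)) ≡ p ℕ.* p ℕ.* p
    lemma = solve-∀

  ν-cube∸1 : ∀ {p} → Prime p → ν (cube∸1 p) ≡ ν p * ν p * ν p - 1ℚ
  ν-cube∸1 {p} pp = begin
    ν (cube∸1 p)                 ≡⟨ solve 1 (λ x → x := con 1ℚ :+ x :- con 1ℚ) refl (ν (cube∸1 p)) ⟩
    1ℚ + ν (cube∸1 p) - 1ℚ       ≡⟨ cong (_- 1ℚ) (sym (ν-suc (cube∸1 p))) ⟩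
    ν (suc (cube∸1 p)) - 1ℚ      ≡⟨ cong (λ x → ν x - 1ℚ) (ℕP.m+[n∸m]≡n {1} (ℕP.≤-trans (ℕP.n≤1+n 1) (p³≥2 pp))) ⟩
    ν (p ℕ.^ 3) - 1ℚ             ≡⟨ cong (_- 1ℚ) (ν-cube p) ⟩
    ν p * ν p * ν p - 1ℚ         ∎
    where open ≡-Reasoning

  -- With m and n prime to p = K + 1, this choice of `χ` turns Z into the K-rough series for p^α m
  -- and p^β n, and U into the (K+1)-rough series for m and n.
  module PeelPrime {K} (pp : Prime (suc K)) {m n} (p∤m : suc K ∤ m) (p∤n : suc K ∤ n) where

    private
      p = suc K

    p∤mn : p ∤ m ℕ.* n
    p∤mn h = [ p∤m , p∤n ]′ (euclidsLemma m n pp h)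

    χ : ℕ → ℕ → ℚ
    χ i j = guardℚ (m ∣? i) (guardℚ (m ℕ.* n ∣? i ℕ.* j) (rough K i * rough K j))

    ∣χ∣≤1 : ∀ i j → ∣ χ i j ∣ ≤ 1ℚ
    ∣χ∣≤1 i j = ∣guardℚ∣≤ (m ∣? i) (∣guardℚ∣≤ (m ℕ.* n ∣? i ℕ.* j) (begin
      ∣ rough K i * rough K j ∣       ≡⟨ ∣p*q∣≡∣p∣*∣q∣ (rough K i) (rough K j) ⟩
      ∣ rough K i ∣ * ∣ rough K j ∣   ≤⟨ *-mono-≤-nonNeg (0≤∣p∣ (rough K i)) (∣rough∣≤1 K i) (0≤∣p∣ (rough K j)) (∣rough∣≤1 K j) ⟩
      1ℚ * 1ℚ                         ≡⟨ *-identityˡ 1ℚ ⟩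
      1ℚ                              ∎))
      where open ≤-Reasoning

    χ-dilate₁ : ∀ i j → χ (p ℕ.* i) j ≡ χ i j
    χ-dilate₁ i j = trans
      (guardℚ-cong {d = m ∣? p ℕ.* i} {e = m ∣? i} (∣-dilate pp p∤m) (∣n⇒∣m*n p))
      (cong (guardℚ (m ∣? i)) (trans
        (guardℚ-cong {d = m ℕ.* n ∣? p ℕ.* i ℕ.* j} {e = m ℕ.* n ∣? i ℕ.* j}
          (λ h → ∣-dilate pp p∤mn (subst (m ℕ.* n ∣_) (ℕP.*-assoc p i j) h))
          (λ h → subst (m ℕ.* n ∣_) (sym (ℕP.*-assoc p i j)) (∣n⇒∣m*n p h)))
        (cong (λ x → guardℚ (m ℕ.* n ∣? i ℕ.* j) (x * rough K j)) (rough-dilate pp (ℕP.n<1+n K) i))))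

    χ-dilate₂ : ∀ i j → χ i (p ℕ.* j) ≡ χ i j
    χ-dilate₂ i j = cong (guardℚ (m ∣? i)) (trans
      (guardℚ-cong {d = m ℕ.* n ∣? i ℕ.* (p ℕ.* j)} {e = m ℕ.* n ∣? i ℕ.* j}
        (λ h → ∣-dilate pp p∤mn (subst (m ℕ.* n ∣_) (swap p i j) h))
        (λ h → subst (m ℕ.* n ∣_) (sym (swap p i j)) (∣n⇒∣m*n p h)))
      (cong (λ x → guardℚ (m ℕ.* n ∣? i ℕ.* j) (rough K i * x)) (rough-dilate pp (ℕP.n<1+n K) j)))
      where
      swap : ∀ p i j → i ℕ.* (p ℕ.* j) ≡ p ℕ.* (i ℕ.* j)
      swap = solve-∀

    open LocalFactor pp χ ∣χ∣≤1 χ-dilate₁ χ-dilate₂ public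

    guard-*ʳ : ∀ {A : Set} (d : Dec A) x y → guardℚ d x * y ≡ guardℚ d (x * y)
    guard-*ʳ (yes _) x y = refl
    guard-*ʳ (no _)  x y = *-zeroˡ y

    -- Divisibility by a power of p and by a number prime to p merges into divisibility by the
    -- product; the two moduli multiply to p^α m · p^β n.
    Z≡term : ∀ α β i j → Z α β i j ≡ term (p ℕ.^ α ℕ.* m) (p ℕ.^ β ℕ.* n) K i j
    Z≡term α β i j = trans
      (cong (λ x → guardℚ (p ℕ.^ α ∣? i) (guardℚ (p ℕ.^ (α ℕ.+ β) ∣? i ℕ.* j) x)) (trans
        (guard-*ʳ (m ∣? i) (guardℚ (m ℕ.* n ∣? i ℕ.* j) (rough K i * rough K j)) (summandℚ i j))
        (cong (guardℚ (m ∣? i)) (guard-*ʳ (m ℕ.* n ∣? i ℕ.* j) (rough K i * rough K j) (summandℚ i j)))))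
      (trans (swap (p ℕ.^ α ∣? i) (p ℕ.^ (α ℕ.+ β) ∣? i ℕ.* j) (m ∣? i) (m ℕ.* n ∣? i ℕ.* j))
        (trans (merge (p ℕ.^ α ∣? i) (m ∣? i) (p ℕ.^ α ℕ.* m ∣? i) (^*∣ pp α p∤m) (m*n∣⇒m∣ (p ℕ.^ α) m) (m*n∣⇒n∣ (p ℕ.^ α) m))
          (cong (guardℚ (p ℕ.^ α ℕ.* m ∣? i))
            (merge (p ℕ.^ (α ℕ.+ β) ∣? i ℕ.* j) (m ℕ.* n ∣? i ℕ.* j) (p ℕ.^ α ℕ.* m ℕ.* (p ℕ.^ β ℕ.* n) ∣? i ℕ.* j)
              (λ x y → subst (_∣ i ℕ.* j) product (^*∣ pp (α ℕ.+ β) p∤mn x y))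
              (λ x → m*n∣⇒m∣ (p ℕ.^ (α ℕ.+ β)) (m ℕ.* n) (subst (_∣ i ℕ.* j) (sym product) x))
              (λ x → m*n∣⇒n∣ (p ℕ.^ (α ℕ.+ β)) (m ℕ.* n) (subst (_∣ i ℕ.* j) (sym product) x))))))
      where
      product : p ℕ.^ (α ℕ.+ β) ℕ.* (m ℕ.* n) ≡ p ℕ.^ α ℕ.* m ℕ.* (p ℕ.^ β ℕ.* n)
      product = trans (cong (ℕ._* (m ℕ.* n)) (ℕP.^-distribˡ-+-* p α β)) (ℕP.[m*n]*[o*p]≡[m*o]*[n*p] (p ℕ.^ α) (p ℕ.^ β) m n)
      swap : ∀ {A B C D : Set} (a : Dec A) (b′ : Dec B) (c : Dec C) (d : Dec D) {x} →
        guardℚ a (guardℚ b′ (guardℚ c (guardℚ d x))) ≡ guardℚ a (guardℚ c (guardℚ b′ (guardℚ d x)))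
      swap a (yes _) (yes _) d = refl
      swap a (yes _) (no _)  d = refl
      swap a (no _)  (yes _) d = refl
      swap a (no _)  (no _)  d = refl
      merge : ∀ {A B C : Set} (a : Dec A) (e : Dec B) (c : Dec C) {x} → (A → B → C) → (C → A) → (C → B) →
        guardℚ a (guardℚ e x) ≡ guardℚ c x
      merge (yes a) (yes e) c f _ _ = sym (guardℚ-yes {d = c} (f a e))
      merge (yes _) (no ¬e) c _ _ h = sym (guardℚ-no {d = c} (¬e ∘ h))
      merge (no ¬a) _       c _ h _ = sym (guardℚ-no {d = c} (¬a ∘ h))

    U≡term : ∀ i j → U i j ≡ term m n p i j
    U≡term i j = go (m ∣? i) (m ℕ.* n ∣? i ℕ.* j)
      where
      go : ∀ {A B : Set} (a : Dec A) (e : Dec B) →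
        guardℚ (¬? (p ∣? i)) (guardℚ (¬? (p ∣? j)) (guardℚ a (guardℚ e (rough K i * rough K j)) * summandℚ i j))
        ≡ guardℚ a (guardℚ e (rough p i * rough p j * summandℚ i j))
      guards-zero : guardℚ (¬? (p ∣? i)) (guardℚ (¬? (p ∣? j)) (0ℚ * summandℚ i j)) ≡ 0ℚ
      guards-zero = trans (cong (guardℚ (¬? (p ∣? i))) (trans (cong (guardℚ (¬? (p ∣? j))) (*-zeroˡ (summandℚ i j)))
        (guard-zero (¬? (p ∣? j))))) (guard-zero (¬? (p ∣? i)))
      nest : ∀ {A B : Set} (a : Dec A) (e : Dec B) x y z → guardℚ a (guardℚ e (x * y * z)) ≡ guardℚ a x * guardℚ e y * z
      nest (yes _) (yes _) x y z = refl
      nest (yes _) (no _)  x y z = solve 2 (λ x z → con 0ℚ := x :* con 0ℚ :* z) refl x z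
      nest (no _)  e       x y z = solve 2 (λ y z → con 0ℚ := con 0ℚ :* y :* z) refl (guardℚ e y) z
      go (yes _) (yes _) = trans (nest (¬? (p ∣? i)) (¬? (p ∣? j)) (rough K i) (rough K j) (summandℚ i j))
        (cong₂ (λ x y → x * y * summandℚ i j) (rough-prime pp i) (rough-prime pp j))
      go (yes _) (no _)  = guards-zero
      go (no _)  _       = guards-zero

    null-peel : ∀ α β → Null (λ i j → cube (α ℕ.+ β) * (P * P * P - 1ℚ) * term (p ℕ.^ α ℕ.* m) (p ℕ.^ β ℕ.* n) K i j
                                       - localFactor α β * term m n p i j)
    null-peel α β = null-cong (λ i j → cong₂ (λ z u → cube (α ℕ.+ β) * (P * P * P - 1ℚ) * z - localFactor α β * u)
      (Z≡term α β i j) (U≡term i j)) (null-local α β)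

  -- The invariant of the sieve: s and t are the parts of m and n made of primes up to K, and c is
  -- the constant accumulated so far. The `keeps` fields are there because the next Euler factor
  -- asks whether p divides m and n, whereas its exponents are taken from m′ and n′. In `c≡` the
  -- cube (s t)³ is multiplied out to avoid a division.
  record Sieved (m n K : ℕ) : Set where
    field
      m′ n′ s t : ℕ
      m≡        : m ≡ s ℕ.* m′
      n≡        : n ≡ t ℕ.* n′
      m′-rough  : ∀ {q} → Prime q → q ℕ.≤ K → q ∤ m′
      n′-rough  : ∀ {q} → Prime q → q ℕ.≤ K → q ∤ n′
      m′-keeps  : ∀ {q} → Prime q → K ℕ.< q → q ∣ m → q ∣ m′
      n′-keeps  : ∀ {q} → Prime q → K ℕ.< q → q ∣ n → q ∣ n′
      c         : ℚ
      c≡        : ν (s ℕ.* t) * ν (s ℕ.* t) * ν (s ℕ.* t) * c ≡ eulerProduct m n K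
      null      : Null (λ i j → term m n 0 i j - c * term m′ n′ K i j)

  keeps-step : ∀ {p} → Prime p → ∀ α {m m′ q} → Prime q → p ℕ.< q → m ≡ p ℕ.^ α ℕ.* m′ → q ∣ m → q ∣ m′
  keeps-step pp α {m′ = m′} pq p<q refl q∣ = coprime-divisor
    (Coprimality.sym (coprime-^ (∤⇒coprime pp λ p∣q → ℕP.<⇒≢ p<q (distinct-primes pq pp p∣q)) α)) q∣

  rough-step : ∀ {K m} → suc K ∤ m → (∀ {q} → Prime q → q ℕ.≤ K → q ∤ m) → ∀ {q} → Prime q → q ℕ.≤ suc K → q ∤ m
  rough-step {K} p∤m h {q} pq q≤ with q ℕ.≟ suc K
  ... | yes refl = p∤m
  ... | no q≢    = h pq (ℕP.≤-pred (ℕP.≤∧≢⇒< q≤ q≢))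

  -- `localFactor` depends only on which exponents vanish, that is, on whether p divides p^α m and
  -- p^β n. The inconsistent combinations are refuted by p ∤ m and p ∤ n.
  localFactor≡numerator : ∀ {K} (pp : Prime (suc K)) {m n} (p∤m : suc K ∤ m) (p∤n : suc K ∤ n) α β
    {A B : Set} (d : Dec A) (e : Dec B) →
    (A → suc K ∣ suc K ℕ.^ α ℕ.* m) → (suc K ∣ suc K ℕ.^ α ℕ.* m → A) →
    (B → suc K ∣ suc K ℕ.^ β ℕ.* n) → (suc K ∣ suc K ℕ.^ β ℕ.* n → B) →
    PeelPrime.localFactor pp p∤m p∤n α β ≡ numerator (ν (suc K)) d e
  localFactor≡numerator {K} pp {m} {n} p∤m p∤n = go
    where
    p∣1*⇒ : ∀ {x} → suc K ∣ suc K ℕ.^ 0 ℕ.* x → suc K ∣ x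
    p∣1*⇒ {x} = subst (suc K ∣_) (ℕP.*-identityˡ x)
    p∣^suc* : ∀ a x → suc K ∣ suc K ℕ.^ suc a ℕ.* x
    p∣^suc* a x = ∣m⇒∣m*n x (m∣m*n (suc K ℕ.^ a))
    go : ∀ α β {A B : Set} (d : Dec A) (e : Dec B) →
      (A → suc K ∣ suc K ℕ.^ α ℕ.* m) → (suc K ∣ suc K ℕ.^ α ℕ.* m → A) →
      (B → suc K ∣ suc K ℕ.^ β ℕ.* n) → (suc K ∣ suc K ℕ.^ β ℕ.* n → B) →
      PeelPrime.localFactor pp p∤m p∤n α β ≡ numerator (ν (suc K)) d e
    go zero    zero    (yes a) _       f _ _ _ = contradiction (p∣1*⇒ (f a)) p∤m
    go zero    zero    (no _)  (yes e) _ _ h _ = contradiction (p∣1*⇒ (h e)) p∤n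
    go zero    zero    (no _)  (no _)  _ _ _ _ = refl
    go (suc α) zero    _       (yes e) _ _ h _ = contradiction (p∣1*⇒ (h e)) p∤n
    go (suc α) zero    (yes _) (no _)  _ _ _ _ = refl
    go (suc α) zero    (no ¬a) (no _)  _ f _ _ = contradiction (f (p∣^suc* α m)) ¬a
    go zero    (suc β) _       (yes _) _ _ _ _ = refl
    go (suc α) (suc β) _       (yes _) _ _ _ _ = refl
    go α       (suc β) _       (no ¬e) _ _ _ h = contradiction (h (p∣^suc* β n)) ¬e

  sieve : ∀ m n → .{{NonZero m}} → .{{NonZero n}} → ∀ K → Sieved m n K
  sieve m n zero = record
    { m′ = m ; n′ = n ; s = 1 ; t = 1
    ; m≡ = sym (ℕP.*-identityˡ m) ; n≡ = sym (ℕP.*-identityˡ n)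
    ; m′-rough = λ pq q≤0 → contradiction (ℕP.≤-trans (prime≥2 pq) q≤0) λ ()
    ; n′-rough = λ pq q≤0 → contradiction (ℕP.≤-trans (prime≥2 pq) q≤0) λ ()
    ; m′-keeps = λ _ _ h → h ; n′-keeps = λ _ _ h → h
    ; c = 1ℚ ; c≡ = cong (λ x → x * x * x * 1ℚ) ν-1
    ; null = null-zero λ i j → trans (cong (λ x → term m n 0 i j - x) (*-identityˡ (term m n 0 i j))) (+-inverseʳ (term m n 0 i j))
    }
  sieve m n (suc K) = step (sieve m n K) (prime? (suc K))
    where
    instance
      m≢0 : NonZero m
      m≢0 = ℕ.≢-nonZero (ℕ.≢-nonZero⁻¹ m)
      n≢0 : NonZero n
      n≢0 = ℕ.≢-nonZero (ℕ.≢-nonZero⁻¹ n)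
    step : Sieved m n K → Dec (Prime (suc K)) → Sieved m n (suc K)
    step S (no ¬pp) = record
      { m′ = m′ ; n′ = n′ ; s = s ; t = t ; m≡ = m≡ ; n≡ = n≡
      ; m′-rough = weaken m′-rough ; n′-rough = weaken n′-rough
      ; m′-keeps = λ pq K<q → m′-keeps pq (ℕP.<-trans (ℕP.n<1+n K) K<q)
      ; n′-keeps = λ pq K<q → n′-keeps pq (ℕP.<-trans (ℕP.n<1+n K) K<q)
      ; c = c
      ; c≡ = trans c≡ (trans (sym (*-identityʳ (eulerProduct m n K)))
               (cong (eulerProduct m n K *_) (sym (guard*-no {d = prime? (suc K)} ¬pp))))
      ; null = null-cong (λ i j → cong (λ x → term m n 0 i j - c * x)
          (cong (λ x → guardℚ (m′ ∣? i) (guardℚ (m′ ℕ.* n′ ∣? i ℕ.* j) (x * summandℚ i j)))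
            (cong₂ _*_ (rough-nonprime ¬pp i) (rough-nonprime ¬pp j)))) null
      }
      where
      open Sieved S
      weaken : ∀ {x} → (∀ {q} → Prime q → q ℕ.≤ K → q ∤ x) → ∀ {q} → Prime q → q ℕ.≤ suc K → q ∤ x
      weaken h {q} pq q≤ with q ℕ.≟ suc K
      ... | yes refl = contradiction pq ¬pp
      ... | no q≢    = h pq (ℕP.≤-pred (ℕP.≤∧≢⇒< q≤ q≢))
    step S (yes pp) = peel (factorOut pp m′ {{m′≢0}}) (factorOut pp n′ {{n′≢0}})
      where
      open Sieved S
      p = suc K
      m′≢0 : NonZero m′
      m′≢0 = ℕP.m*n≢0⇒n≢0 s {{subst NonZero m≡ m≢0}}
      n′≢0 : NonZero n′
      n′≢0 = ℕP.m*n≢0⇒n≢0 t {{subst NonZero n≡ n≢0}}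
      peel : (∃₂ λ α m″ → m′ ≡ p ℕ.^ α ℕ.* m″ × p ∤ m″) → (∃₂ λ β n″ → n′ ≡ p ℕ.^ β ℕ.* n″ × p ∤ n″) → Sieved m n (suc K)
      peel (α , m″ , m′≡ , p∤m″) (β , n″ , n′≡ , p∤n″) = record
        { m′ = m″ ; n′ = n″ ; s = s ℕ.* p ℕ.^ α ; t = t ℕ.* p ℕ.^ β
        ; m≡ = trans m≡ (trans (cong (s ℕ.*_) m′≡) (sym (ℕP.*-assoc s (p ℕ.^ α) m″)))
        ; n≡ = trans n≡ (trans (cong (t ℕ.*_) n′≡) (sym (ℕP.*-assoc t (p ℕ.^ β) n″)))
        ; m′-rough = rough-step p∤m″ (λ pq q≤ q∣ → m′-rough pq q≤ (subst (_ ∣_) (sym m′≡) (∣n⇒∣m*n (p ℕ.^ α) q∣)))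
        ; n′-rough = rough-step p∤n″ (λ pq q≤ q∣ → n′-rough pq q≤ (subst (_ ∣_) (sym n′≡) (∣n⇒∣m*n (p ℕ.^ β) q∣)))
        ; m′-keeps = λ pq p<q q∣m → keeps-step pp α pq p<q m′≡ (m′-keeps pq (ℕP.<-trans (ℕP.n<1+n K) p<q) q∣m)
        ; n′-keeps = λ pq p<q q∣n → keeps-step pp β pq p<q n′≡ (n′-keeps pq (ℕP.<-trans (ℕP.n<1+n K) p<q) q∣n)
        ; c = c * d * λ′
        ; c≡ = c″≡
        ; null = null-cong rearrange (null-+ null (null-*ˡ (c * d) (null-peel α β)))
        }
        where
        open PeelPrime pp p∤m″ p∤n″ using (P; cube; localFactor; null-peel)
        open ≡-Reasoning
        q = p ℕ.^ (α ℕ.+ β)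
        D = inv (cube∸1 p)
        -- The reciprocal of p^(3(α+β)) (p³ - 1), the coefficient of Z in the local relation.
        d = D * (inv q * inv q * inv q)
        λ′ = localFactor α β
        instance
          q≢0 : NonZero q
          q≢0 = ℕP.m^n≢0 p (α ℕ.+ β)
        cube-inverse : cube (α ℕ.+ β) * (inv q * inv q * inv q) ≡ 1ℚ
        cube-inverse = begin
          ν q * ν q * ν q * (inv q * inv q * inv q)
            ≡⟨ solve 2 (λ x y → x :* x :* x :* (y :* y :* y) := (x :* y) :* (x :* y) :* (x :* y)) refl (ν q) (inv q) ⟩
          (ν q * inv q) * (ν q * inv q) * (ν q * inv q)  ≡⟨ cong (λ x → x * x * x) (ν*inv q) ⟩
          1ℚ * 1ℚ * 1ℚ                                   ≡⟨⟩
          1ℚ                                             ∎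
        d-inverse : d * (cube (α ℕ.+ β) * (P * P * P - 1ℚ)) ≡ 1ℚ
        d-inverse = begin
          d * (cube (α ℕ.+ β) * (P * P * P - 1ℚ))
            ≡⟨ solve 4 (λ D i r x → D :* i :* (r :* x) := (r :* i) :* (x :* D)) refl D (inv q * inv q * inv q) (cube (α ℕ.+ β)) (P * P * P - 1ℚ) ⟩
          cube (α ℕ.+ β) * (inv q * inv q * inv q) * ((P * P * P - 1ℚ) * D)
            ≡⟨ cong₂ (λ x y → x * (y * D)) cube-inverse (sym (ν-cube∸1 pp)) ⟩
          1ℚ * (ν (cube∸1 p) * D)  ≡⟨ trans (*-identityˡ _) (ν*inv (cube∸1 p) {{cube∸1≢0 pp}}) ⟩
          1ℚ ∎
        rearrange : ∀ i j → .{{NonZero i}} → .{{NonZero j}} →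
          term m n 0 i j - c * term m′ n′ K i j + c * d * (cube (α ℕ.+ β) * (P * P * P - 1ℚ) * term (p ℕ.^ α ℕ.* m″) (p ℕ.^ β ℕ.* n″) K i j
            - λ′ * term m″ n″ p i j)
          ≡ term m n 0 i j - c * d * λ′ * term m″ n″ p i j
        rearrange i j = begin
          x - c * term m′ n′ K i j + c * d * (r * y - λ′ * z)
            ≡⟨ cong₂ (λ u v → x - c * term u v K i j + c * d * (r * y - λ′ * z)) m′≡ n′≡ ⟩
          x - c * y + c * d * (r * y - λ′ * z)
            ≡⟨ solve 7 (λ x c y d r l z → x :- c :* y :+ c :* d :* (r :* y :- l :* z) := x :- c :* y :+ c :* (d :* r) :* y :- c :* d :* l :* z)
                 refl x c y d r λ′ z ⟩
          x - c * y + c * (d * r) * y - c * d * λ′ * z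
            ≡⟨ cong (λ u → x - c * y + c * u * y - c * d * λ′ * z) d-inverse ⟩
          x - c * y + c * 1ℚ * y - c * d * λ′ * z
            ≡⟨ solve 4 (λ x c y w → x :- c :* y :+ c :* con 1ℚ :* y :- w := x :- w) refl x c y (c * d * λ′ * z) ⟩
          x - c * d * λ′ * z ∎
          where
          x = term m n 0 i j
          y = term (p ℕ.^ α ℕ.* m″) (p ℕ.^ β ℕ.* n″) K i j
          z = term m″ n″ p i j
          r = cube (α ℕ.+ β) * (P * P * P - 1ℚ)
        λ′≡ : λ′ ≡ numerator (ν p) (p ∣? m) (p ∣? n)
        λ′≡ = localFactor≡numerator pp p∤m″ p∤n″ α β (p ∣? m) (p ∣? n)
          (λ h → subst (p ∣_) m′≡ (m′-keeps pp (ℕP.n<1+n K) h)) (λ h → subst (p ∣_) (sym m≡) (∣n⇒∣m*n s (subst (p ∣_) (sym m′≡) h)))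
          (λ h → subst (p ∣_) n′≡ (n′-keeps pp (ℕP.n<1+n K) h)) (λ h → subst (p ∣_) (sym n≡) (∣n⇒∣m*n t (subst (p ∣_) (sym n′≡) h)))
        ν-st : ν (s ℕ.* p ℕ.^ α ℕ.* (t ℕ.* p ℕ.^ β)) ≡ ν (s ℕ.* t) * ν q
        ν-st = trans (cong ν (trans (ℕP.[m*n]*[o*p]≡[m*o]*[n*p] s (p ℕ.^ α) t (p ℕ.^ β)) (cong (s ℕ.* t ℕ.*_) (sym (ℕP.^-distribˡ-+-* p α β)))))
          (ν-* (s ℕ.* t) q)
        c″≡ : ν (s ℕ.* p ℕ.^ α ℕ.* (t ℕ.* p ℕ.^ β)) * ν (s ℕ.* p ℕ.^ α ℕ.* (t ℕ.* p ℕ.^ β)) * ν (s ℕ.* p ℕ.^ α ℕ.* (t ℕ.* p ℕ.^ β)) * (c * d * λ′)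
          ≡ eulerProduct m n (suc K)
        c″≡ = begin
          _ ≡⟨ cong (λ x → x * x * x * (c * d * λ′)) ν-st ⟩
          (σ * ν q) * (σ * ν q) * (σ * ν q) * (c * d * λ′)
            ≡⟨ solve 6 (λ σ q c D i l → (σ :* q) :* (σ :* q) :* (σ :* q) :* (c :* (D :* (i :* i :* i)) :* l)
                          := σ :* σ :* σ :* c :* (q :* q :* q :* (i :* i :* i)) :* (D :* l)) refl σ (ν q) c D (inv q) λ′ ⟩
          σ * σ * σ * c * (cube (α ℕ.+ β) * (inv q * inv q * inv q)) * (D * λ′)
            ≡⟨ cong₂ (λ x y → x * y * (D * λ′)) c≡ cube-inverse ⟩
          eulerProduct m n K * 1ℚ * (D * λ′)
            ≡⟨ cong₂ (λ x y → x * (D * y)) (*-identityʳ (eulerProduct m n K)) λ′≡ ⟩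
          eulerProduct m n K * euler m n p
            ≡⟨ cong (eulerProduct m n K *_) (sym (guard*-yes {d = prime? p} pp)) ⟩
          eulerProduct m n (suc K) ∎
          where σ = ν (s ℕ.* t)

  -- Convergence

  rough≡1 : ∀ {K n} → .{{NonZero n}} → n ℕ.≤ K → (∀ {q} → Prime q → q ℕ.≤ K → q ∤ n) → n ≡ 1
  rough≡1 {n = suc zero}      _   _ = refl
  rough≡1 {n = n@(suc (suc _))} n≤K h with ∃-prime-divisor n (s≤s (s≤s z≤n))
  ... | q , pq , q∣n = contradiction q∣n (h pq (ℕP.≤-trans (∣⇒≤ q∣n) n≤K))

  roughTerm : ℕ → ℕ → ℕ → ℚ
  roughTerm K i j = rough K i * rough K j * summandℚ i j

  admissible : ℕ → ℕ → ℕ → ℕ → ℚ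
  admissible m n i j = guardℚ (m ∣? i) (guardℚ (m ℕ.* n ∣? i ℕ.* j) (summandℚ i j))

  eulerValue : ℕ → ℕ → ℕ → ℚ
  eulerValue m n K = inv (m ℕ.^ 3 ℕ.* n ℕ.^ 3) * eulerProduct m n K

  -- Once K ≥ m and K ≥ n, the remaining parts m′ and n′ are at most K and have no prime factor up
  -- to K, so both are 1. Then s = m and t = n, which produces the factor 1/(m³n³).
  null-euler : ∀ m n → .{{NonZero m}} → .{{NonZero n}} → ∀ {K} → m ℕ.≤ K → n ℕ.≤ K →
    Null (λ i j → admissible m n i j - eulerValue m n K * roughTerm K i j)
  null-euler m n {K} m≤K n≤K = null-cong eq null
    where
    open Sieved (sieve m n K)
    open ≡-Reasoning
    instance
      m≢0 : NonZero m
      m≢0 = ℕ.≢-nonZero (ℕ.≢-nonZero⁻¹ m)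
      n≢0 : NonZero n
      n≢0 = ℕ.≢-nonZero (ℕ.≢-nonZero⁻¹ n)
      m′≢0 : NonZero m′
      m′≢0 = ℕP.m*n≢0⇒n≢0 s {{subst NonZero m≡ m≢0}}
      n′≢0 : NonZero n′
      n′≢0 = ℕP.m*n≢0⇒n≢0 t {{subst NonZero n≡ n≢0}}
    m′≡1 : m′ ≡ 1
    m′≡1 = rough≡1 (ℕP.≤-trans (∣⇒≤ (subst (m′ ∣_) (sym m≡) (n∣m*n s))) m≤K) m′-rough
    n′≡1 : n′ ≡ 1
    n′≡1 = rough≡1 (ℕP.≤-trans (∣⇒≤ (subst (n′ ∣_) (sym n≡) (n∣m*n t))) n≤K) n′-rough
    s≡m : s ≡ m
    s≡m = sym (trans m≡ (trans (cong (s ℕ.*_) m′≡1) (ℕP.*-identityʳ s)))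
    t≡n : t ≡ n
    t≡n = sym (trans n≡ (trans (cong (t ℕ.*_) n′≡1) (ℕP.*-identityʳ t)))
    cubes : ∀ m n → m ℕ.* n ℕ.* (m ℕ.* n) ℕ.* (m ℕ.* n) ≡ m ℕ.* (m ℕ.* (m ℕ.* 1)) ℕ.* (n ℕ.* (n ℕ.* (n ℕ.* 1)))
    cubes = solve-∀
    N = m ℕ.^ 3 ℕ.* n ℕ.^ 3
    instance
      N≢0 : NonZero N
      N≢0 = ℕP.m*n≢0 (m ℕ.^ 3) (n ℕ.^ 3) {{ℕP.m^n≢0 m 3}} {{ℕP.m^n≢0 n 3}}
    νN : ν (m ℕ.* n) * ν (m ℕ.* n) * ν (m ℕ.* n) ≡ ν N
    νN = sym (trans (cong ν (sym (cubes m n))) (trans (ν-* (m ℕ.* n ℕ.* (m ℕ.* n)) (m ℕ.* n)) (cong (_* ν (m ℕ.* n)) (ν-* (m ℕ.* n) (m ℕ.* n)))))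
    c≡value : c ≡ eulerValue m n K
    c≡value = ν-cancel N (begin
      ν N * c                                            ≡⟨ cong (_* c) (sym νN) ⟩
      ν (m ℕ.* n) * ν (m ℕ.* n) * ν (m ℕ.* n) * c        ≡⟨ cong₂ (λ s t → ν (s ℕ.* t) * ν (s ℕ.* t) * ν (s ℕ.* t) * c) (sym s≡m) (sym t≡n) ⟩
      ν (s ℕ.* t) * ν (s ℕ.* t) * ν (s ℕ.* t) * c        ≡⟨ c≡ ⟩
      eulerProduct m n K                                 ≡⟨ sym (*-identityˡ _) ⟩
      1ℚ * eulerProduct m n K                            ≡⟨ cong (_* eulerProduct m n K) (sym (ν*inv N)) ⟩
      ν N * inv N * eulerProduct m n K                   ≡⟨ *-assoc (ν N) (inv N) (eulerProduct m n K) ⟩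
      ν N * eulerValue m n K                             ∎)
    eq : ∀ i j → .{{NonZero i}} → .{{NonZero j}} →
      term m n 0 i j - c * term m′ n′ K i j ≡ admissible m n i j - eulerValue m n K * roughTerm K i j
    eq i j = cong₂ _-_
      (cong (λ x → guardℚ (m ∣? i) (guardℚ (m ℕ.* n ∣? i ℕ.* j) x)) (trans (cong (_* summandℚ i j) (*-identityˡ 1ℚ)) (*-identityˡ (summandℚ i j))))
      (cong₂ _*_ c≡value (trans (cong₂ (λ m n → term m n K i j) m′≡1 n′≡1)
        (trans (guardℚ-yes {d = 1 ∣? i} (1∣ i)) (guardℚ-yes {d = 1 ℕ.* 1 ∣? i ℕ.* j} (1∣ (i ℕ.* j))))))

  roughTerm-dominated : ∀ K → Dominated (roughTerm K)
  roughTerm-dominated K i j = begin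
    ∣ rough K i * rough K j * summandℚ i j ∣          ≡⟨ ∣p*q∣≡∣p∣*∣q∣ (rough K i * rough K j) (summandℚ i j) ⟩
    ∣ rough K i * rough K j ∣ * ∣ summandℚ i j ∣      ≤⟨ *-mono-≤-nonNeg (0≤∣p∣ (rough K i * rough K j)) rr≤1 (0≤∣p∣ (summandℚ i j)) (summandℚ-dominated i j) ⟩
    1ℚ * (decay i * decay j)                           ≡⟨ *-identityˡ (decay i * decay j) ⟩
    decay i * decay j                                  ∎
    where
    open ≤-Reasoning
    rr≤1 : ∣ rough K i * rough K j ∣ ≤ 1ℚ
    rr≤1 = begin
      ∣ rough K i * rough K j ∣       ≡⟨ ∣p*q∣≡∣p∣*∣q∣ (rough K i) (rough K j) ⟩
      ∣ rough K i ∣ * ∣ rough K j ∣   ≤⟨ *-mono-≤-nonNeg (0≤∣p∣ (rough K i)) (∣rough∣≤1 K i) (0≤∣p∣ (rough K j)) (∣rough∣≤1 K j) ⟩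
      1ℚ * 1ℚ                         ≡⟨ *-identityˡ 1ℚ ⟩
      1ℚ                              ∎

  summandℚ-1-1 : summandℚ 1 1 ≡ 1ℚ
  summandℚ-1-1 = trans (cong (_* inv 1) ν-1) (trans (*-identityˡ (inv 1)) (trans (sym (*-identityˡ (inv 1))) (trans (cong (_* inv 1) (sym ν-1)) (ν*inv 1))))

  ∑ℚ-first : ∀ f K → .{{NonZero K}} → (∀ k → 1 ℕ.< k → k ℕ.≤ K → f k ≡ 0ℚ) → ∑ℚ f K ≡ f 1
  ∑ℚ-first f (suc K) h = begin
    ∑ℚ f (1 ℕ.+ K)                          ≡⟨ ∑ℚ-split f 1 K ⟩
    0ℚ + f 1 + ∑ℚ (λ k → f (1 ℕ.+ k)) K     ≡⟨ cong₂ _+_ (+-identityˡ (f 1)) (∑ℚ-zero K λ k k≤K → h (suc k) (s≤s (ℕ.>-nonZero⁻¹ k)) (s≤s k≤K)) ⟩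
    f 1 + 0ℚ                                ≡⟨ +-identityʳ (f 1) ⟩
    f 1                                     ∎
    where open ≡-Reasoning

  roughTerm-i : ∀ {K i} j → 1 ℕ.< i → i ℕ.≤ K → roughTerm K i j ≡ 0ℚ
  roughTerm-i {K} {i} j 1<i i≤K = trans (cong (λ x → x * rough K j * summandℚ i j) (rough-small 1<i i≤K))
    (solve 2 (λ x y → con 0ℚ :* x :* y := con 0ℚ) refl (rough K j) (summandℚ i j))

  roughTerm-j : ∀ {K j} i → 1 ℕ.< j → j ℕ.≤ K → roughTerm K i j ≡ 0ℚ
  roughTerm-j {K} {j} i 1<j j≤K = trans (cong (λ x → rough K i * x * summandℚ i j) (rough-small 1<j j≤K))
    (solve 2 (λ x y → x :* con 0ℚ :* y := con 0ℚ) refl (rough K i) (summandℚ i j))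

  -- Apart from (1 , 1), every pair contributing to the K-rough sum has a coordinate larger than K.
  rough-box-bound : ∀ {K t} .{{_ : NonZero K}} → (∀ N → mass * ∑ℚ (λ k → decay (K ℕ.+ k)) N ≤ t) →
    ∀ {I J} → K ℕ.≤ I → K ℕ.≤ J → ∣ boxSum (roughTerm K) I J - 1ℚ ∣ ≤ t + t
  rough-box-bound {K} {t} tail {I} {J} K≤I K≤J = begin
    ∣ B I J - 1ℚ ∣                               ≡⟨ cong ∣_∣ (solve 3 (λ x y o → x :- o := (x :- y) :+ (y :- o)) refl (B I J) (B K J) 1ℚ) ⟩
    ∣ (B I J - B K J) + (B K J - 1ℚ) ∣           ≤⟨ ∣p+q∣≤∣p∣+∣q∣ (B I J - B K J) (B K J - 1ℚ) ⟩
    ∣ B I J - B K J ∣ + ∣ B K J - 1ℚ ∣           ≤⟨ +-mono-≤ (≤-trans (rows-bound dom K≤I J) (tail (I ℕ.∸ K))) column ⟩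
    t + t                                        ∎
    where
    open ≤-Reasoning
    B = boxSum (roughTerm K)
    dom = roughTerm-dominated K
    instance
      K≢0 : NonZero K
      K≢0 = ℕ.≢-nonZero (ℕ.≢-nonZero⁻¹ K)
    collapse : ∀ J → B K J ≡ B 1 J
    collapse J = trans (∑ℚ-first (λ i → ∑ℚ (roughTerm K i) J) K λ i 1<i i≤K → ∑ℚ-zero J λ j _ → roughTerm-i j 1<i i≤K)
      (sym (+-identityˡ (∑ℚ (roughTerm K 1) J)))
    B1K : B 1 K ≡ 1ℚ
    B1K = trans (+-identityˡ (∑ℚ (roughTerm K 1) K)) (trans
      (∑ℚ-first (roughTerm K 1) K λ j 1<j j≤K → roughTerm-j 1 1<j j≤K)
      (trans (cong₂ (λ x y → x * y * summandℚ 1 1) (rough-1 K) (rough-1 K)) (cong (1ℚ * 1ℚ *_) summandℚ-1-1)))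
    column : ∣ B K J - 1ℚ ∣ ≤ t
    column = begin
      ∣ B K J - 1ℚ ∣      ≡⟨ cong₂ (λ x y → ∣ x - y ∣) (collapse J) (sym B1K) ⟩
      ∣ B 1 J - B 1 K ∣   ≤⟨ ≤-trans (columns-bound dom K≤J 1) (tail (J ℕ.∸ K)) ⟩
      t                   ∎

  rough-box-limit : ∀ ε .{{_ : Positive ε}} → ∃ λ M → ∀ {K} → M ℕ.≤ K → ∀ {I J} → K ℕ.≤ I → K ℕ.≤ J →
    ∣ boxSum (roughTerm K) I J - 1ℚ ∣ ≤ ε
  rough-box-limit ε =
    let M , tail = ∑decay-tail-scaled ε
    in suc M , λ {K} M<K {I} {J} K≤I K≤J → subst (∣ boxSum (roughTerm K) I J - 1ℚ ∣ ≤_) (halves ε)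
         (rough-box-bound {K} {½ * ε} {{ℕ.>-nonZero (ℕP.≤-trans (s≤s z≤n) M<K)}}
           (tail (ℕP.≤-trans (ℕP.n≤1+n M) M<K)) K≤I K≤J)

  -- With R the K-rough box sum and x the K-th approximation of L, the three errors in f - xR, x(R -
  -- 1) and x - L receive ε/4, ε/4 and ε/2. K is fixed before the box, since the size beyond which
  -- the null series is small depends on K; the estimate for R - 1 holds for all larger boxes.
  boxSum-limit : ∀ f (L : ℝ) K₀ → (∀ {K} → K₀ ℕ.≤ K → Null (λ i j → f i j - seq L K * roughTerm K i j)) →
    ∀ ε .{{_ : Positive ε}} → ∃ λ M → ∀ {I J l} → M ℕ.≤ I → M ℕ.≤ J → M ℕ.≤ l → ∣ boxSum f I J - seq L l ∣ ≤ ε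
  boxSum-limit f L K₀ N ε =
    let ε₁ = ½ * ε
        ε₁>0 = half-pos ε
        ε₂ = ½ * ε₁
        ε₂>0 = half-pos ε₁ {{ε₁>0}}
        A , A>0 , K₁ , L≤A = bounded L
        e , e>0 , Ae≡ = shrink ε₁ {{ε₁>0}} A {{A>0}}
        K₂ , rough≈1 = rough-box-limit e {{e>0}}
        K₃ , close = cauchy L ε₁ {{ε₁>0}}
        K = (K₀ ℕ.⊔ K₁) ℕ.⊔ (K₂ ℕ.⊔ K₃)
        K₀₁ = ℕP.m≤m⊔n (K₀ ℕ.⊔ K₁) (K₂ ℕ.⊔ K₃)
        K₂₃ = ℕP.m≤n⊔m (K₀ ℕ.⊔ K₁) (K₂ ℕ.⊔ K₃)
        K₀≤K = ℕP.≤-trans (ℕP.m≤m⊔n K₀ K₁) K₀₁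
        K₁≤K = ℕP.≤-trans (ℕP.m≤n⊔m K₀ K₁) K₀₁
        K₂≤K = ℕP.≤-trans (ℕP.m≤m⊔n K₂ K₃) K₂₃
        K₃≤K = ℕP.≤-trans (ℕP.m≤n⊔m K₂ K₃) K₂₃
        M , small = N K₀≤K ε₂ {{ε₂>0}}
    in K ℕ.⊔ M , λ {I} {J} {l} I≥ J≥ l≥ →
         estimate K I J l A e
           (small (⊔ʳ {K} {M} I≥) (⊔ʳ {K} {M} J≥))
           (L≤A K K₁≤K)
           (rough≈1 K₂≤K (⊔ˡ {K} {M} I≥) (⊔ˡ {K} {M} J≥))
           Ae≡
           (close K l K₃≤K (ℕP.≤-trans K₃≤K (⊔ˡ {K} {M} l≥)))
    where
    open ≤-Reasoning
    estimate : ∀ K I J l A e →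
      ∣ boxSum (λ i j → f i j - seq L K * roughTerm K i j) I J ∣ ≤ ½ * (½ * ε) →
      ∣ seq L K ∣ ≤ A → ∣ boxSum (roughTerm K) I J - 1ℚ ∣ ≤ e → A * e ≡ ½ * (½ * ε) →
      ∣ seq L K - seq L l ∣ ≤ ½ * ε → ∣ boxSum f I J - seq L l ∣ ≤ ε
    estimate K I J l A e h₁ h₂ h₃ Ae h₄ = begin
      ∣ B - y ∣                                        ≡⟨ cong ∣_∣ (solve 4 (λ B x R y → B :- y :=
                                                            ((B :+ :- x :* R) :+ x :* (R :- con 1ℚ)) :+ (x :- y)) refl B x R y) ⟩
      ∣ (B + - x * R) + x * (R - 1ℚ) + (x - y) ∣       ≤⟨ ∣p+q∣≤∣p∣+∣q∣ ((B + - x * R) + x * (R - 1ℚ)) (x - y) ⟩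
      ∣ (B + - x * R) + x * (R - 1ℚ) ∣ + ∣ x - y ∣     ≤⟨ +-monoˡ-≤ ∣ x - y ∣ (∣p+q∣≤∣p∣+∣q∣ (B + - x * R) (x * (R - 1ℚ))) ⟩
      ∣ B + - x * R ∣ + ∣ x * (R - 1ℚ) ∣ + ∣ x - y ∣   ≤⟨ +-mono-≤ (+-mono-≤ part₁ part₂) h₄ ⟩
      ½ * (½ * ε) + ½ * (½ * ε) + ½ * ε                ≡⟨ cong (_+ ½ * ε) (halves (½ * ε)) ⟩
      ½ * ε + ½ * ε                                    ≡⟨ halves ε ⟩
      ε                                                ∎
      where
      B = boxSum f I J
      R = boxSum (roughTerm K) I J
      x = seq L K
      y = seq L l
      part₁ : ∣ B + - x * R ∣ ≤ ½ * (½ * ε)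
      part₁ = subst (λ z → ∣ z ∣ ≤ ½ * (½ * ε)) (trans
        (boxSum-cong (λ i j → cong (f i j +_) (neg-distribˡ-* x (roughTerm K i j))) I J)
        (trans (boxSum-+ f (λ i j → - x * roughTerm K i j) I J) (cong (B +_) (boxSum-*ˡ (- x) (roughTerm K) I J)))) h₁
      part₂ : ∣ x * (R - 1ℚ) ∣ ≤ ½ * (½ * ε)
      part₂ = begin
        ∣ x * (R - 1ℚ) ∣         ≡⟨ ∣p*q∣≡∣p∣*∣q∣ x (R - 1ℚ) ⟩
        ∣ x ∣ * ∣ R - 1ℚ ∣       ≤⟨ *-mono-≤-abs x (R - 1ℚ) h₂ h₃ ⟩
        A * e                    ≡⟨ Ae ⟩
        ½ * (½ * ε)              ∎

  -- Convergence of the product S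

  stephensFactor : ℕ → ℚ
  stephensFactor p = 1ℚ - ν p * inv (cube∸1 p)

  -- The limit of these partial products is known as Stephens' constant.
  stephensProduct : ℕ → ℚ
  stephensProduct = ∏ℚ (λ p → guard* (prime? p) (stephensFactor p))

  -- With p = k + 1 the denominator satisfies p³ - 1 ≥ (p - 1) p² = k p².
  p/[p³-1]≤ : ∀ k .{{_ : NonZero k}} → ν (suc k) * inv (cube∸1 (suc k)) ≤ inv (k ℕ.* suc k)
  p/[p³-1]≤ k = begin
    ν p * inv (cube∸1 p)              ≤⟨ *-monoˡ-≤-nonNeg (ν p) {{ℚ.nonNegative (0≤ν p)}} (inv-anti-≤ {{ℕP.m*n≢0 p (k ℕ.* p) {{_}} {{ℕP.m*n≢0 k p}}}} bound) ⟩
    ν p * inv (p ℕ.* (k ℕ.* p))       ≡⟨ ν*inv* p (k ℕ.* p) ⟩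
    inv (k ℕ.* p)                     ∎
    where
    open ≤-Reasoning
    p = suc k
    instance
      k≢0 : NonZero k
      k≢0 = ℕ.≢-nonZero (ℕ.≢-nonZero⁻¹ k)
    lemma : ∀ k → suc k ℕ.* (suc k ℕ.* (suc k ℕ.* 1)) ≡ 1 ℕ.+ (suc k ℕ.* (k ℕ.* suc k) ℕ.+ (k ℕ.* k ℕ.+ (k ℕ.+ k)))
    lemma = solve-∀
    bound : p ℕ.* (k ℕ.* p) ℕ.≤ cube∸1 p
    bound = ℕP.≤-trans (ℕP.m≤m+n (p ℕ.* (k ℕ.* p)) (k ℕ.* k ℕ.+ (k ℕ.+ k))) (ℕP.≤-reflexive (sym (cong (ℕ._∸ 1) (lemma k))))

  -- 1 - a ≤ 1/(k(k+1)) = 1/k - 1/(k+1), which telescopes.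
  factor-bounds : ∀ k → .{{NonZero k}} → let a = guard* (prime? (suc k)) (stephensFactor (suc k)) in
    (0ℚ ≤ a) × (a ≤ 1ℚ) × (1ℚ + inv (suc k) ≤ a + inv k)
  factor-bounds k = go (prime? (suc k))
    where
    open ≤-Reasoning
    x = ν (suc k) * inv (cube∸1 (suc k))
    0≤x : 0ℚ ≤ x
    0≤x = 0≤* (0≤ν (suc k)) (0≤inv (cube∸1 (suc k)))
    x≤1 : x ≤ 1ℚ
    x≤1 = begin
      x                   ≤⟨ p/[p³-1]≤ k ⟩
      inv (k ℕ.* suc k)   ≤⟨ inv-anti-≤ {1} {k ℕ.* suc k} (ℕ.>-nonZero⁻¹ (k ℕ.* suc k) {{ℕP.m*n≢0 k (suc k)}}) ⟩
      inv 1               ≡⟨ trans (sym (*-identityˡ (inv 1))) (trans (cong (_* inv 1) (sym ν-1)) (ν*inv 1)) ⟩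
      1ℚ                  ∎
    1/[1+k]≤1/k : inv (suc k) ≤ inv k
    1/[1+k]≤1/k = inv-anti-≤ (ℕP.n≤1+n k)
    0≤1-x : 0ℚ ≤ 1ℚ - x
    0≤1-x = begin
      0ℚ      ≡⟨ sym (+-inverseʳ x) ⟩
      x - x   ≤⟨ +-monoˡ-≤ (- x) x≤1 ⟩
      1ℚ - x  ∎
    1-x≤1 : 1ℚ - x ≤ 1ℚ
    1-x≤1 = begin
      1ℚ - x        ≤⟨ p≤p+nonNeg 0≤x ⟩
      1ℚ - x + x    ≡⟨ solve 1 (λ x → con 1ℚ :- x :+ x := con 1ℚ) refl x ⟩
      1ℚ            ∎
    drop : 1ℚ + inv (suc k) ≤ 1ℚ - x + inv k
    drop = begin
      1ℚ + inv (suc k)                                  ≡⟨ solve 2 (λ x i → con 1ℚ :+ i := con 1ℚ :- x :+ (x :+ i)) refl x (inv (suc k)) ⟩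
      1ℚ - x + (x + inv (suc k))                        ≤⟨ +-monoʳ-≤ (1ℚ - x) (+-monoˡ-≤ (inv (suc k)) (p/[p³-1]≤ k)) ⟩
      1ℚ - x + (inv (k ℕ.* suc k) + inv (suc k))        ≡⟨ cong (1ℚ - x +_) (inv-suc-difference k) ⟩
      1ℚ - x + inv k                                    ∎
    go : (d : Dec (Prime (suc k))) → let a = guard* d (stephensFactor (suc k)) in
      (0ℚ ≤ a) × (a ≤ 1ℚ) × (1ℚ + inv (suc k) ≤ a + inv k)
    go (yes _) = 0≤1-x , 1-x≤1 , drop
    go (no _)  = nonNegative⁻¹ 1ℚ , ≤-refl , +-monoʳ-≤ 1ℚ 1/[1+k]≤1/k

  stephensProduct-1 : stephensProduct 1 ≡ 1ℚ
  stephensProduct-1 = cong (1ℚ *_) (guard*-no {d = prime? 1} {stephensFactor 1} ¬prime[1])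

  stephensProduct-unit : ∀ N → (0ℚ ≤ stephensProduct N) × (stephensProduct N ≤ 1ℚ)
  stephensProduct-unit zero       = nonNegative⁻¹ 1ℚ , ≤-refl
  -- `factor-bounds` compares with 1/k for k ≥ 1 and therefore starts with the factor at 2.
  stephensProduct-unit (suc zero) = subst (λ x → (0ℚ ≤ x) × (x ≤ 1ℚ)) (sym stephensProduct-1) (nonNegative⁻¹ 1ℚ , ≤-refl)
  stephensProduct-unit (suc N@(suc _)) with stephensProduct-unit N | factor-bounds N
  ... | 0≤P , P≤1 | 0≤a , a≤1 , _ = 0≤* 0≤P 0≤a , ≤-trans
    (*-mono-≤-nonNeg {stephensProduct N} {1ℚ} {guard* (prime? (suc N)) (stephensFactor (suc N))} {1ℚ} 0≤P P≤1 0≤a a≤1)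
    (≤-reflexive (*-identityˡ 1ℚ))

  -- Since the product stays between 0 and 1, a further factor a lowers it by at most 1 - a, and
  -- these losses telescope to 1/M - 1/(d + M). The inequality is written with sums on both sides.
  stephensProduct-decreases : ∀ M → .{{NonZero M}} → ∀ d →
    (stephensProduct (d ℕ.+ M) ≤ stephensProduct M) ×
    (stephensProduct M + inv (d ℕ.+ M) ≤ stephensProduct (d ℕ.+ M) + inv M)
  stephensProduct-decreases M zero    = ≤-refl , ≤-refl
  stephensProduct-decreases M (suc d) = ≤-trans Pa≤P (proj₁ IH) , bound
    where
    open ≤-Reasoning
    k = d ℕ.+ M
    instance
      k≢0 : NonZero k
      k≢0 = ℕ.>-nonZero (ℕP.<-≤-trans (ℕ.>-nonZero⁻¹ M) (ℕP.m≤n+m M d))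
    IH = stephensProduct-decreases M d
    P = stephensProduct k
    Q = stephensProduct M
    a = guard* (prime? (suc k)) (stephensFactor (suc k))
    fb = factor-bounds k
    0≤P = proj₁ (stephensProduct-unit k)
    P≤1 = proj₂ (stephensProduct-unit k)
    i = inv k
    i′ = inv (suc k)
    Pa≤P : P * a ≤ P
    Pa≤P = ≤-trans (*-monoˡ-≤-nonNeg P {{ℚ.nonNegative 0≤P}} (proj₁ (proj₂ fb))) (≤-reflexive (*-identityʳ P))
    0≤1-a : 0ℚ ≤ 1ℚ - a
    0≤1-a = ≤-trans (≤-reflexive (sym (+-inverseʳ a))) (+-monoˡ-≤ (- a) (proj₁ (proj₂ fb)))
    one-step : P + i′ ≤ P * a + i
    one-step = begin
      P + i′                           ≡⟨ solve 3 (λ P a i → P :+ i := P :* a :+ (P :* (con 1ℚ :- a) :+ i)) refl P a i′ ⟩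
      P * a + (P * (1ℚ - a) + i′)      ≤⟨ +-monoʳ-≤ (P * a) (+-monoˡ-≤ i′ (*-monoʳ-≤-nonNeg (1ℚ - a) {{ℚ.nonNegative 0≤1-a}} P≤1)) ⟩
      P * a + (1ℚ * (1ℚ - a) + i′)     ≡⟨ solve 3 (λ x a i → x :+ (con 1ℚ :* (con 1ℚ :- a) :+ i) := x :- a :+ (con 1ℚ :+ i)) refl (P * a) a i′ ⟩
      P * a - a + (1ℚ + i′)            ≤⟨ +-monoʳ-≤ (P * a - a) (proj₂ (proj₂ fb)) ⟩
      P * a - a + (a + i)              ≡⟨ solve 3 (λ x a i → x :- a :+ (a :+ i) := x :+ i) refl (P * a) a i ⟩
      P * a + i                        ∎
    bound : Q + i′ ≤ P * a + inv M
    bound = +-cancelˡ-≤ (P + i) (Q + i′) (P * a + inv M) (begin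
      P + i + (Q + i′)          ≡⟨ solve 4 (λ P i Q j → P :+ i :+ (Q :+ j) := (Q :+ i) :+ (P :+ j)) refl P i Q i′ ⟩
      (Q + i) + (P + i′)        ≤⟨ +-mono-≤ (proj₂ IH) one-step ⟩
      (P + inv M) + (P * a + i) ≡⟨ solve 4 (λ P m x i → (P :+ m) :+ (x :+ i) := P :+ i :+ (x :+ m)) refl P (inv M) (P * a) i ⟩
      P + i + (P * a + inv M)   ∎)

  close-below : ∀ {x y z e} → x ≤ z → y ≤ z → z ≤ x + e → z ≤ y + e → ∣ x - y ∣ ≤ e
  close-below {x} {y} {z} {e} x≤z y≤z z≤x+e z≤y+e with ∣p∣≡p∨∣p∣≡-p (x - y)
  ... | inj₁ eq = ≤-trans (≤-reflexive eq) (+-cancelˡ-≤ y (x - y) e (≤-trans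
    (≤-reflexive (solve 2 (λ x y → y :+ (x :- y) := x) refl x y)) (≤-trans x≤z z≤y+e)))
  ... | inj₂ eq = ≤-trans (≤-reflexive eq) (+-cancelˡ-≤ x (- (x - y)) e (≤-trans
    (≤-reflexive (solve 2 (λ x y → x :+ :- (x :- y) := y) refl x y)) (≤-trans y≤z z≤x+e)))

  -- All products from index M on lie at most 1/M below the M-th one, so any two of them differ by
  -- at most 1/M.
  stephensProduct-cauchy : IsCauchy stephensProduct
  stephensProduct-cauchy ε =
    let M , M≢0 , 1/M≤ε = archimedean ε
    in M , λ k l M≤k M≤l → ≤-trans
         (close-below {stephensProduct k} {stephensProduct l} {stephensProduct M} {inv M}
           (below M {{M≢0}} M≤k) (below M {{M≢0}} M≤l) (above M {{M≢0}} M≤k) (above M {{M≢0}} M≤l))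
         1/M≤ε
    where
    below : ∀ M .{{_ : NonZero M}} {k} → M ℕ.≤ k → stephensProduct k ≤ stephensProduct M
    below M {k} M≤k = subst (λ k → stephensProduct k ≤ stephensProduct M) (ℕP.m∸n+n≡m M≤k) (proj₁ (stephensProduct-decreases M (k ℕ.∸ M)))
    above : ∀ M .{{_ : NonZero M}} {k} → M ℕ.≤ k → stephensProduct M ≤ stephensProduct k + inv M
    above M {k} M≤k = subst (λ k → stephensProduct M ≤ stephensProduct k + inv M) (ℕP.m∸n+n≡m M≤k)
      (≤-trans (p≤p+nonNeg (0≤inv (k ℕ.∸ M ℕ.+ M))) (proj₂ (stephensProduct-decreases M (k ℕ.∸ M))))

  stephens : ℝ
  stephens = mkℝ stephensProduct stephensProduct-cauchy

  -- Partial sums and products of reals, and their limits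

  seq-∑ : ∀ ks f l → seq (∑ ks f) l ≡ foldr (λ k s → seq (f k) l + s) 0ℚ ks
  seq-∑ []       f l = refl
  seq-∑ (k ∷ ks) f l = cong (seq (f k) l +_) (seq-∑ ks f l)

  seq-∏ : ∀ ks f l → seq (∏ ks f) l ≡ foldr (λ k s → seq (f k) l * s) 1ℚ ks
  seq-∏ []       f l = refl
  seq-∏ (k ∷ ks) f l = cong (seq (f k) l *_) (seq-∏ ks f l)

  seq-∑-filter : ∀ {Q : Pred ℕ 0ℓ} (Q? : Decidable Q) f N l →
    seq (∑ (filter Q? [1‥ N ]) f) l ≡ ∑ℚ (λ k → guardℚ (Q? k) (seq (f k) l)) N
  seq-∑-filter Q? f N l = trans (seq-∑ (filter Q? [1‥ N ]) f l) (foldrℚ-filter-range Q? (λ k → seq (f k) l) N)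

  seq-∏-filter : ∀ {Q : Pred ℕ 0ℓ} (Q? : Decidable Q) f N l →
    seq (∏ (filter Q? [1‥ N ]) f) l ≡ ∏ℚ (λ k → guard* (Q? k) (seq (f k) l)) N
  seq-∏-filter Q? f N l = trans (seq-∏ (filter Q? [1‥ N ]) f l) (foldr*-filter-range Q? (λ k → seq (f k) l) N)

  -- The definition of `_⟶_` permits the threshold for l to depend on k and δ; here one threshold
  -- serves both indices.
  ⟶-intro : ∀ (x : ℕ → ℝ) L → (∀ ε .{{_ : Positive ε}} → ∃ λ N → ∀ k l → N ℕ.≤ k → N ℕ.≤ l → ∣ seq (x k) l - seq L l ∣ ≤ ε) → x ⟶ L
  ⟶-intro x L h ε =
    let N , close = h ε
    in N , λ k N≤k δ → N , λ l N≤l → ≤-trans (close k l N≤k N≤l) (p≤p+nonNeg (nonNegative⁻¹ δ {{pos⇒nonNeg δ}}))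

  -- Euler factors of the limit

  pos-∸ : ∀ {m n} → n ℕ.≤ m → ℤ.+ m ℤ.- ℤ.+ n ≡ ℤ.+ (m ℕ.∸ n)
  pos-∸ {m} {n} n≤m = trans (ℤP.m-n≡m⊖n m n) (ℤP.⊖-≥ n≤m)

  pos-cube : ∀ p → (ℤ.+ p) ℤ.^ 3 ≡ ℤ.+ (p ℕ.^ 3)
  pos-cube p = sym (trans (ℤP.pos-* p (p ℕ.^ 2)) (cong (ℤ.+ p ℤ.*_)
    (trans (ℤP.pos-* p (p ℕ.^ 1)) (cong (ℤ.+ p ℤ.*_) (ℤP.pos-* p 1)))))

  ι-² : ∀ z → ι (z ℤ.^ 2) ≡ ι z * ι z
  ι-² z = trans (ι-* z (z ℤ.^ 1)) (cong (ι z *_) (cong ι (ℤP.*-identityʳ z)))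

  ι-³ : ∀ z → ι (z ℤ.^ 3) ≡ ι z * ι z * ι z
  ι-³ z = trans (ι-* z (z ℤ.^ 2)) (trans (cong (ι z *_) (ι-² z)) (sym (*-assoc (ι z) (ι z) (ι z))))

  ι-⁴ : ∀ z → ι (z ℤ.^ 4) ≡ ι z * ι z * ι z * ι z
  ι-⁴ z = trans (ι-* z (z ℤ.^ 3)) (trans (cong (ι z *_) (ι-³ z)) (*-comm (ι z) (ι z * ι z * ι z)))

  //-seq-cong : ∀ a {d n} l → d ≡ ℤ.+ n → seq (a // d) l ≡ ι a * inv n
  //-seq-cong a {n = n} l refl = //-seq a n l

  -- At a prime the truncated subtractions are exact and the result is positive, because p + 2 ≤ 2p
  -- ≤ p² ≤ p³.
  cube∸p∸1 : ℕ → ℕ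
  cube∸p∸1 p = p ℕ.^ 3 ℕ.∸ p ℕ.∸ 1

  module _ {p} (pp : Prime p) where

    private
      P = ν p

      p+2≤p³ : p ℕ.+ 2 ℕ.≤ p ℕ.^ 3
      p+2≤p³ = ℕP.≤-trans (ℕP.+-monoʳ-≤ p (prime≥2 pp)) (ℕP.≤-trans
        (ℕP.≤-reflexive (cong (p ℕ.+_) (sym (ℕP.+-identityʳ p))))
        (ℕP.≤-trans (ℕP.*-monoˡ-≤ p (prime≥2 pp)) (ℕP.*-monoʳ-≤ p
          (ℕP.m≤m*n p (p ℕ.^ 1) {{ℕP.m^n≢0 p 1 {{prime⇒nonZero pp}}}}))))

      p≤p³ : p ℕ.≤ p ℕ.^ 3
      p≤p³ = ℕP.≤-trans (ℕP.m≤m+n p 2) p+2≤p³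

      2≤p³∸p : 2 ℕ.≤ p ℕ.^ 3 ℕ.∸ p
      2≤p³∸p = subst (ℕ._≤ p ℕ.^ 3 ℕ.∸ p) (ℕP.m+n∸m≡n p 2) (ℕP.∸-monoˡ-≤ p p+2≤p³)

    cube∸p∸1≢0 : NonZero (cube∸p∸1 p)
    cube∸p∸1≢0 = ℕ.>-nonZero (ℕP.m<n⇒0<n∸m 2≤p³∸p)

    pos-cube∸1 : (ℤ.+ p) ℤ.^ 3 ℤ.- ℤ.+ 1 ≡ ℤ.+ cube∸1 p
    pos-cube∸1 = trans (cong (ℤ._- ℤ.+ 1) (pos-cube p)) (pos-∸ (ℕP.≤-trans (ℕP.n≤1+n 1) (p³≥2 pp)))

    pos-cube∸p∸1 : (ℤ.+ p) ℤ.^ 3 ℤ.- ℤ.+ p ℤ.- ℤ.+ 1 ≡ ℤ.+ cube∸p∸1 p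
    pos-cube∸p∸1 = trans (cong (λ z → z ℤ.- ℤ.+ p ℤ.- ℤ.+ 1) (pos-cube p))
      (trans (cong (ℤ._- ℤ.+ 1) (pos-∸ p≤p³)) (pos-∸ (ℕP.≤-trans (ℕP.n≤1+n 1) 2≤p³∸p)))

    ν-cube∸p∸1 : ν (cube∸p∸1 p) ≡ P * P * P - P - 1ℚ
    ν-cube∸p∸1 = begin
      ι (ℤ.+ cube∸p∸1 p)                              ≡⟨ cong ι (sym pos-cube∸p∸1) ⟩
      ι ((ℤ.+ p) ℤ.^ 3 ℤ.- ℤ.+ p ℤ.- ℤ.+ 1)           ≡⟨ trans (ι-+ _ (ℤ.- ℤ.+ 1)) (cong₂ _+_ (ι-+ ((ℤ.+ p) ℤ.^ 3) (ℤ.- ℤ.+ p)) (ι-neg (ℤ.+ 1))) ⟩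
      ι ((ℤ.+ p) ℤ.^ 3) + ι (ℤ.- ℤ.+ p) - ν 1         ≡⟨ cong₂ _-_ (cong₂ _+_ (ι-³ (ℤ.+ p)) (ι-neg (ℤ.+ p))) ν-1 ⟩
      P * P * P - P - 1ℚ                              ∎
      where open ≡-Reasoning

    stephensFactor≡ : stephensFactor p ≡ ν (cube∸p∸1 p) * inv (cube∸1 p)
    stephensFactor≡ = begin
      1ℚ - P * D                       ≡⟨ cong (_- P * D) (sym (ν*inv (cube∸1 p) {{cube∸1≢0 pp}})) ⟩
      ν (cube∸1 p) * D - P * D         ≡⟨ cong (λ x → x * D - P * D) (ν-cube∸1 pp) ⟩
      (P * P * P - 1ℚ) * D - P * D     ≡⟨ solve 2 (λ p d → (p :* p :* p :- con 1ℚ) :* d :- p :* d := (p :* p :* p :- p :- con 1ℚ) :* d) refl P D ⟩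
      (P * P * P - P - 1ℚ) * D         ≡⟨ cong (_* D) (sym ν-cube∸p∸1) ⟩
      ν (cube∸p∸1 p) * D               ∎
      where
      open ≡-Reasoning
      D = inv (cube∸1 p)

    -- The numerator p³ - p - 1 of the factor of S cancels against the denominator in the finite
    -- products. This is how Euler factors over p³ - 1 become the fractions over p³ - p - 1 in the
    -- theorem.
    rescale : ∀ x → stephensFactor p * (x * inv (cube∸p∸1 p)) ≡ inv (cube∸1 p) * x
    rescale x = begin
      stephensFactor p * (x * E)     ≡⟨ cong (_* (x * E)) stephensFactor≡ ⟩
      ν e * D * (x * E)              ≡⟨ solve 4 (λ e D x E → e :* D :* (x :* E) := D :* x :* (e :* E)) refl (ν e) D x E ⟩
      D * x * (ν e * E)              ≡⟨ trans (cong (D * x *_) (ν*inv e {{cube∸p∸1≢0}})) (*-identityʳ (D * x)) ⟩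
      D * x                          ∎
      where
      open ≡-Reasoning
      e = cube∸p∸1 p
      E = inv e
      D = inv (cube∸1 p)

  divisorFactor quotientFactor : ℕ → ℚ
  divisorFactor p  = - (ν p * ν p * ν p * ν p) * inv (cube∸p∸1 p)
  quotientFactor p = (ν p * ν p * ν p + ν p * ν p) * inv (cube∸p∸1 p)

  seq-divisorFactor : ∀ {p} → Prime p → ∀ l →
    seq ((ℤ.- ((ℤ.+ p) ℤ.^ 4)) // ((ℤ.+ p) ℤ.^ 3 ℤ.- ℤ.+ p ℤ.- ℤ.+ 1)) l ≡ divisorFactor p
  seq-divisorFactor {p} pp l = trans (//-seq-cong (ℤ.- ((ℤ.+ p) ℤ.^ 4)) l (pos-cube∸p∸1 pp))
    (cong (_* inv (cube∸p∸1 p)) (trans (ι-neg ((ℤ.+ p) ℤ.^ 4)) (cong -_ (ι-⁴ (ℤ.+ p)))))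

  seq-quotientFactor : ∀ {p} → Prime p → ∀ l →
    seq (((ℤ.+ p) ℤ.^ 3 ℤ.+ (ℤ.+ p) ℤ.^ 2) // ((ℤ.+ p) ℤ.^ 3 ℤ.- ℤ.+ p ℤ.- ℤ.+ 1)) l ≡ quotientFactor p
  seq-quotientFactor {p} pp l = trans (//-seq-cong ((ℤ.+ p) ℤ.^ 3 ℤ.+ (ℤ.+ p) ℤ.^ 2) l (pos-cube∸p∸1 pp))
    (cong (_* inv (cube∸p∸1 p)) (trans (ι-+ ((ℤ.+ p) ℤ.^ 3) ((ℤ.+ p) ℤ.^ 2)) (cong₂ _+_ (ι-³ (ℤ.+ p)) (ι-² (ℤ.+ p)))))

  seq-stephensFactor : ∀ {p} → Prime p → ∀ l → seq (1ℝ -ℝ (ℤ.+ p // ((ℤ.+ p) ℤ.^ 3 ℤ.- ℤ.+ 1))) l ≡ stephensFactor p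
  seq-stephensFactor {p} pp l = cong (λ x → 1ℚ - x) (//-seq-cong (ℤ.+ p) l (pos-cube∸1 pp))

  guard*-prime : ∀ {x y} p → (Prime p → x ≡ y) → guard* (prime? p) x ≡ guard* (prime? p) y
  guard*-prime {x} {y} p = go (prime? p)
    where
    go : (d : Dec (Prime p)) → (Prime p → x ≡ y) → guard* d x ≡ guard* d y
    go (yes pp) h = h pp
    go (no _)   h = refl

  -- Extending the finite products up to l lets them be multiplied with the partial product of S
  -- factor by factor.
  foldr-primeDivisors : ∀ n (h h′ : ℕ → ℚ) → (∀ {p} → Prime p → h p ≡ h′ p) → .{{_ : NonZero n}} → ∀ {l} → n ℕ.≤ l →
    foldr (λ p x → h p * x) 1ℚ (primeDivisors n) ≡ ∏ℚ (λ p → guard* (prime-divisor? n p) (h′ p)) l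
  foldr-primeDivisors n h h′ h≡ {l} n≤l = begin
    foldr (λ p x → h p * x) 1ℚ (primeDivisors n)
      ≡⟨ foldr*-filter-range (prime-divisor? n) h n ⟩
    ∏ℚ (λ p → guard* (prime-divisor? n p) (h p)) n
      ≡⟨ ∏ℚ-cong (λ p → guard-≡ p (prime? p) (p ∣? n)) n ⟩
    ∏ℚ (λ p → guard* (prime-divisor? n p) (h′ p)) n
      ≡⟨ sym (∏ℚ-extend n≤l λ p n<p → guard*-no {d = prime-divisor? n p} {x = h′ p} λ (_ , p∣n) → >⇒∤ n<p p∣n) ⟩
    ∏ℚ (λ p → guard* (prime-divisor? n p) (h′ p)) l ∎
    where
    open ≡-Reasoning
    guard-≡ : ∀ p (d : Dec (Prime p)) (e : Dec (p ∣ n)) → guard* (d ×-dec e) (h p) ≡ guard* (d ×-dec e) (h′ p)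
    guard-≡ p (yes pp) (yes _) = h≡ pp
    guard-≡ p (yes _)  (no _)  = refl
    guard-≡ p (no _)   _       = refl

  module _ (m n : ℕ) .{{_ : NonZero m}} .{{_ : NonZero n}} where

    onDivisors onQuotients : ℕ → ℚ
    onDivisors  p = guard* (prime-divisor? n p) (divisorFactor p)
    onQuotients p = guard* (prime-divisor? m p) (guard* (¬? (p ∣? n)) (quotientFactor p))

    euler-factor : ∀ p → guard* (prime? p) (stephensFactor p) * onDivisors p * onQuotients p
      ≡ guard* (prime? p) (euler m n p)
    euler-factor p = go (prime? p) (p ∣? m) (p ∣? n)
      where
      open ≡-Reasoning
      s = stephensFactor p
      guard-1 : ∀ {A : Set} (d : Dec A) → guard* d 1ℚ ≡ 1ℚ
      guard-1 (yes _) = refl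
      guard-1 (no _)  = refl
      numerator-∣ : ∀ {A B : Set} (x : B) (e : Dec A) → - (ν p * ν p * ν p * ν p) ≡ numerator (ν p) e (yes x)
      numerator-∣ x (yes _) = refl
      numerator-∣ x (no _)  = refl
      go : (d : Dec (Prime p)) (e : Dec (p ∣ m)) (f : Dec (p ∣ n)) →
        guard* d s * guard* (d ×-dec f) (divisorFactor p) * guard* (d ×-dec e) (guard* (¬? f) (quotientFactor p))
        ≡ guard* d (inv (cube∸1 p) * numerator (ν p) e f)
      go (no _) _ _ = refl
      go (yes pp) e (yes p∣n) = begin
        s * divisorFactor p * guard* (yes pp ×-dec e) 1ℚ
          ≡⟨ trans (cong (s * divisorFactor p *_) (guard-1 (yes pp ×-dec e))) (*-identityʳ (s * divisorFactor p)) ⟩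
        s * divisorFactor p
          ≡⟨ rescale pp (- (ν p * ν p * ν p * ν p)) ⟩
        inv (cube∸1 p) * - (ν p * ν p * ν p * ν p)
          ≡⟨ cong (inv (cube∸1 p) *_) (numerator-∣ p∣n e) ⟩
        inv (cube∸1 p) * numerator (ν p) e (yes p∣n) ∎
      go (yes pp) (yes _) (no _) = trans (cong (_* quotientFactor p) (*-identityʳ s)) (rescale pp (ν p * ν p * ν p + ν p * ν p))
      go (yes pp) (no _) (no _) = begin
        s * 1ℚ * 1ℚ                                ≡⟨ trans (*-identityʳ (s * 1ℚ)) (*-identityʳ s) ⟩
        s                                          ≡⟨ stephensFactor≡ pp ⟩
        ν (cube∸p∸1 p) * inv (cube∸1 p)            ≡⟨ *-comm (ν (cube∸p∸1 p)) (inv (cube∸1 p)) ⟩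
        inv (cube∸1 p) * ν (cube∸p∸1 p)            ≡⟨ cong (inv (cube∸1 p) *_) (ν-cube∸p∸1 pp) ⟩
        inv (cube∸1 p) * (ν p * ν p * ν p - ν p - 1ℚ) ∎

    stephens-euler : ∀ l → inv (m ℕ.^ 3 ℕ.* n ℕ.^ 3) * (stephensProduct l * ∏ℚ onDivisors l * ∏ℚ onQuotients l) ≡ eulerValue m n l
    stephens-euler l = cong (inv (m ℕ.^ 3 ℕ.* n ℕ.^ 3) *_) (begin
      stephensProduct l * ∏ℚ onDivisors l * ∏ℚ onQuotients l
        ≡⟨ cong (_* ∏ℚ onQuotients l) (sym (∏ℚ-* (λ p → guard* (prime? p) (stephensFactor p)) onDivisors l)) ⟩
      ∏ℚ (λ p → guard* (prime? p) (stephensFactor p) * onDivisors p) l * ∏ℚ onQuotients l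
        ≡⟨ sym (∏ℚ-* (λ p → guard* (prime? p) (stephensFactor p) * onDivisors p) onQuotients l) ⟩
      ∏ℚ (λ p → guard* (prime? p) (stephensFactor p) * onDivisors p * onQuotients p) l
        ≡⟨ ∏ℚ-cong (λ p → euler-factor p) l ⟩
      eulerProduct m n l ∎)
      where open ≡-Reasoning

    -- For l ≥ m and l ≥ n all primes dividing m or n are already among the factors up to l, so the
    -- approximation is an exact finite Euler product.
    seq-limit : ∀ {f₁ f₂ : ℕ → ℝ} → (∀ {p} → Prime p → ∀ l → seq (f₁ p) l ≡ divisorFactor p) →
      (∀ {p} → Prime p → ∀ l → seq (f₂ p) l ≡ quotientFactor p) → ∀ {l} → m ℕ.≤ l → n ℕ.≤ l →
      seq ((stephens *ℝ (ℤ.+ 1 // ℤ.+ (m ℕ.^ 3 ℕ.* n ℕ.^ 3))) *ℝ ∏ (primeDivisors n) f₁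
            *ℝ ∏ (filter (λ p → ¬? (p ∣? n)) (primeDivisors m)) f₂) l ≡ eulerValue m n l
    seq-limit {f₁} {f₂} f₁≡ f₂≡ {l} m≤l n≤l = begin
      stephensProduct l * seq (ℤ.+ 1 // ℤ.+ N) l * seq (∏ (primeDivisors n) f₁) l
        * seq (∏ (filter ∤n? (primeDivisors m)) f₂) l
        ≡⟨ cong₂ _*_ (cong₂ _*_ (cong (stephensProduct l *_) (trans (//-seq (ℤ.+ 1) N l) (trans (cong (_* inv N) ν-1) (*-identityˡ (inv N)))))
             (trans (seq-∏ (primeDivisors n) f₁ l)
                    (foldr-primeDivisors n (λ p → seq (f₁ p) l) divisorFactor (λ pp → f₁≡ pp l) n≤l)))
             (trans (seq-∏ (filter ∤n? (primeDivisors m)) f₂ l) (trans (foldr*-filter ∤n? (λ p → seq (f₂ p) l) (primeDivisors m))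
                    (foldr-primeDivisors m (λ p → guard* (∤n? p) (seq (f₂ p) l)) (λ p → guard* (∤n? p) (quotientFactor p))
                      (λ {p} pp → cong (guard* (∤n? p)) (f₂≡ pp l)) m≤l))) ⟩
      stephensProduct l * inv N * ∏ℚ onDivisors l * ∏ℚ onQuotients l
        ≡⟨ solve 4 (λ s i x y → s :* i :* x :* y := i :* (s :* x :* y)) refl (stephensProduct l) (inv N) (∏ℚ onDivisors l) (∏ℚ onQuotients l) ⟩
      inv N * (stephensProduct l * ∏ℚ onDivisors l * ∏ℚ onQuotients l)
        ≡⟨ stephens-euler l ⟩
      eulerValue m n l ∎
      where
      open ≡-Reasoning
      N = m ℕ.^ 3 ℕ.* n ℕ.^ 3
      ∤n? : Decidable (_∤ n)
      ∤n? p = ¬? (p ∣? n)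

    -- The inner sums and the iterated sum

    rowTerm : ℕ → ℕ → ℚ
    rowTerm i j = guardℚ (m ℕ.* n ∣? i ℕ.* j) (summandℚ i j)

    rowTerm-dominated : Dominated rowTerm
    rowTerm-dominated i j = ∣guardℚ∣≤ (m ℕ.* n ∣? i ℕ.* j) (summandℚ-dominated i j)

    decay≤mass : ∀ i → .{{NonZero i}} → decay i ≤ mass
    decay≤mass (suc i) = begin
      decay (suc i)               ≡⟨ sym (+-identityˡ (decay (suc i))) ⟩
      0ℚ + decay (suc i)          ≤⟨ +-monoˡ-≤ (decay (suc i)) (∑ℚ-nonNeg (λ k → 0≤decay k) i) ⟩
      ∑ℚ decay (suc i)            ≤⟨ ∑decay≤mass (suc i) ⟩
      mass                     ∎
      where open ≤-Reasoning

    row-cauchy : ∀ i → .{{NonZero i}} → IsCauchy (∑ℚ (rowTerm i))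
    row-cauchy i ε =
      let M , small = ∑decay-tail-scaled ε
      in M , λ k l M≤k M≤l → symmetric k l
           (λ k≤l → bound k l k≤l (small {k} M≤k (l ℕ.∸ k)))
           (λ l≤k → bound l k l≤k (small {l} M≤l (k ℕ.∸ l)))
      where
      open ≤-Reasoning
      R = ∑ℚ (rowTerm i)
      bound : ∀ k l → k ℕ.≤ l → mass * ∑ℚ (λ j → decay (k ℕ.+ j)) (l ℕ.∸ k) ≤ ½ * ε → ∣ R l - R k ∣ ≤ ε
      bound k l k≤l h = begin
        ∣ R l - R k ∣                                 ≤⟨ column-tail rowTerm-dominated i k≤l ⟩
        decay i * ∑ℚ (λ j → decay (k ℕ.+ j)) (l ℕ.∸ k)        ≤⟨ *-monoʳ-≤-nonNeg (∑ℚ (λ j → decay (k ℕ.+ j)) (l ℕ.∸ k)) {{ℚ.nonNegative (0≤∑decay k (l ℕ.∸ k))}} (decay≤mass i) ⟩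
        mass * ∑ℚ (λ j → decay (k ℕ.+ j)) (l ℕ.∸ k)        ≤⟨ h ⟩
        ½ * ε                                         ≤⟨ ½ε≤ε ε ⟩
        ε                                             ∎
      symmetric : ∀ k l → (k ℕ.≤ l → ∣ R l - R k ∣ ≤ ε) → (l ℕ.≤ k → ∣ R k - R l ∣ ≤ ε) → ∣ R k - R l ∣ ≤ ε
      symmetric k l h₁ h₂ with ℕP.≤-total k l
      ... | inj₁ k≤l = subst (_≤ ε) (dist-sym (R l) (R k)) (h₁ k≤l)
      ... | inj₂ l≤k = h₂ l≤k

    -- The real is represented by the partial sums of its own series. The value at 0 is a
    -- placeholder, as i starts at 1.
    innerSum : ℕ → ℝ
    innerSum zero      = 0ℝ
    innerSum i@(suc _) = mkℝ (∑ℚ (rowTerm i)) (row-cauchy i)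

    seq-innerSum : ∀ i → .{{NonZero i}} → ∀ l → seq (innerSum i) l ≡ ∑ℚ (rowTerm i) l
    seq-innerSum (suc _) l = refl

  -- When L is represented by the partial values themselves, convergence to L is nothing but the
  -- Cauchy property of that sequence.
  ⟶-partial : ∀ (x : ℕ → ℝ) (L : ℝ) → (∀ N l → seq (x N) l ≡ seq L N) → x ⟶ L
  ⟶-partial x L h = ⟶-intro x L λ ε →
    let N , close = cauchy L ε
    in N , λ k l N≤k N≤l → subst (λ z → ∣ z - seq L l ∣ ≤ ε) (sym (h k l)) (close k l N≤k N≤l)

  hasProduct-stephens : ∀ f → (∀ {p} → Prime p → ∀ l → seq (f p) l ≡ stephensFactor p) → HasProduct prime? f stephens
  hasProduct-stephens f f≡ = ⟶-partial (λ N → ∏ (filter prime? [1‥ N ]) f) stephens λ N l → trans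
    (seq-∏-filter prime? f N l) (∏ℚ-cong (λ p → guard*-prime p λ pp → f≡ pp l) N)

  module _ (m n : ℕ) .{{_ : NonZero m}} .{{_ : NonZero n}}
    (f : ℕ → ℕ → ℝ) (f≡ : ∀ i j l → seq (f i j) l ≡ summandℚ i j)
    (L : ℝ) (L≡ : ∀ {l} → m ℕ.≤ l → n ℕ.≤ l → seq L l ≡ eulerValue m n l) where

    inner-partial : ∀ i → .{{NonZero i}} → ∀ N l →
      seq (∑ (filter (λ j → m ℕ.* n ∣? i ℕ.* j) [1‥ N ]) (f i)) l ≡ seq (innerSum m n i) N
    inner-partial i N l = begin
      seq (∑ (filter (λ j → m ℕ.* n ∣? i ℕ.* j) [1‥ N ]) (f i)) l
        ≡⟨ seq-∑-filter (λ j → m ℕ.* n ∣? i ℕ.* j) (f i) N l ⟩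
      ∑ℚ (λ j → guardℚ (m ℕ.* n ∣? i ℕ.* j) (seq (f i j) l)) N
        ≡⟨ ∑ℚ-cong (λ j → cong (guardℚ (m ℕ.* n ∣? i ℕ.* j)) (f≡ i j l)) N ⟩
      ∑ℚ (rowTerm m n i) N
        ≡⟨ sym (seq-innerSum m n i N) ⟩
      seq (innerSum m n i) N ∎
      where open ≡-Reasoning

    -- The l-th approximation of an inner sum is its l-th partial sum. So truncating the outer
    -- series at I and then taking the l-th rational approximation gives the I by l box, which is
    -- why box sums have two independent sides.
    outer-partial : ∀ I l → seq (∑ (filter (λ i → m ∣? i) [1‥ I ]) (innerSum m n)) l ≡ boxSum (admissible m n) I l
    outer-partial I l = begin
      seq (∑ (filter (λ i → m ∣? i) [1‥ I ]) (innerSum m n)) l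
        ≡⟨ seq-∑-filter (λ i → m ∣? i) (innerSum m n) I l ⟩
      ∑ℚ (λ i → guardℚ (m ∣? i) (seq (innerSum m n i) l)) I
        ≡⟨ ∑ℚ-cong (λ i → trans (cong (guardℚ (m ∣? i)) (seq-innerSum m n i l))
                                (sym (guard-∑ (m ∣? i) (rowTerm m n i) l))) I ⟩
      boxSum (admissible m n) I l ∎
      where open ≡-Reasoning

    null-limit : ∀ {K} → m ℕ.⊔ n ℕ.≤ K → Null (λ i j → admissible m n i j - seq L K * roughTerm K i j)
    null-limit {K} K≥ = subst (λ x → Null (λ i j → admissible m n i j - x * roughTerm K i j))
      (sym (L≡ {K} m≤K n≤K)) (null-euler m n {K} m≤K n≤K)
      where
      m≤K : m ℕ.≤ K
      m≤K = ⊔ˡ {m} {n} K≥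
      n≤K : n ℕ.≤ K
      n≤K = ⊔ʳ {m} {n} K≥

    hasSum-inner : ∀ i .{{_ : NonZero i}} → HasSum (λ j → m ℕ.* n ∣? i ℕ.* j) (f i) (innerSum m n i)
    hasSum-inner i = ⟶-partial (λ N → ∑ (filter (λ j → m ℕ.* n ∣? i ℕ.* j) [1‥ N ]) (f i)) (innerSum m n i)
      (λ N l → inner-partial i N l)

    outer-close : ∀ ε .{{_ : Positive ε}} → ∃ λ M → ∀ k l → M ℕ.≤ k → M ℕ.≤ l →
      ∣ seq (∑ (filter (λ i → m ∣? i) [1‥ k ]) (innerSum m n)) l - seq L l ∣ ≤ ε
    outer-close ε =
      let M , close = boxSum-limit (admissible m n) L (m ℕ.⊔ n) null-limit ε
      in M , λ k l M≤k M≤l → subst (λ z → ∣ z - seq L l ∣ ≤ ε) (sym (outer-partial k l))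
           (close {k} {l} {l} M≤k M≤l M≤l)

    hasSum-outer : HasSum (λ i → m ∣? i) (innerSum m n) L
    hasSum-outer = ⟶-intro (λ I → ∑ (filter (λ i → m ∣? i) [1‥ I ]) (innerSum m n)) L outer-close

    hasIteratedSum : HasIteratedSum (λ i → m ∣? i) (λ i j → m ℕ.* n ∣? i ℕ.* j) f L
    hasIteratedSum = innerSum m n , (λ i _ → hasSum-inner i) , hasSum-outer

  hasIteratedSum-eulerProduct : ∀ m n → .{{_ : NonZero m}} → .{{_ : NonZero n}} →
    ∀ f → (∀ i j l → seq (f i j) l ≡ summandℚ i j) →
    ∀ f₁ → (∀ {p} → Prime p → ∀ l → seq (f₁ p) l ≡ divisorFactor p) →
    ∀ f₂ → (∀ {p} → Prime p → ∀ l → seq (f₂ p) l ≡ quotientFactor p) →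
    HasIteratedSum (λ i → m ∣? i) (λ i j → m ℕ.* n ∣? i ℕ.* j) f
      ((stephens *ℝ (ℤ.+ 1 // ℤ.+ (m ℕ.^ 3 ℕ.* n ℕ.^ 3))) *ℝ ∏ (primeDivisors n) f₁
        *ℝ ∏ (filter (λ p → ¬? (p ∣? n)) (primeDivisors m)) f₂)
  hasIteratedSum-eulerProduct m n f f≡ f₁ f₁≡ f₂ f₂≡ = hasIteratedSum m n f f≡
    ((stephens *ℝ (ℤ.+ 1 // ℤ.+ (m ℕ.^ 3 ℕ.* n ℕ.^ 3))) *ℝ ∏ (primeDivisors n) f₁
      *ℝ ∏ (filter (λ p → ¬? (p ∣? n)) (primeDivisors m)) f₂)
    (seq-limit m n {f₁} {f₂} f₁≡ f₂≡)

open import Defs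
open import Data.Integer as ℤ using (+_)
open import Data.List using (filter)
open import Data.Nat using (ℕ; NonZero; _*_; _^_)
open import Data.Nat.Divisibility using (_∣?_)
open import Data.Nat.Primality using (prime?)
open import Data.Product using (∃; _×_; _,_)
open import Relation.Nullary using (¬?)

theorem4p2 : ∃ λ (S : ℝ) →
    HasProduct prime? (λ p → 1ℝ -ℝ (+ p // ((+ p) ℤ.^ 3 ℤ.- + 1))) S
    × (∀ (m n : ℕ) .{{_ : NonZero m}} .{{_ : NonZero n}} →
    HasIteratedSum (λ i → m ∣? i) (λ i j → m * n ∣? i * j)
    (λ i j → μ j // + (i ^ 2 * j * φ (i * j)))
    ( (S *ℝ (+ 1 // + (m ^ 3 * n ^ 3)))
    *ℝ ∏ (primeDivisors n)
    (λ p → (ℤ.- ((+ p) ℤ.^ 4)) // ((+ p) ℤ.^ 3 ℤ.- + p ℤ.- + 1))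
    *ℝ ∏ (filter (λ p → ¬? (p ∣? n)) (primeDivisors m))
    (λ p → ((+ p) ℤ.^ 3 ℤ.+ (+ p) ℤ.^ 2) // ((+ p) ℤ.^ 3 ℤ.- + p ℤ.- + 1))))
theorem4p2 = stephens ,
  hasProduct-stephens (λ p → 1ℝ -ℝ (+ p // ((+ p) ℤ.^ 3 ℤ.- + 1))) seq-stephensFactor ,
  λ m n → hasIteratedSum-eulerProduct m n
    (λ i j → μ j // + (i ^ 2 * j * φ (i * j))) (λ i j → //-seq (μ j) (i ^ 2 * j * φ (i * j)))
    (λ p → (ℤ.- ((+ p) ℤ.^ 4)) // ((+ p) ℤ.^ 3 ℤ.- + p ℤ.- + 1)) seq-divisorFactor
    (λ p → ((+ p) ℤ.^ 3 ℤ.+ (+ p) ℤ.^ 2) // ((+ p) ℤ.^ 3 ℤ.- + p ℤ.- + 1)) seq-quotientFactor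
  where open DoubleSeries
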